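{- Let $\mathcal{F}$ be a real closed field and let $C_1, C_2$ be Dedekind cuts in $\mathcal{F}$ induced by the indiscernible sequences $\bar{\mathbf a} = \langle a_t : t \in I\rangle$ and $\bar{\mathbf b} = \langle b_s : s \in J\rangle$ of elements of $\mathcal{F}$, respectively. Then $C_2$ is positively equivalent to $C_1$ if and only if $\bar{\mathbf a}, \bar{\mathbf b}$ are not $\mathcal{F}$-perpendicular.
   Context: We work in the theory of real closed fields in the language $\langle +,\cdot,0,1,<\rangle$. Indiscernibility is with respect to this language. A cut in $\mathcal{F}$ is a pair $C=(C^-,C^+)$ with $C^-$ an initial segment of $\mathcal{F}$, $C^+$ an end segment, $C^-\cup C^+=\mathcal{F}$, $C^-\cap C^+=\emptyset$; it is Dedekind if $C^-$ has no maximum and $C^+$ has no minimum. If $\bar{\mathbf a}=\langle a_t:t\in I\rangle$ is a strictly increasing indiscernible sequence, the cut induced by $\bar{\mathbf a}$ in $\mathcal{F}$ is $(C^-,C^+)$ where $C^-$ is the downward closure of $\{a_t : t\in I\}$ in $\mathcal{F}$. An interval around a cut $C$ is an interval $(d,e)$ of $\mathcal{F}$ with $d\in C^-$, $e\in C^+$. Dedekind cuts $C_1,C_2$ are positively equivalent if there is a function $f$, definable in $\mathcal{F}$ with parameters from $\mathcal{F}$, which is strictly increasing from some interval $I_1$ around $C_1$ onto some interval $I_2$ around $C_2$ and respects the cuts, i.e. $f(I_1\cap C_1^-)=I_2\cap C_2^-$. For a formula $\varphi$, $\varphi^1=\varphi$ and $\varphi^0=\neg\varphi$. "For every large enough $t\in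 I$, $P(t)$" means: there is $t_0\in I$ with $P(t)$ for all $t\ge t_0$. Two indiscernible sequences $\langle a_t:t\in I\rangle$, $\langle b_s:s\in J\rangle$ with all entries in $\mathcal{F}$ are $\mathcal{F}$-perpendicular if for every formula $\varphi(x,y,\bar z)$ and every tuple $\bar d$ from $\mathcal{F}$ there is a truth value $\mathbf t\in\{0,1\}$ such that: for every large enough $t\in I$, for every large enough $s\in J$, $\models\varphi[a_t,b_s,\bar d]^{\mathbf t}$; and for every large enough $s\in J$, for every large enough $t\in I$, $\models\varphi[a_t,b_s,\bar d]^{\mathbf t}$.
   Formalization: The Dedekind cuts are required to have both sides nonempty; for a sequence cofinal in the field no interval around its cut exists, and the claim as literally stated fails (take both sequences equal and cofinal). -}

module Defs where

open import Level using (0ℓ)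
open import Data.Nat using (ℕ; zero; suc; _+_)
open import Data.Fin using (Fin; zero; suc)
open import Data.Bool using (Bool; true; false)
open import Data.Product using (Σ; ∃; _×_; _,_)
open import Data.Sum using (_⊎_)
open import Data.Empty using (⊥)
open import Relation.Nullary using (¬_)
open import Relation.Binary.PropositionalEquality using (_≡_)
open import Relation.Binary.Structures using (IsStrictTotalOrder)
open import Algebra.Structures using (IsCommutativeRing)
open import Data.Vec.Functional using (_∷_)
open import Function.Bundles using (_⇔_)

record OrderedField : Set₁ where
  infixl 6 _+F_
  infixl 7 _*F_
  infix 4 _<F_
  field
    Carrier   : Set
    _+F_ _*F_ : Carrier → Carrier → Carrier
    -F_       : Carrier → Carrier
    0F 1F     : Carrier
    _<F_      : Carrier → Carrier → Set
    isCommutativeRing   : IsCommutativeRing _≡_ _+F_ _*F_ -F_ 0F 1F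
    0≢1                 : ¬ (0F ≡ 1F)
    inverse             : ∀ x → ¬ (x ≡ 0F) → ∃ λ y → x *F y ≡ 1F
    isStrictTotalOrder  : IsStrictTotalOrder _≡_ _<F_
    +-mono-<            : ∀ x y z → x <F y → x +F z <F y +F z
    *-pos               : ∀ x y → 0F <F x → 0F <F y → 0F <F x *F y

  _≤F_ : Carrier → Carrier → Set
  x ≤F y = x <F y ⊎ x ≡ y

  pow : Carrier → ℕ → Carrier
  pow x zero    = 1F
  pow x (suc n) = x *F pow x n

  sumF : ∀ n → (Fin n → Carrier) → Carrier
  sumF zero    c = 0F
  sumF (suc n) c = c zero +F sumF n (λ i → c (suc i))

record RealClosedField : Set₁ where
  field
    orderedField : OrderedField
  open OrderedField orderedField
  field
    sqrt    : ∀ x → 0F <F x → ∃ λ y → y *F y ≡ x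
    oddRoot : ∀ m → (c : Fin (suc (m + m)) → Carrier) →
              ∃ λ x → pow x (suc (m + m)) +F sumF (suc (m + m)) (λ i → c i *F pow x (Data.Fin.toℕ i)) ≡ 0F
  open OrderedField orderedField public

data Term (n : ℕ) : Set where
  var  : Fin n → Term n
  zer  : Term n
  one  : Term n
  plus : Term n → Term n → Term n
  mult : Term n → Term n → Term n

data Formula : ℕ → Set where
  eq   : ∀ {n} → Term n → Term n → Formula n
  less : ∀ {n} → Term n → Term n → Formula n
  neg  : ∀ {n} → Formula n → Formula n
  conj : ∀ {n} → Formula n → Formula n → Formula n
  ex   : ∀ {n} → Formula (suc n) → Formula n

_^tv_ : ∀ {n} → Formula n → Bool → Formula n
φ ^tv true  = φ
φ ^tv false = neg φ

module _ (F : RealClosedField) where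
  open RealClosedField F

  evalT : ∀ {n} → Term n → (Fin n → Carrier) → Carrier
  evalT (var i)    ρ = ρ i
  evalT zer        ρ = 0F
  evalT one        ρ = 1F
  evalT (plus s t) ρ = evalT s ρ +F evalT t ρ
  evalT (mult s t) ρ = evalT s ρ *F evalT t ρ

  Sat : ∀ {n} → Formula n → (Fin n → Carrier) → Set
  Sat (eq s t)   ρ = evalT s ρ ≡ evalT t ρ
  Sat (less s t) ρ = evalT s ρ <F evalT t ρ
  Sat (neg φ)    ρ = ¬ Sat φ ρ
  Sat (conj φ ψ) ρ = Sat φ ρ × Sat ψ ρ
  Sat (ex φ)     ρ = Σ Carrier λ x → Sat φ (x ∷ ρ)

record LinOrder : Set₁ where
  field
    Idx  : Set
    _<I_ : Idx → Idx → Set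
    isStrictTotalOrder : IsStrictTotalOrder _≡_ _<I_
  _≤I_ : Idx → Idx → Set
  s ≤I t = s <I t ⊎ s ≡ t

open LinOrder public

EventuallyIn : (I : LinOrder) → (Idx I → Set) → Set
EventuallyIn I P = Σ (Idx I) λ t₀ → ∀ t → _≤I_ I t₀ t → P t

module _ (F : RealClosedField) where
  open RealClosedField F

  StrictlyIncreasing : (I : LinOrder) → (Idx I → Carrier) → Set
  StrictlyIncreasing I a = ∀ s t → _<I_ I s t → a s <F a t

  Indiscernible : (I : LinOrder) → (Idx I → Carrier) → Set
  Indiscernible I a =
    ∀ n (φ : Formula n) (u v : Fin n → Idx I) →
    (∀ i j → i Data.Fin.< j → _<I_ I (u i) (u j)) →
    (∀ i j → i Data.Fin.< j → _<I_ I (v i) (v j)) →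
    Sat F φ (λ i → a (u i)) ⇔ Sat F φ (λ i → a (v i))

  -- a cut given by its lower part C⁻ (a predicate on F)
  Cut : Set₁
  Cut = Carrier → Set

  inducedCut : (I : LinOrder) → (Idx I → Carrier) → Cut
  inducedCut I a x = Σ (Idx I) λ t → x ≤F a t

  IsDedekind : Cut → Set
  IsDedekind C =
    (Σ Carrier λ x → C x) × (Σ Carrier λ x → ¬ C x) ×
    (∀ x → C x → Σ Carrier λ y → C y × x <F y) ×
    (∀ x → ¬ C x → Σ Carrier λ y → ¬ C y × y <F x)

  InInterval : Carrier → Carrier → Carrier → Set
  InInterval d e x = d <F x × x <F e

  PositivelyEquivalent : Cut → Cut → Set
  PositivelyEquivalent C₁ C₂ =
    Σ Carrier λ d₁ → Σ Carrier λ e₁ → Σ Carrier λ d₂ → Σ Carrier λ e₂ →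
    C₁ d₁ × ¬ C₁ e₁ × C₂ d₂ × ¬ C₂ e₂ ×
    Σ (Carrier → Carrier) λ f →
      (Σ ℕ λ k → Σ (Formula (suc (suc k))) λ ψ → Σ (Fin k → Carrier) λ p →
         ∀ x → InInterval d₁ e₁ x → ∀ y → Sat F ψ (x ∷ y ∷ p) ⇔ (f x ≡ y)) ×
      (∀ x y → InInterval d₁ e₁ x → InInterval d₁ e₁ y → x <F y → f x <F f y) ×
      (∀ x → InInterval d₁ e₁ x → InInterval d₂ e₂ (f x)) ×
      (∀ y → InInterval d₂ e₂ y → Σ Carrier λ x → InInterval d₁ e₁ x × f x ≡ y) ×
      (∀ x → InInterval d₁ e₁ x → C₁ x → C₂ (f x)) ×
      (∀ y → InInterval d₂ e₂ y → C₂ y → Σ Carrier λ x → InInterval d₁ e₁ x × C₁ x × f x ≡ y)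

  Perpendicular : (I : LinOrder) → (Idx I → Carrier) → (J : LinOrder) → (Idx J → Carrier) → Set
  Perpendicular I a J b =
    ∀ k (φ : Formula (suc (suc k))) (d : Fin k → Carrier) →
    Σ Bool λ tv →
      EventuallyIn I (λ t → EventuallyIn J (λ s → Sat F (φ ^tv tv) (a t ∷ b s ∷ d))) ×
      EventuallyIn J (λ s → EventuallyIn I (λ t → Sat F (φ ^tv tv) (a t ∷ b s ∷ d)))

{-# OPTIONS --safe #-}

-- If f is a definable increasing map matching the two cuts, then the truth value of f (b s) < a t depends on which of s
-- and t grows first. Conversely, a formula φ(x, y, d) is decided by the signs of finitely many polynomials P(x, y).
-- Take such a P of least degree whose sign is constant on no quadrant below the pair of cuts. Then its partial
-- derivatives do have constant signs on a quadrant, necessarily opposite ones, so the zeros of P form the graph of an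
-- increasing function tending to both cuts, and o-minimality continues this function beyond the cuts.
--
-- Quantifiers are eliminated by a back-and-forth argument: if a finite set of polynomials in x, closed under
-- derivatives, omission of the leading term and pseudo-remainders, has coefficients of the same signs at two parameter
-- points, then the two lines over these points are cut into matching cells of constant signs, polynomial by polynomial
-- in the order of increasing degree. The intermediate value theorem needed for this follows from square roots and roots
-- of odd degree by Laplace's argument, in terms of linear algebra: the shifts X and Y in the two indices of an n × n
-- array commute, the operators X + Y + κ X Y act on the symmetric arrays, whose dimension n (n + 1) / 2 has smaller
-- 2-adic valuation than n if n is even, and two of them sharing an eigenvector provide a complex root of the
-- polynomial of degree n that defines the shifts.

module Submission where

open import Defs
open import Level using (0ℓ)
open import Axiom.ExcludedMiddle using (ExcludedMiddle)
open import Relation.Nullary using (¬_)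
open import Function.Bundles using (_⇔_)

open import Algebra.Bundles using (CommutativeRing; RawRing)
open import Algebra.Structures using (IsCommutativeRing)
open import Algebra.Solver.Ring.AlmostCommutativeRing using (fromCommutativeRing; _-Raw-AlmostCommutative⟶_)
import Algebra.Properties.Ring as Ring
import Algebra.Properties.Semiring.Mult.TCOptimised as Mult
import Algebra.Solver.Ring as RingSolver
open import Data.Bool using (Bool; true; false)
open import Data.Empty using (⊥; ⊥-elim)
open import Data.Fin as Fin using (Fin; toℕ)
open import Data.Fin.Properties using (toℕ<n)
open import Data.List using (List; []; _∷_; _∷ʳ_; _++_; length; map; filter; concat; concatMap; cartesianProduct)
open import Data.List.Properties using (length-map; length-++; map-++; ∷-injective)
open import Data.List.Membership.Propositional using (_∈_; _∉_; lose)
open import Data.List.Membership.Propositional.Properties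
  using (∈-++⁺ˡ; ∈-++⁺ʳ; ∈-++⁻; ∈-filter⁺; ∈-filter⁻; ∈-concatMap⁺; ∈-cartesianProduct⁺; ∈-map⁺; ∈-concat⁺′)
open import Data.List.Relation.Binary.Subset.Propositional using (_⊆_)
open import Data.List.Relation.Unary.All as All using (All; []; _∷_)
import Data.List.Relation.Unary.All.Properties as Allₚ
open import Data.List.Relation.Unary.AllPairs as AllPairs using (AllPairs; []; _∷_)
import Data.List.Relation.Unary.AllPairs.Properties as AllPairsₚ
open import Data.List.Relation.Unary.Any using (here; there)
open import Data.Maybe using (Maybe; just; nothing; maybe)
open import Data.Nat as ℕ using (ℕ; zero; suc)
import Data.Nat.Properties as ℕₚ
open import Data.Nat.Divisibility
  using (_∣_; _∣0; 1∣_; divides; ∣m∣n⇒∣m+n; *-monoʳ-∣; *-cancelˡ-∣; ∣-trans; m∣m*n; ∣⇒≤)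
open import Data.Nat.Primality using (euclidsLemma; prime[2])
open import Data.Product using (Σ; ∃; _×_; _,_; proj₁; proj₂)
open import Data.Sum using (_⊎_; inj₁; inj₂; [_,_]′)
open import Data.Unit using (⊤; tt)
open import Data.Vec.Functional as VF using ()
open import Function.Bundles using (mk⇔; module Equivalence)
open import Relation.Binary.Definitions using (Tri; tri<; tri≈; tri>)
open import Relation.Binary.PropositionalEquality
open import Relation.Binary.Structures using (IsStrictTotalOrder)
open import Relation.Nullary using (Dec; yes; no)

-- Real closedness is given only as square roots and roots of odd degree, so every fact about
-- polynomials on intervals has to be derived from the intermediate value theorem. Laplace's
-- argument usually picks roots in a splitting field. The arrays replace it: up to duality they are
-- the tensor square of F[x]/(p), and X and Y play the part of two roots. Eigenvectors are found
-- without determinants or complex scalars: a factor of the minimal polynomial of a Krylov block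
-- yields a vector over F killed by a quadratic. Two members of the pencil share such a vector,
-- since commuting operators with pairwise disjoint kernels would give more independent vectors than
-- the dimension allows.
--
-- Formulas are not rewritten into quantifier-free ones; it is enough that finitely many polynomial
-- signs decide their truth.
--
-- The signs of P and its derivatives are controlled only below the cuts, while the map between the
-- cuts must be defined on both sides. Hence the branch of zeros, and all that is wanted of it, is
-- expressed by a first-order property of a single point, which can be carried across the cut.

module Basics (em : ExcludedMiddle 0ℓ) (𝓕 : RealClosedField) where

  open RealClosedField 𝓕 public using (sqrt; oddRoot; pow; sumF)
    renaming (Carrier to F; _+F_ to infixl 6 _+_; _*F_ to infixl 7 _*_; -F_ to infix 8 -_; 0F to 0#; 1F to 1#
             ; _<F_ to infix 4 _<_; _≤F_ to infix 4 _≤_; orderedField to 𝓞)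
  open OrderedField 𝓞 public using (isCommutativeRing; 0≢1; inverse; +-mono-<; *-pos) renaming (isStrictTotalOrder to <-isSTO)
  open IsCommutativeRing isCommutativeRing public
    using (+-comm; +-assoc; *-comm; *-assoc; +-identityˡ; +-identityʳ; *-identityˡ; zeroˡ; zeroʳ; distribˡ; distribʳ; -‿inverseˡ; -‿inverseʳ)
  open IsStrictTotalOrder <-isSTO public using (compare) renaming (trans to <-trans; irrefl to <-irrefl′)

  F-ring : CommutativeRing 0ℓ 0ℓ
  F-ring = record { isCommutativeRing = isCommutativeRing }

  infixl 6 _-_
  _-_ : F → F → F
  x - y = x + - y

  -- The ring solver computes with formal differences (m , n) of natural numbers, read as m - n.
  module Solver where
    open Mult (CommutativeRing.semiring F-ring)
      renaming (_×_ to _·_; ×-homo-+ to ·-homo-+; ×1-homo-* to ·1-homo-*)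
    open Ring (CommutativeRing.ring F-ring) using (-‿distribˡ-*; -‿distribʳ-*; -‿involutive; -‿+-comm; -0#≈0#)
    open ≡-Reasoning

    ι : ℕ → F
    ι n = n · 1#

    ⟦_⟧ : ℕ × ℕ → F
    ⟦ m , zero ⟧  = ι m
    ⟦ m , suc n ⟧ = ι m - ι (suc n)

    ⟦⟧-diff : ∀ m n → ⟦ m , n ⟧ ≡ ι m - ι n
    ⟦⟧-diff m zero    = sym (trans (cong (ι m +_) -0#≈0#) (+-identityʳ (ι m)))
    ⟦⟧-diff m (suc n) = refl

    +-interchange : ∀ a b c d → (a + b) + (c + d) ≡ (a + c) + (b + d)
    +-interchange a b c d = begin
      (a + b) + (c + d) ≡⟨ +-assoc a b (c + d) ⟩
      a + (b + (c + d)) ≡⟨ cong (a +_) (sym (+-assoc b c d)) ⟩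
      a + ((b + c) + d) ≡⟨ cong (λ z → a + (z + d)) (+-comm b c) ⟩
      a + ((c + b) + d) ≡⟨ cong (a +_) (+-assoc c b d) ⟩
      a + (c + (b + d)) ≡⟨ sym (+-assoc a c (b + d)) ⟩
      (a + c) + (b + d) ∎

    _+ᵈ_ _*ᵈ_ : ℕ × ℕ → ℕ × ℕ → ℕ × ℕ
    (a , b) +ᵈ (c , d) = a ℕ.+ c , b ℕ.+ d
    (a , b) *ᵈ (c , d) = a ℕ.* c ℕ.+ b ℕ.* d , a ℕ.* d ℕ.+ b ℕ.* c

    homo-+ : ∀ p q → ⟦ p +ᵈ q ⟧ ≡ ⟦ p ⟧ + ⟦ q ⟧
    homo-+ (a , b) (c , d) = begin
      ⟦ a ℕ.+ c , b ℕ.+ d ⟧         ≡⟨ ⟦⟧-diff (a ℕ.+ c) (b ℕ.+ d) ⟩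
      ι (a ℕ.+ c) - ι (b ℕ.+ d)     ≡⟨ cong₂ _-_ (·-homo-+ 1# a c) (·-homo-+ 1# b d) ⟩
      (ι a + ι c) - (ι b + ι d)     ≡⟨ cong ((ι a + ι c) +_) (sym (-‿+-comm (ι b) (ι d))) ⟩
      (ι a + ι c) + (- ι b + - ι d) ≡⟨ +-interchange (ι a) (ι c) (- ι b) (- ι d) ⟩
      (ι a - ι b) + (ι c - ι d)     ≡⟨ sym (cong₂ _+_ (⟦⟧-diff a b) (⟦⟧-diff c d)) ⟩
      ⟦ a , b ⟧ + ⟦ c , d ⟧         ∎

    homo-neg : ∀ p → ⟦ proj₂ p , proj₁ p ⟧ ≡ - ⟦ p ⟧
    homo-neg (a , b) = begin
      ⟦ b , a ⟧         ≡⟨ ⟦⟧-diff b a ⟩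
      ι b - ι a         ≡⟨ +-comm (ι b) (- ι a) ⟩
      - ι a + ι b       ≡⟨ cong (- ι a +_) (sym (-‿involutive (ι b))) ⟩
      - ι a + - (- ι b) ≡⟨ -‿+-comm (ι a) (- ι b) ⟩
      - (ι a - ι b)     ≡⟨ cong -_ (sym (⟦⟧-diff a b)) ⟩
      - ⟦ a , b ⟧       ∎

    homo-* : ∀ p q → ⟦ p *ᵈ q ⟧ ≡ ⟦ p ⟧ * ⟦ q ⟧
    homo-* (a , b) (c , d) = begin
      ⟦ a ℕ.* c ℕ.+ b ℕ.* d , a ℕ.* d ℕ.+ b ℕ.* c ⟧
        ≡⟨ ⟦⟧-diff (a ℕ.* c ℕ.+ b ℕ.* d) (a ℕ.* d ℕ.+ b ℕ.* c) ⟩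
      ι (a ℕ.* c ℕ.+ b ℕ.* d) - ι (a ℕ.* d ℕ.+ b ℕ.* c)
        ≡⟨ cong₂ _-_ (prods a c b d) (prods a d b c) ⟩
      (ι a * ι c + ι b * ι d) - (ι a * ι d + ι b * ι c)
        ≡⟨ cong ((ι a * ι c + ι b * ι d) +_) (sym (-‿+-comm (ι a * ι d) (ι b * ι c))) ⟩
      (ι a * ι c + ι b * ι d) + (- (ι a * ι d) + - (ι b * ι c))
        ≡⟨ cong ((ι a * ι c + ι b * ι d) +_) (+-comm (- (ι a * ι d)) (- (ι b * ι c))) ⟩
      (ι a * ι c + ι b * ι d) + (- (ι b * ι c) + - (ι a * ι d))
        ≡⟨ +-interchange (ι a * ι c) (ι b * ι d) (- (ι b * ι c)) (- (ι a * ι d)) ⟩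
      (ι a * ι c + - (ι b * ι c)) + (ι b * ι d + - (ι a * ι d))
        ≡⟨ cong₂ _+_ (cong (ι a * ι c +_) (-‿distribˡ-* (ι b) (ι c)))
                     (trans (+-comm (ι b * ι d) (- (ι a * ι d)))
                            (cong₂ _+_ (-‿distribʳ-* (ι a) (ι d)) (negneg (ι b) (ι d)))) ⟩
      (ι a * ι c + - ι b * ι c) + (ι a * - ι d + - ι b * - ι d)
        ≡⟨ sym (cong₂ _+_ (distribʳ (ι c) (ι a) (- ι b)) (distribʳ (- ι d) (ι a) (- ι b))) ⟩
      (ι a - ι b) * ι c + (ι a - ι b) * - ι d
        ≡⟨ sym (distribˡ (ι a - ι b) (ι c) (- ι d)) ⟩
      (ι a - ι b) * (ι c - ι d)
        ≡⟨ sym (cong₂ _*_ (⟦⟧-diff a b) (⟦⟧-diff c d)) ⟩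
      ⟦ a , b ⟧ * ⟦ c , d ⟧ ∎
      where
      prods : ∀ a c b d → ι (a ℕ.* c ℕ.+ b ℕ.* d) ≡ ι a * ι c + ι b * ι d
      prods a c b d = trans (·-homo-+ 1# (a ℕ.* c) (b ℕ.* d)) (cong₂ _+_ (·1-homo-* a c) (·1-homo-* b d))
      negneg : ∀ x y → x * y ≡ - x * - y
      negneg x y = trans (sym (-‿involutive (x * y))) (trans (cong -_ (-‿distribʳ-* x y)) (-‿distribˡ-* x (- y)))

    cross : ∀ a b c d → a ℕ.+ d ≡ b ℕ.+ c → ⟦ a , b ⟧ ≡ ⟦ c , d ⟧
    cross a b c d a+d≡b+c = begin
      ⟦ a , b ⟧                     ≡⟨ ⟦⟧-diff a b ⟩
      ι a - ι b                     ≡⟨ cong (_- ι b) (sym (+-identityʳ (ι a))) ⟩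
      (ι a + 0#) - ι b              ≡⟨ cong (λ z → (ι a + z) - ι b) (sym (-‿inverseʳ (ι d))) ⟩
      (ι a + (ι d - ι d)) - ι b     ≡⟨ cong (_- ι b) (sym (+-assoc (ι a) (ι d) (- ι d))) ⟩
      ((ι a + ι d) - ι d) - ι b     ≡⟨ cong (λ z → (z - ι d) - ι b) moved ⟩
      ((ι c + ι b) - ι d) - ι b     ≡⟨ +-assoc (ι c + ι b) (- ι d) (- ι b) ⟩
      (ι c + ι b) + (- ι d - ι b)   ≡⟨ +-interchange (ι c) (ι b) (- ι d) (- ι b) ⟩
      (ι c - ι d) + (ι b - ι b)     ≡⟨ cong ((ι c - ι d) +_) (-‿inverseʳ (ι b)) ⟩
      (ι c - ι d) + 0#              ≡⟨ +-identityʳ (ι c - ι d) ⟩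
      ι c - ι d                     ≡⟨ sym (⟦⟧-diff c d) ⟩
      ⟦ c , d ⟧                     ∎
      where
      moved : ι a + ι d ≡ ι c + ι b
      moved = trans (sym (·-homo-+ 1# a d)) (trans (cong ι (trans a+d≡b+c (ℕₚ.+-comm b c))) (·-homo-+ 1# c b))

    -- The solver compares normal forms syntactically, so differences are kept reduced.
    reduce : ℕ × ℕ → ℕ × ℕ
    reduce (suc m , suc n) = reduce (m , n)
    reduce p               = p

    reduce-⟦⟧ : ∀ p → ⟦ reduce p ⟧ ≡ ⟦ p ⟧
    reduce-⟦⟧ (zero  , n)     = refl
    reduce-⟦⟧ (suc m , zero)  = refl
    reduce-⟦⟧ (suc m , suc n) = trans (reduce-⟦⟧ (m , n)) (cross m n (suc m) (suc n) (trans (ℕₚ.+-comm m (suc n)) (sym (ℕₚ.+-suc n m))))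

    Difference : RawRing 0ℓ 0ℓ
    Difference = record
      { Carrier = ℕ × ℕ ; _≈_ = _≡_
      ; _+_ = λ p q → reduce (p +ᵈ q) ; _*_ = λ p q → reduce (p *ᵈ q)
      ; -_ = λ p → proj₂ p , proj₁ p ; 0# = 0 , 0 ; 1# = 1 , 0 }

    morphism : Difference -Raw-AlmostCommutative⟶ fromCommutativeRing F-ring
    morphism = record
      { ⟦_⟧ = ⟦_⟧ ; +-homo = λ p q → trans (reduce-⟦⟧ (p +ᵈ q)) (homo-+ p q) ; *-homo = λ p q → trans (reduce-⟦⟧ (p *ᵈ q)) (homo-* p q)
      ; -‿homo = homo-neg ; 0-homo = refl ; 1-homo = refl }

    _≟_ : ∀ p q → Maybe (⟦ p ⟧ ≡ ⟦ q ⟧)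
    (a , b) ≟ (c , d) with a ℕ.+ d ℕ.≟ b ℕ.+ c
    ... | yes e = just (cross a b c d e)
    ... | no  _  = nothing

    open RingSolver Difference (fromCommutativeRing F-ring) morphism _≟_ public
      using (Polynomial; solve; con; _:+_; _:*_; _:-_; :-_; _:=_)

    :0 :1 : ∀ {n} → Polynomial n
    :0 = con (0 , 0)
    :1 = con (1 , 0)

  open Solver using (solve; :0; :1; _:+_; _:*_; _:-_; :-_; _:=_) public

-- Order, halves and signs of field elements

module Order (em : ExcludedMiddle 0ℓ) (𝓕 : RealClosedField) where

  open Basics em 𝓕

  <-irrefl : ∀ {x} → ¬ x < x
  <-irrefl = <-irrefl′ refl

  <-≤-trans : ∀ {x y z} → x < y → y ≤ z → x < z
  <-≤-trans x<y (inj₁ y<z)  = <-trans x<y y<z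
  <-≤-trans x<y (inj₂ refl) = x<y

  ≤-<-trans : ∀ {x y z} → x ≤ y → y < z → x < z
  ≤-<-trans (inj₁ x<y)  y<z = <-trans x<y y<z
  ≤-<-trans (inj₂ refl) y<z = y<z

  ≤-trans : ∀ {x y z} → x ≤ y → y ≤ z → x ≤ z
  ≤-trans (inj₁ x<y)  y≤z = inj₁ (<-≤-trans x<y y≤z)
  ≤-trans (inj₂ refl) y≤z = y≤z

  ≤-refl : ∀ {x} → x ≤ x
  ≤-refl = inj₂ refl

  <⇒≱ : ∀ {x y} → x < y → ¬ y ≤ x
  <⇒≱ x<y y≤x = <-irrefl (<-≤-trans x<y y≤x)

  ≮⇒≥ : ∀ {x y} → ¬ x < y → y ≤ x
  ≮⇒≥ {x} {y} x≮y with compare x y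
  ... | tri< x<y _ _ = ⊥-elim (x≮y x<y)
  ... | tri≈ _ x≡y _ = inj₂ (sym x≡y)
  ... | tri> _ _ y<x = inj₁ y<x

  <⊎≥ : ∀ x y → x < y ⊎ y ≤ x
  <⊎≥ x y with compare x y
  ... | tri< x<y _ _ = inj₁ x<y
  ... | tri≈ _ x≡y _ = inj₂ (inj₂ (sym x≡y))
  ... | tri> _ _ y<x = inj₂ (inj₁ y<x)

  ≤-antisym : ∀ {x y} → x ≤ y → y ≤ x → x ≡ y
  ≤-antisym (inj₁ x<y) y≤x = ⊥-elim (<⇒≱ x<y y≤x)
  ≤-antisym (inj₂ x≡y) _   = x≡y

  <-by : ∀ {x y} d → 0# < d → y ≡ x + d → x < y
  <-by {x} d 0<d y≡x+d = subst₂ _<_ (+-identityˡ x) (trans (+-comm d x) (sym y≡x+d)) (+-mono-< 0# d x 0<d)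

  0<-diff : ∀ {x y} → x < y → 0# < y - x
  0<-diff {x} {y} x<y = subst (_< y - x) (-‿inverseʳ x) (+-mono-< x y (- x) x<y)

  +-pos : ∀ {x y} → 0# < x → 0# < y → 0# < x + y
  +-pos {x} {y} 0<x 0<y = <-trans 0<x (<-by y 0<y refl)

  +-pos-≤ : ∀ {x y} → 0# < x → 0# ≤ y → 0# < x + y
  +-pos-≤ 0<x (inj₁ 0<y)  = +-pos 0<x 0<y
  +-pos-≤ 0<x (inj₂ refl) = subst (0# <_) (sym (+-identityʳ _)) 0<x

  neg-pos : ∀ {x} → x < 0# → 0# < - x
  neg-pos {x} x<0 = subst (0# <_) (+-identityˡ (- x)) (0<-diff x<0)

  neg-neg : ∀ {x} → 0# < x → - x < 0#
  neg-neg {x} 0<x = <-by x 0<x (sym (-‿inverseˡ x))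

  -‿involutive : ∀ x → - - x ≡ x
  -‿involutive = solve 1 (λ x → :- (:- x) := x) refl

  sq-pos : ∀ {x} → ¬ x ≡ 0# → 0# < x * x
  sq-pos {x} x≢0 with compare x 0#
  ... | tri< x<0 _ _ = subst (0# <_) (solve 1 (λ x → :- x :* :- x := x :* x) refl x) (*-pos _ _ (neg-pos x<0) (neg-pos x<0))
  ... | tri≈ _ x≡0 _ = ⊥-elim (x≢0 x≡0)
  ... | tri> _ _ 0<x = *-pos x x 0<x 0<x

  sq-nonneg : ∀ x → 0# ≤ x * x
  sq-nonneg x with em {x ≡ 0#}
  ... | yes refl = inj₂ (sym (zeroˡ 0#))
  ... | no x≢0   = inj₁ (sq-pos x≢0)

  0<1 : 0# < 1#
  0<1 = subst (0# <_) (*-identityˡ 1#) (sq-pos (λ 1≡0 → 0≢1 (sym 1≡0)))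

  *-neg-pos : ∀ {x y} → x < 0# → 0# < y → x * y < 0#
  *-neg-pos {x} {y} x<0 0<y =
    <-by (- x * y) (*-pos _ _ (neg-pos x<0) 0<y) (solve 2 (λ x y → :0 := x :* y :+ :- x :* y) refl x y)

  *-neg-neg : ∀ {x y} → x < 0# → y < 0# → 0# < x * y
  *-neg-neg {x} {y} x<0 y<0 =
    subst (0# <_) (solve 2 (λ x y → :- x :* :- y := x :* y) refl x y) (*-pos _ _ (neg-pos x<0) (neg-pos y<0))

  pos≢0 : ∀ {x} → 0# < x → ¬ x ≡ 0#
  pos≢0 0<x refl = <-irrefl 0<x

  nonzero-* : ∀ {x y} → ¬ x ≡ 0# → ¬ y ≡ 0# → ¬ x * y ≡ 0#
  nonzero-* {x} {y} x≢0 y≢0 xy≡0 with inverse x x≢0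
  ... | x⁻¹ , xx⁻¹≡1 = y≢0 (begin
    y                ≡⟨ sym (*-identityˡ y) ⟩
    1# * y           ≡⟨ cong (_* y) (sym xx⁻¹≡1) ⟩
    x * x⁻¹ * y      ≡⟨ solve 3 (λ x i y → x :* i :* y := i :* (x :* y)) refl x x⁻¹ y ⟩
    x⁻¹ * (x * y)    ≡⟨ cong (x⁻¹ *_) xy≡0 ⟩
    x⁻¹ * 0#         ≡⟨ zeroʳ x⁻¹ ⟩
    0#               ∎)
    where open ≡-Reasoning

  zero-product : ∀ x y → x * y ≡ 0# → x ≡ 0# ⊎ y ≡ 0#
  zero-product x y xy≡0 with em {x ≡ 0#} | em {y ≡ 0#}
  ... | yes x≡0 | _       = inj₁ x≡0
  ... | no _    | yes y≡0 = inj₂ y≡0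
  ... | no x≢0  | no y≢0  = ⊥-elim (nonzero-* x≢0 y≢0 xy≡0)

  -- The ring solver proves only identities. To use a hypothesis `l ≡ r`, its multiple by `k` is
  -- added crosswise to both sides of the goal, which turns the goal into an identity.
  by-multiple : ∀ {l r} k → l ≡ r → ∀ {x y} → x + k * r ≡ y + k * l → x ≡ y
  by-multiple {l} k refl {x} {y} e = begin
    x                        ≡⟨ solve 2 (λ x c → x := (x :+ c) :- c) refl x (k * l) ⟩
    (x + k * l) - k * l      ≡⟨ cong (_- k * l) e ⟩
    (y + k * l) - k * l      ≡⟨ solve 2 (λ y c → (y :+ c) :- c := y) refl y (k * l) ⟩
    y                        ∎
    where open ≡-Reasoning

  x-y≡0⇒x≡y : ∀ {x y} → x - y ≡ 0# → x ≡ y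
  x-y≡0⇒x≡y {x} {y} e = by-multiple 1# e (solve 2 (λ x y → x :+ :1 :* :0 := y :+ :1 :* (x :- y)) refl x y)

  2# : F
  2# = 1# + 1#

  0<2 : 0# < 2#
  0<2 = +-pos 0<1 0<1

  ½ : F
  ½ = proj₁ (inverse 2# (pos≢0 0<2))

  2*½≡1 : 2# * ½ ≡ 1#
  2*½≡1 = proj₂ (inverse 2# (pos≢0 0<2))

  abstract
    inverse-pos : ∀ {x i} → 0# < x → x * i ≡ 1# → 0# < i
    inverse-pos {x} {i} 0<x xi≡1 with <⊎≥ 0# i
    ... | inj₁ 0<i         = 0<i
    ... | inj₂ (inj₁ i<0)  = ⊥-elim (<-irrefl (<-trans 0<1
            (subst (_< 0#) (trans (*-comm i x) xi≡1) (*-neg-pos i<0 0<x))))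
    ... | inj₂ (inj₂ refl) = ⊥-elim (0≢1 (trans (sym (zeroʳ x)) xi≡1))

  0<½ : 0# < ½
  0<½ = inverse-pos 0<2 2*½≡1

  abstract
    between : ∀ {x y} → x < y → ∃ λ z → x < z × z < y
    between {x} {y} x<y = x + ½ * (y - x) , <-by _ gap refl ,
      <-by _ gap (by-multiple (y - x) (sym 2*½≡1)
        (solve 3 (λ x y h → y :+ (y :- x) :* ((:1 :+ :1) :* h) := ((x :+ h :* (y :- x)) :+ h :* (y :- x)) :+ (y :- x) :* :1) refl x y ½))
      where
      gap : 0# < ½ * (y - x)
      gap = *-pos _ _ 0<½ (0<-diff x<y)

  above : ∀ x → x < x + 1#
  above x = <-by 1# 0<1 refl

  neg-mono-< : ∀ {x y} → x < y → - y < - x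
  neg-mono-< {x} {y} x<y = <-by (y - x) (0<-diff x<y) (solve 2 (λ x y → :- x := :- y :+ (y :- x)) refl x y)

  abstract
    max : ∀ x y → ∃ λ z → x ≤ z × y ≤ z × (z ≡ x ⊎ z ≡ y)
    max x y with <⊎≥ x y
    ... | inj₁ x<y = y , inj₁ x<y , ≤-refl , inj₂ refl
    ... | inj₂ y≤x = x , ≤-refl , y≤x , inj₁ refl

  abstract
    min : ∀ x y → ∃ λ z → z ≤ x × z ≤ y × (z ≡ x ⊎ z ≡ y)
    min x y with <⊎≥ x y
    ... | inj₁ x<y = x , ≤-refl , inj₁ x<y , inj₁ refl
    ... | inj₂ y≤x = y , y≤x , ≤-refl , inj₂ refl

  data Sgn : Set where
    ⊖ ⊙ ⊕ : Sgn

  sgn : F → Sgn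
  sgn x with compare x 0#
  ... | tri< _ _ _ = ⊖
  ... | tri≈ _ _ _ = ⊙
  ... | tri> _ _ _ = ⊕

  sgn-neg : ∀ {x} → x < 0# → sgn x ≡ ⊖
  sgn-neg {x} x<0 with compare x 0#
  ... | tri< _ _ _   = refl
  ... | tri≈ x≮0 _ _ = ⊥-elim (x≮0 x<0)
  ... | tri> x≮0 _ _ = ⊥-elim (x≮0 x<0)

  sgn-zero : ∀ {x} → x ≡ 0# → sgn x ≡ ⊙
  sgn-zero {x} x≡0 with compare x 0#
  ... | tri< _ x≢0 _ = ⊥-elim (x≢0 x≡0)
  ... | tri≈ _ _ _   = refl
  ... | tri> _ x≢0 _ = ⊥-elim (x≢0 x≡0)

  sgn-pos : ∀ {x} → 0# < x → sgn x ≡ ⊕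
  sgn-pos {x} 0<x with compare x 0#
  ... | tri< _ _ x≯0 = ⊥-elim (x≯0 0<x)
  ... | tri≈ _ _ x≯0 = ⊥-elim (x≯0 0<x)
  ... | tri> _ _ _   = refl

  sgn⇒neg : ∀ {x} → sgn x ≡ ⊖ → x < 0#
  sgn⇒neg {x} e with compare x 0#
  sgn⇒neg {x} e  | tri< x<0 _ _ = x<0
  sgn⇒neg {x} () | tri≈ _ _ _
  sgn⇒neg {x} () | tri> _ _ _

  sgn⇒zero : ∀ {x} → sgn x ≡ ⊙ → x ≡ 0#
  sgn⇒zero {x} e with compare x 0#
  sgn⇒zero {x} () | tri< _ _ _
  sgn⇒zero {x} e  | tri≈ _ x≡0 _ = x≡0
  sgn⇒zero {x} () | tri> _ _ _

  sgn⇒pos : ∀ {x} → sgn x ≡ ⊕ → 0# < x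
  sgn⇒pos {x} e with compare x 0#
  sgn⇒pos {x} () | tri< _ _ _
  sgn⇒pos {x} () | tri≈ _ _ _
  sgn⇒pos {x} e  | tri> _ _ 0<x = 0<x

  infixl 7 _·ₛ_
  _·ₛ_ : Sgn → Sgn → Sgn
  ⊙ ·ₛ _ = ⊙
  ⊕ ·ₛ s = s
  ⊖ ·ₛ ⊖ = ⊕
  ⊖ ·ₛ ⊙ = ⊙
  ⊖ ·ₛ ⊕ = ⊖

  sgn-* : ∀ x y → sgn (x * y) ≡ sgn x ·ₛ sgn y
  sgn-* x y with compare x 0# | compare y 0#
  ... | tri< x<0 _ _ | tri< y<0 _ _ = sgn-pos (*-neg-neg x<0 y<0)
  ... | tri< x<0 _ _ | tri≈ _ y≡0 _ = sgn-zero (trans (cong (x *_) y≡0) (zeroʳ x))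
  ... | tri< x<0 _ _ | tri> _ _ 0<y = sgn-neg (*-neg-pos x<0 0<y)
  ... | tri≈ _ x≡0 _ | _            = sgn-zero (trans (cong (_* y) x≡0) (zeroˡ y))
  ... | tri> _ _ 0<x | tri< y<0 _ _ = sgn-neg (subst (_< 0#) (*-comm y x) (*-neg-pos y<0 0<x))
  ... | tri> _ _ 0<x | tri≈ _ y≡0 _ = sgn-zero (trans (cong (x *_) y≡0) (zeroʳ x))
  ... | tri> _ _ 0<x | tri> _ _ 0<y = sgn-pos (*-pos x y 0<x 0<y)

  sgn-opp : ∀ x → sgn (- x) ≡ ⊖ ·ₛ sgn x
  sgn-opp x = begin
    sgn (- x)          ≡⟨ cong sgn (solve 1 (λ x → :- x := :- :1 :* x) refl x) ⟩
    sgn (- 1# * x)     ≡⟨ sgn-* (- 1#) x ⟩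
    sgn (- 1#) ·ₛ sgn x ≡⟨ cong (_·ₛ sgn x) (sgn-neg (neg-neg 0<1)) ⟩
    ⊖ ·ₛ sgn x         ∎
    where open ≡-Reasoning

  ·ₛ-cancel : ∀ s {t u} → ¬ s ≡ ⊙ → s ·ₛ t ≡ s ·ₛ u → t ≡ u
  ·ₛ-cancel ⊙ s≢⊙ _ = ⊥-elim (s≢⊙ refl)
  ·ₛ-cancel ⊕ _ e   = e
  ·ₛ-cancel ⊖ {⊖} {⊖} _ e = refl
  ·ₛ-cancel ⊖ {⊙} {⊙} _ e = refl
  ·ₛ-cancel ⊖ {⊕} {⊕} _ e = refl

-- Linear algebra without matrices: spans, exchange, powers of an operator

module LinearAlgebra (em : ExcludedMiddle 0ℓ) (𝓕 : RealClosedField) where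

  open Basics em 𝓕
  open Order em 𝓕

  -- Coefficient lists are written from the highest degree down; s is any sequence in place of the powers of a variable.
  lin : List F → (ℕ → F) → F
  lin []      s = 0#
  lin (a ∷ p) s = a * s (length p) + lin p s

  lin-cong : ∀ p {s t} → (∀ k → s k ≡ t k) → lin p s ≡ lin p t
  lin-cong []      s≗t = refl
  lin-cong (a ∷ p) s≗t = cong₂ (λ x y → a * x + y) (s≗t (length p)) (lin-cong p s≗t)

  lin-+ : ∀ p c s t → lin p (λ k → c * s k + t k) ≡ c * lin p s + lin p t
  lin-+ []      c s t = solve 1 (λ c → :0 := c :* :0 :+ :0) refl c
  lin-+ (a ∷ p) c s t = trans (cong (a * (c * s (length p) + t (length p)) +_) (lin-+ p c s t))
    (solve 6 (λ a c s t S T → a :* (c :* s :+ t) :+ (c :* S :+ T) := c :* (a :* s :+ S) :+ (a :* t :+ T)) refl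
       a c (s (length p)) (t (length p)) (lin p s) (lin p t))

  -- p lists the lower coefficients of a monic polynomial of degree length p. Polynomial identities are stated by applying
  -- both sides to every sequence s.
  Factors : List F → Set
  Factors p =
    (∃ λ r → ∃ λ q → suc (length q) ≡ length p ×
       ∀ s → s (length p) + lin p s ≡ lin (1# ∷ q) (λ k → s (suc k) - r * s k)) ⊎
    (∃ λ b → ∃ λ c → ∃ λ q → suc (suc (length q)) ≡ length p ×
       ∀ s → s (length p) + lin p s ≡ lin (1# ∷ q) (λ k → s (suc (suc k)) + (b * s (suc k) + c * s k)))

  -- Vectors are functions I → F, compared only on the indices satisfying D.
  module VectorSpace (I : Set) (D : I → Set) where

    V : Set
    V = I → F

    infix 4 _≈_ _≉_
    _≈_ _≉_ : V → V → Set
    u ≈ v = ∀ i → D i → u i ≡ v i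
    u ≉ v = ¬ u ≈ v

    𝟘 : V
    𝟘 _ = 0#

    infixl 6 _⊞_ _⊟_
    infixl 7 _⊡_
    _⊞_ _⊟_ : V → V → V
    (u ⊞ v) i = u i + v i
    (u ⊟ v) i = u i - v i
    _⊡_ : F → V → V
    (c ⊡ u) i = c * u i

    ≈-trans : ∀ {u v w} → u ≈ v → v ≈ w → u ≈ w
    ≈-trans p q i d = trans (p i d) (q i d)
    ≈-sym : ∀ {u v} → u ≈ v → v ≈ u
    ≈-sym p i d = sym (p i d)

    record Linear (A : V → V) : Set where
      field
        respects : ∀ {u v} → u ≈ v → A u ≈ A v
        comb : ∀ c u v → A (c ⊡ u ⊞ v) ≈ c ⊡ A u ⊞ A v

      preserves-𝟘 : A 𝟘 ≈ 𝟘
      preserves-𝟘 i d = begin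
        A 𝟘 i                          ≡⟨ respects (λ _ _ → solve 0 (:0 := :- :1 :* :0 :+ :0) refl) i d ⟩
        A ((- 1#) ⊡ 𝟘 ⊞ 𝟘) i           ≡⟨ comb (- 1#) 𝟘 𝟘 i d ⟩
        - 1# * A 𝟘 i + A 𝟘 i           ≡⟨ solve 1 (λ x → :- :1 :* x :+ x := :0) refl (A 𝟘 i) ⟩
        0#                             ∎
        where open ≡-Reasoning

      sub : ∀ u c v → A (u ⊟ c ⊡ v) ≈ A u ⊟ c ⊡ A v
      sub u c v i d = begin
        A (u ⊟ c ⊡ v) i          ≡⟨ respects (λ i _ → solve 3 (λ u c v → u :- c :* v := :- c :* v :+ u) refl (u i) c (v i)) i d ⟩
        A ((- c) ⊡ v ⊞ u) i      ≡⟨ comb (- c) v u i d ⟩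
        - c * A v i + A u i      ≡⟨ solve 3 (λ u c v → :- c :* v :+ u := u :- c :* v) refl (A u i) c (A v i) ⟩
        A u i - c * A v i        ∎
        where open ≡-Reasoning

      diff : ∀ u v → A (u ⊟ v) ≈ A u ⊟ A v
      diff u v i d = begin
        A (u ⊟ v) i          ≡⟨ respects (λ i _ → solve 2 (λ u v → u :- v := u :- :1 :* v) refl (u i) (v i)) i d ⟩
        A (u ⊟ 1# ⊡ v) i     ≡⟨ sub u 1# v i d ⟩
        A u i - 1# * A v i   ≡⟨ solve 2 (λ u v → u :- :1 :* v := u :- v) refl (A u i) (A v i) ⟩
        A u i - A v i        ∎
        where open ≡-Reasoning

    open Linear

    record Subspace (U : V → Set) : Set where
      field
        respects : ∀ {u v} → u ≈ v → U u → U v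
        comb : ∀ c {u v} → U u → U v → U (c ⊡ u ⊞ v)
        zero∈ : U 𝟘

    -- One coefficient is split off at a time, so linear combinations need no indexed sums and
    -- proofs go by induction on the list.
    Span : List V → V → Set
    Span []       u = u ≈ 𝟘
    Span (e ∷ es) u = ∃ λ c → Span es (u ⊟ c ⊡ e)

    Span-resp : ∀ es {u v} → u ≈ v → Span es u → Span es v
    Span-resp []       u≈v s       = ≈-trans (≈-sym u≈v) s
    Span-resp (e ∷ es) u≈v (c , s) = c , Span-resp es (λ i d → cong (_- c * e i) (u≈v i d)) s

    Span-comb : ∀ es c {u v} → Span es u → Span es v → Span es (c ⊡ u ⊞ v)
    Span-comb [] c su sv i d = trans (cong₂ (λ x y → c * x + y) (su i d) (sv i d)) (solve 1 (λ c → c :* :0 :+ :0 := :0) refl c)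
    Span-comb (e ∷ es) c {u} {v} (a , su) (b , sv) = c * a + b ,
      Span-resp es (λ i _ → solve 6 (λ c u v a b e → c :* (u :- a :* e) :+ (v :- b :* e) := c :* u :+ v :- (c :* a :+ b) :* e)
                      refl c (u i) (v i) a b (e i))
        (Span-comb es c su sv)

    Span-𝟘 : ∀ es → Span es 𝟘
    Span-𝟘 []       i d = refl
    Span-𝟘 (e ∷ es) = 0# , Span-resp es (λ i _ → solve 1 (λ e → :0 := :0 :- :0 :* e) refl (e i)) (Span-𝟘 es)

    Span-subspace : ∀ es → Subspace (Span es)
    Span-subspace es = record { respects = Span-resp es ; comb = Span-comb es ; zero∈ = Span-𝟘 es }

    Span-there : ∀ e es {u} → Span es u → Span (e ∷ es) u
    Span-there e es {u} s = 0# , Span-resp es (λ i _ → solve 2 (λ u e → u := u :- :0 :* e) refl (u i) (e i)) s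

    Span-here : ∀ e es → Span (e ∷ es) e
    Span-here e es = 1# , Span-resp es (λ i _ → solve 1 (λ e → :0 := e :- :1 :* e) refl (e i)) (Span-𝟘 es)

    Span-++ : ∀ fs es {u} → Span es u → Span (fs ++ es) u
    Span-++ []       es s = s
    Span-++ (f ∷ fs) es s = Span-there f (fs ++ es) (Span-++ fs es s)

    Span-self : ∀ es → All (Span es) es
    Span-self []       = []
    Span-self (e ∷ es) = Span-here e es ∷ All.map (Span-there e es) (Span-self es)

    Span-least : ∀ {U} → Subspace U → ∀ es → All U es → ∀ {u} → Span es u → U u
    Span-least SU []       []          s       = Subspace.respects SU (≈-sym s) (Subspace.zero∈ SU)
    Span-least SU (e ∷ es) (Ue ∷ Ues) {u} (c , s) =
      Subspace.respects SU (λ i _ → solve 3 (λ u c e → c :* e :+ (u :- c :* e) := u) refl (u i) c (e i))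
        (Subspace.comb SU c Ue (Span-least SU es Ues s))

    Indep : List V → Set
    Indep []       = ⊤
    Indep (e ∷ es) = ¬ Span es e × Indep es

    -- In the second case p is the pivot: multiples of it are subtracted from the other vectors.
    eliminate : ∀ e es us → All (Span (e ∷ es)) us →
      All (Span es) us ⊎
      (∃ λ vs → ∃ λ p → length us ≡ suc (length vs) × All (Span es) vs × (Indep us → Indep vs) ×
         All (Span us) vs × Span us p × (∃ λ c → ¬ c ≡ 0# × Span es (p ⊟ c ⊡ e)))
    eliminate e es []       [] = inj₁ []
    eliminate e es (u ∷ us) ((a , su) ∷ sus) with eliminate e es us sus
    ... | inj₁ all with em {a ≡ 0#}
    ...   | yes refl = inj₁ (Span-resp es (λ i _ → solve 2 (λ u e → u :- :0 :* e := u) refl (u i) (e i)) su ∷ all)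
    ...   | no a≢0   = inj₂ (us , u , refl , all , proj₂ , All.map (Span-there u us) (Span-self us) , Span-here u us , a , a≢0 , su)
    eliminate e es (u ∷ us) ((a , su) ∷ sus)
        | inj₂ (vs , p , len , svs , ind , vs⊆us , p∈us , c , c≢0 , sp) with inverse c c≢0
    ... | c⁻¹ , cc⁻¹≡1 =
      inj₂ (u′ ∷ vs , p , cong suc len , u′∈es ∷ svs , ind′ ,
            u′∈us ∷ All.map (Span-there u us) vs⊆us , Span-there u us p∈us , c , c≢0 , sp)
      where
      u′ : V
      u′ = (- (a * c⁻¹)) ⊡ p ⊞ u
      u′∈es : Span es u′
      u′∈es = Span-resp es
        (λ i _ → by-multiple (a * e i) cc⁻¹≡1
           (solve 6 (λ a c c′ p e u → :- (a :* c′) :* (p :- c :* e) :+ (u :- a :* e) :+ (a :* e) :* :1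
                       := :- (a :* c′) :* p :+ u :+ (a :* e) :* (c :* c′)) refl a c c⁻¹ (p i) (e i) (u i)))
        (Span-comb es (- (a * c⁻¹)) sp su)
      u′∈us : Span (u ∷ us) u′
      u′∈us = Span-comb (u ∷ us) (- (a * c⁻¹)) (Span-there u us p∈us) (Span-here u us)
      ind′ : Indep (u ∷ us) → Indep (u′ ∷ vs)
      ind′ (u∉ , indus) =
        (λ u′∈vs → u∉ (Span-resp us (λ i _ → solve 3 (λ k p u → k :* p :+ (:- k :* p :+ u) := u) refl (a * c⁻¹) (p i) (u i))
                        (Span-comb us (a * c⁻¹) p∈us (Span-least (Span-subspace us) vs vs⊆us u′∈vs)))) , ind indus

    steinitz : ∀ es us → All (Span es) us → Indep us → length us ℕ.≤ length es
    steinitz []       []       _         _        = ℕ.z≤n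
    steinitz []       (u ∷ us) (su ∷ _)  (u∉ , _) =
      ⊥-elim (u∉ (Span-resp us (≈-sym su) (Span-𝟘 us)))
    steinitz (e ∷ es) us sus ind with eliminate e es us sus
    ... | inj₁ all = ℕₚ.m≤n⇒m≤1+n (steinitz es us all ind)
    ... | inj₂ (vs , _ , len , svs , f , _) = subst (ℕ._≤ suc (length es)) (sym len) (ℕ.s≤s (steinitz es vs svs (f ind)))

    Commute : (V → V) → (V → V) → Set
    Commute A B = ∀ u → A (B u) ≈ B (A u)

    Span-image : ∀ {A} → Linear A → ∀ es {u} → Span es u → Span (map A es) (A u)
    Span-image LA []       s       = ≈-trans (respects LA s) (preserves-𝟘 LA)
    Span-image LA (e ∷ es) {u} (c , s) = c , Span-resp (map _ es) (sub LA u c e) (Span-image LA es s)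

    Span-preimage : ∀ {A} → Linear A → ∀ es {w} → Span (map A es) w → ∃ λ u → Span es u × A u ≈ w
    Span-preimage LA []       s       = 𝟘 , (λ _ _ → refl) , ≈-trans (preserves-𝟘 LA) (≈-sym s)
    Span-preimage {A} LA (e ∷ es) {w} (c , s) with Span-preimage LA es s
    ... | u , su , Au≈ = c ⊡ e ⊞ u , (c , Span-resp es (λ i _ → solve 3 (λ c e u → u := c :* e :+ u :- c :* e) refl c (e i) (u i)) su) ,
          λ i d → trans (comb LA c e u i d) (trans (cong (c * A e i +_) (Au≈ i d))
                    (solve 3 (λ c e w → c :* e :+ (w :- c :* e) := w) refl c (A e i) (w i)))

    -- When `A e` lies in the span of the later images, it has a preimage `s` in the span of the
    -- later vectors. Then `A` kills `e ⊟ s`, which is not zero because `e` is outside that span.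
    kernel-vector : ∀ {A} → Linear A → ∀ es → Indep es → ¬ Indep (map A es) →
      ∃ λ u → Span es u × u ≉ 𝟘 × A u ≈ 𝟘
    kernel-vector LA []       _ ¬ind = ⊥-elim (¬ind tt)
    kernel-vector {A} LA (e ∷ es) (e∉ , ind) ¬ind with em {Indep (map A es)}
    ... | no ¬ind′ = let u , su , rest = kernel-vector LA es ind ¬ind′ in u , Span-there e es su , rest
    ... | yes ind′ with em {Span (map A es) (A e)}
    ...   | no Ae∉  = ⊥-elim (¬ind (Ae∉ , ind′))
    ...   | yes Ae∈ with Span-preimage LA es Ae∈
    ...     | s , s∈ , As≈Ae = e ⊟ s ,
              (1# , Span-resp es (λ i _ → solve 2 (λ e s → :- :1 :* s :+ :0 := e :- s :- :1 :* e) refl (e i) (s i))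
                      (Span-comb es (- 1#) s∈ (Span-𝟘 es))) ,
              (λ e≈s → e∉ (Span-resp es (λ i d → by-multiple (- 1#) (e≈s i d) (solve 2 (λ e s → s :+ :- :1 :* :0 := e :+ :- :1 :* (e :- s)) refl (e i) (s i))) s∈)) ,
              λ i d → trans (diff LA e s i d) (trans (cong (_-_ (A e i)) (As≈Ae i d)) (-‿inverseʳ (A e i)))

    iter : (V → V) → ℕ → V → V
    iter A zero    v = v
    iter A (suc k) v = A (iter A k v)

    -- This is p(A) v. Since it is `lin` along the orbit of v, a polynomial identity stated for all
    -- sequences becomes an identity of operators.
    act : (V → V) → List F → V → V
    act A p v i = lin p (λ k → iter A k v i)

    iter-commute : ∀ {A G} → Linear A → Commute A G → ∀ k v → iter A k (G v) ≈ G (iter A k v)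
    iter-commute LA AG zero    v = λ _ _ → refl
    iter-commute {A} LA AG (suc k) v = ≈-trans (respects LA (iter-commute LA AG k v)) (AG (iter A k v))

    act-commute : ∀ {A G} → Linear A → Linear G → Commute A G → ∀ p v → act A p (G v) ≈ G (act A p v)
    act-commute LA LG AG [] v = ≈-sym (preserves-𝟘 LG)
    act-commute {A} {G} LA LG AG (a ∷ p) v i d =
      trans (cong₂ (λ x y → a * x + y) (iter-commute LA AG (length p) v i d) (act-commute LA LG AG p v i d))
            (sym (comb LG a (iter A (length p) v) (act A p v) i d))

    act-subspace : ∀ {A U} → Subspace U → (∀ {u} → U u → U (A u)) → ∀ p {v} → U v → U (act A p v)
    act-subspace SU AU []      Uv = Subspace.zero∈ SU
    act-subspace {A} {U} SU AU (a ∷ p) {v} Uv = Subspace.comb SU a (iter∈ (length p)) (act-subspace SU AU p Uv)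
      where
      iter∈ : ∀ k → U (iter A k v)
      iter∈ zero    = Uv
      iter∈ (suc k) = AU (iter∈ k)

    powers : (V → V) → ℕ → V → List V
    powers A zero    v = []
    powers A (suc k) v = iter A k v ∷ powers A k v

    length-powers : ∀ A k v → length (powers A k v) ≡ k
    length-powers A zero    v = refl
    length-powers A (suc k) v = cong suc (length-powers A k v)

    Span-powers : ∀ A es d v {u} → Span (powers A d v ++ es) u → ∃ λ p → length p ≡ d × Span es (u ⊟ act A p v)
    Span-powers A es zero    v {u} s = [] , refl , Span-resp es (λ i _ → solve 1 (λ u → u := u :- :0) refl (u i)) s
    Span-powers A es (suc d) v {u} (c , s) with Span-powers A es d v s
    ... | p , refl , s′ = c ∷ p , refl , Span-resp es
          (λ i _ → solve 4 (λ u c e f → u :- c :* e :- f := u :- (c :* e :+ f)) refl (u i) c (iter A (length p) v i) (act A p v i)) s′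

    act∈powers : ∀ A es p v → Span (powers A (length p) v ++ es) (act A p v)
    act∈powers A es []      v = Span-𝟘 es
    act∈powers A es (a ∷ p) v = a , Span-resp _ (λ i _ → solve 3 (λ a x y → y := a :* x :+ y :- a :* x) refl a (iter A (length p) v i) (act A p v i))
                                     (act∈powers A es p v)

    iter∈powers : ∀ A es d v j → j ℕ.< d → Span (powers A d v ++ es) (iter A j v)
    iter∈powers A es (suc d) v j (ℕ.s≤s j≤d) with ℕₚ.m≤n⇒m<n∨m≡n j≤d
    ... | inj₁ j<d  = Span-there _ (powers A d v ++ es) (iter∈powers A es d v j j<d)
    ... | inj₂ refl = Span-here (iter A d v) (powers A d v ++ es)

    powers-indep : ∀ A es d v → Indep (powers A d v ++ es) → ∀ j → j ℕ.< d → ¬ Span (powers A j v ++ es) (iter A j v)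
    powers-indep A es (suc d) v (top∉ , ind) j (ℕ.s≤s j≤d) with ℕₚ.m≤n⇒m<n∨m≡n j≤d
    ... | inj₁ j<d  = powers-indep A es d v ind j j<d
    ... | inj₂ refl = top∉

    -- Otherwise the leading power of `A` would be a combination of lower powers and `es`, against
    -- independence.
    monic∉Span : ∀ A es d v → Indep (powers A d v ++ es) → ∀ q → length q ℕ.< d → ¬ Span es (act A (1# ∷ q) v)
    monic∉Span A es d v ind q q<d s = powers-indep A es d v ind (length q) q<d
      (Span-resp _ (λ i _ → solve 2 (λ x y → :- :1 :* y :+ (:1 :* x :+ y) := x) refl (iter A (length q) v i) (act A q v i))
        (Span-comb _ (- 1#) (act∈powers A es q v) (Span-++ (powers A (length q) v) es s)))

-- Vectors over F killed by a quadratic polynomial of an operator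

module Annihilators (em : ExcludedMiddle 0ℓ) (𝓕 : RealClosedField) where

  open Basics em 𝓕
  open LinearAlgebra em 𝓕

  module RealEigen (I : Set) (D : I → Set) where
    open VectorSpace I D
    open Linear

    record Basis (U : V → Set) : Set where
      field
        vectors : List V
        inside  : All U vectors
        indep   : Indep vectors
        spans   : ∀ {u} → U u → Span vectors u

      dim : ℕ
      dim = length vectors

      bound : ∀ us → All U us → Indep us → length us ℕ.≤ dim
      bound us Uus ind = steinitz vectors us (All.map spans Uus) ind

    quadratic : (V → V) → F → F → V → V
    quadratic A b c u = A (A u) ⊞ (b ⊡ A u ⊞ c ⊡ u)

    shifted : (V → V) → F → V → V
    shifted A r u = A u ⊟ r ⊡ u

    quadratic-linear : ∀ {A} → Linear A → ∀ b c → Linear (quadratic A b c)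
    quadratic-linear {A} LA b c = record
      { respects = λ u≈v i d → cong₂ _+_ (respects LA (respects LA u≈v) i d)
                                 (cong₂ (λ x y → b * x + c * y) (respects LA u≈v i d) (u≈v i d))
      ; comb = λ k u v i d → trans
          (cong₂ (λ x y → x + (b * y + c * (k * u i + v i)))
            (trans (respects LA (comb LA k u v) i d) (comb LA k (A u) (A v) i d)) (comb LA k u v i d))
          (solve 9 (λ k b c a₂u a₂v au av u v →
               k :* a₂u :+ a₂v :+ (b :* (k :* au :+ av) :+ c :* (k :* u :+ v))
               := k :* (a₂u :+ (b :* au :+ c :* u)) :+ (a₂v :+ (b :* av :+ c :* v))) refl
             k b c (A (A u) i) (A (A v) i) (A u i) (A v i) (u i) (v i)) }

    shifted-linear : ∀ {A} → Linear A → ∀ r → Linear (shifted A r)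
    shifted-linear {A} LA r = record
      { respects = λ u≈v i d → cong₂ (λ x y → x - r * y) (respects LA u≈v i d) (u≈v i d)
      ; comb = λ k u v i d → trans (cong (_- r * (k * u i + v i)) (comb LA k u v i d))
          (solve 6 (λ k r au av u v → k :* au :+ av :- r :* (k :* u :+ v) := k :* (au :- r :* u) :+ (av :- r :* v)) refl
             k r (A u i) (A v i) (u i) (v i)) }

    quadratic-comm : ∀ {A B} → Linear A → Linear B → Commute B A → ∀ b c → Commute B (quadratic A b c)
    quadratic-comm {A} {B} LA LB BA b c u i d = begin
      B (A (A u) ⊞ (b ⊡ A u ⊞ c ⊡ u)) i
        ≡⟨ respects LB (λ i _ → cong (_+ (b * A u i + c * u i)) (sym (*-identityˡ (A (A u) i)))) i d ⟩
      B (1# ⊡ A (A u) ⊞ (b ⊡ A u ⊞ c ⊡ u)) i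
        ≡⟨ comb LB 1# (A (A u)) (b ⊡ A u ⊞ c ⊡ u) i d ⟩
      1# * B (A (A u)) i + B (b ⊡ A u ⊞ c ⊡ u) i
        ≡⟨ cong₂ (λ x y → 1# * x + y) (trans (BA (A u) i d) (respects LA (BA u) i d)) (comb LB b (A u) (c ⊡ u) i d) ⟩
      1# * A (A (B u)) i + (b * B (A u) i + B (c ⊡ u) i)
        ≡⟨ cong₂ (λ x y → 1# * A (A (B u)) i + (b * x + y)) (BA u i d)
             (trans (respects LB (λ i _ → sym (+-identityʳ (c * u i))) i d)
               (trans (comb LB c u 𝟘 i d) (trans (cong (c * B u i +_) (preserves-𝟘 LB i d)) (+-identityʳ (c * B u i))))) ⟩
      1# * A (A (B u)) i + (b * A (B u) i + c * B u i)
        ≡⟨ cong (_+ (b * A (B u) i + c * B u i)) (*-identityˡ (A (A (B u)) i)) ⟩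
      quadratic A b c (B u) i ∎
      where
      open ≡-Reasoning

    shifted-comm : ∀ {A} → Linear A → ∀ r → Commute A (shifted A r)
    shifted-comm {A} LA r u = sub LA (A u) r u

    -- This is the trace that a complex eigenvector leaves over F: real eigenvalues and conjugate
    -- pairs are both covered by a monic quadratic.
    Annihilated : (V → Set) → (V → V) → Set
    Annihilated U A = ∃ λ u → U u × u ≉ 𝟘 × ∃ λ b → ∃ λ c → quadratic A b c u ≈ 𝟘

    -- Adjoin Krylov blocks v, A v, …, A^(d-1) v to an invariant independent family es until K ∤ d. The factor of
    -- the minimal polynomial of that block then yields an operator G = g(A) mapping the span of one more vector into Span es.
    module _ {U} (SU : Subspace U) {A} (LA : Linear A) (AU : ∀ {u} → U u → U (A u)) (B : Basis U)
             (K : ℕ) (factor : ∀ p → ¬ K ∣ length p → Factors p) where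
      open Basis B

      powers-inside : ∀ j {v} → U v → All U (powers A j v)
      powers-inside zero    Uv = []
      powers-inside (suc j) {v} Uv = iter∈ j ∷ powers-inside j Uv
        where
        iter∈ : ∀ k → U (iter A k v)
        iter∈ zero    = Uv
        iter∈ (suc k) = AU (iter∈ k)

      -- The block ends because an independent family inside `U` has at most `dim` members; the fuel
      -- measures the distance to this bound.
      krylov : ∀ fuel es v j → All U es → U v → Indep (powers A j v ++ es) → dim ℕ.< fuel ℕ.+ (j ℕ.+ length es) →
        ∃ λ d → j ℕ.≤ d × Indep (powers A d v ++ es) × Span (powers A d v ++ es) (iter A d v)
      krylov zero es v j Ues Uv ind lt = ⊥-elim (ℕₚ.<-irrefl refl (ℕₚ.<-≤-trans lt
        (subst (ℕ._≤ dim) (trans (length-++ (powers A j v)) (cong (ℕ._+ length es) (length-powers A j v)))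
          (bound _ (Allₚ.++⁺ (powers-inside j Uv) Ues) ind))))
      krylov (suc fuel) es v j Ues Uv ind lt with em {Span (powers A j v ++ es) (iter A j v)}
      ... | yes s = j , ℕₚ.≤-refl , ind , s
      ... | no ¬s with krylov fuel es v (suc j) Ues Uv (¬s , ind) (subst (dim ℕ.<_) (sym (ℕₚ.+-suc fuel (j ℕ.+ length es))) lt)
      ...   | d , j<d , rest = d , ℕₚ.<⇒≤ j<d , rest

      invariant : ∀ es → All (λ e → Span es (A e)) es → ∀ {u} → Span es u → Span es (A u)
      invariant es inv s = Span-least (Span-subspace es) (map A es) (Allₚ.map⁺ inv) (Span-image LA es s)

      -- Put w = q(A) v with q monic. The family `w ∷ es` is independent, but `G` maps it into the
      -- span of `es`, which has one generator fewer. Hence `G` has a kernel vector.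
      descend : ∀ {G} → Linear G → Commute A G → ∀ es → All U es → Indep es → (∀ {u} → Span es u → Span es (G u)) →
        ∀ {v} → U v → ∀ d → Indep (powers A d v ++ es) → ∀ q → length q ℕ.< d →
        Span es (act A (1# ∷ q) (G v)) → ∃ λ u → U u × u ≉ 𝟘 × G u ≈ 𝟘
      descend {G} LG AG es Ues ind GS {v} Uv d indp q q<d s =
        let u , u∈ , u≉ , Gu = kernel-vector LG (w ∷ es) (monic∉Span A es d v indp q q<d , ind) dep
        in u , Span-least SU (w ∷ es) (act-subspace SU AU (1# ∷ q) Uv ∷ Ues) u∈ , u≉ , Gu
        where
        w : V
        w = act A (1# ∷ q) v
        dep : ¬ Indep (map G (w ∷ es))
        dep indG = ℕₚ.<-irrefl refl (subst (ℕ._≤ length es) (cong suc (length-map G es))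
          (steinitz es (map G (w ∷ es))
            (Span-resp es (act-commute LA LG AG (1# ∷ q) v) s ∷ Allₚ.map⁺ (All.map GS (Span-self es))) indG))

      annihilate : ∀ es → All U es → Indep es → All (λ e → Span es (A e)) es → ∀ {v} → U v → ∀ d →
        Indep (powers A d v ++ es) → Span (powers A d v ++ es) (iter A d v) → ¬ K ∣ d → Annihilated U A
      annihilate es Ues ind inv {v} Uv d indp s K∤d with Span-powers A es d v s
      ... | p , refl , s′ = [ linear , quadr ]′ (factor p⁻ (λ K∣ → K∤d (subst (K ∣_) (length-map -_ p) K∣)))
        where
        p⁻ : List F
        p⁻ = map -_ p
        lin-neg : ∀ p s → lin (map -_ p) s ≡ - lin p s
        lin-neg []      s = solve 0 (:0 := :- :0) refl
        lin-neg (a ∷ p) s = trans (cong₂ (λ n y → - a * s n + y) (length-map -_ p) (lin-neg p s))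
          (solve 3 (λ a x y → :- a :* x :+ :- y := :- (a :* x :+ y)) refl a (s (length p)) (lin p s))
        minimal : ∀ i → iter A (length p) v i - act A p v i ≡ iter A (length p⁻) v i + act A p⁻ v i
        minimal i = cong₂ _+_ (cong (λ n → iter A n v i) (sym (length-map -_ p))) (sym (lin-neg p (λ k → iter A k v i)))
        AS : ∀ {u} → Span es u → Span es (A u)
        AS = invariant es inv

        linear : (∃ λ r → ∃ λ q → suc (length q) ≡ length p⁻ ×
          ∀ s → s (length p⁻) + lin p⁻ s ≡ lin (1# ∷ q) (λ k → s (suc k) - r * s k)) → Annihilated U A
        linear (r , q , len , fact) =
          let u , Uu , u≉ , Gu = descend LG (shifted-comm LA r) es Ues ind GS Uv (length p) indp q
                (ℕₚ.≤-reflexive (trans len (length-map -_ p)))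
                (Span-resp es (λ i d → trans (minimal i) (trans (fact (λ k → iter A k v i))
                   (lin-cong (1# ∷ q) (λ k → sym (iterG k i d)) ))) s′)
          -- What A - r kills is also killed by A (A - r), which is quadratic.
          in u , Uu , u≉ , - r , 0# , λ i d → begin
               A (A u) i + (- r * A u i + 0# * u i)  ≡⟨ solve 4 (λ x r y z → x :+ (:- r :* y :+ :0 :* z) := x :- r :* y) refl (A (A u) i) r (A u i) (u i) ⟩
               A (A u) i - r * A u i                 ≡⟨ sym (sub LA (A u) r u i d) ⟩
               A (shifted A r u) i                   ≡⟨ respects LA Gu i d ⟩
               A 𝟘 i                                 ≡⟨ preserves-𝟘 LA i d ⟩
               0#                                    ∎
          where
          open ≡-Reasoning
          LG = shifted-linear LA r
          iterG : ∀ k i → D i → iter A k (shifted A r v) i ≡ iter A (suc k) v i - r * iter A k v i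
          iterG k = iter-commute LA (shifted-comm LA r) k v
          GS : ∀ {u} → Span es u → Span es (shifted A r u)
          GS {u} s = Span-resp es (λ i _ → solve 3 (λ r x y → :- r :* x :+ y := y :- r :* x) refl r (u i) (A u i))
                       (Span-comb es (- r) s (AS s))

        quadr : (∃ λ b → ∃ λ c → ∃ λ q → suc (suc (length q)) ≡ length p⁻ ×
          ∀ s → s (length p⁻) + lin p⁻ s ≡ lin (1# ∷ q) (λ k → s (suc (suc k)) + (b * s (suc k) + c * s k))) → Annihilated U A
        quadr (b , c , q , len , fact) =
          let u , Uu , u≉ , Gu = descend LG comm es Ues ind GS Uv (length p) indp q
                (ℕₚ.≤-trans (ℕₚ.n≤1+n _) (ℕₚ.≤-reflexive (trans len (length-map -_ p))))
                (Span-resp es (λ i d → trans (minimal i) (trans (fact (λ k → iter A k v i))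
                   (lin-cong (1# ∷ q) (λ k → sym (iter-commute LA comm k v i d))))) s′)
          in u , Uu , u≉ , b , c , Gu
          where
          LG = quadratic-linear LA b c
          comm : Commute A (quadratic A b c)
          comm = quadratic-comm LA LA (λ _ _ _ → refl) b c
          GS : ∀ {u} → Span es u → Span es (quadratic A b c u)
          GS {u} s = Span-resp es (λ i _ → solve 5 (λ x b y c z → :1 :* x :+ (b :* y :+ (c :* z :+ :0)) := x :+ (b :* y :+ c :* z)) refl
                                         (A (A u) i) b (A u i) c (u i))
                       (Span-comb es 1# (AS (AS s)) (Span-comb es b (AS s) (Span-comb es c s (Span-𝟘 es))))

      -- Blocks of lengths divisible by `K` cannot exhaust `U`, since `K` would then divide `dim`.
      -- Each block has positive length, so the fuel, a bound for the missing dimensions, decreases.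
      extend : ∀ fuel es → All U es → Indep es → All (λ e → Span es (A e)) es → K ∣ length es → ¬ K ∣ dim →
        dim ℕ.≤ fuel ℕ.+ length es → Annihilated U A
      extend fuel es Ues ind inv K∣es K∤ le with em {∃ λ v → U v × ¬ Span es v}
      ... | no all = ⊥-elim (K∤ (subst (K ∣_) (ℕₚ.≤-antisym (bound es Ues ind)
              (steinitz es vectors (All.map (λ {b} Ub → in-span b Ub) inside) indep)) K∣es))
        where
        in-span : ∀ b → U b → Span es b
        in-span b Ub with em {Span es b}
        ... | yes s = s
        ... | no ¬s = ⊥-elim (all (b , Ub , ¬s))
      ... | yes (v , Uv , v∉) with krylov (suc dim) es v 1 Ues Uv (v∉ , ind) (ℕ.s≤s (ℕₚ.m≤m+n dim (1 ℕ.+ length es)))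
      ...   | d , 1≤d , indp , s with em {K ∣ d}
      ...     | no K∤d  = annihilate es Ues ind inv Uv d indp s K∤d
      extend zero es Ues ind inv K∣es K∤ le | yes (v , Uv , v∉) | d , 1≤d , indp , s | yes K∣d =
        ⊥-elim (ℕₚ.<-irrefl refl (ℕₚ.≤-trans (bound (v ∷ es) (Uv ∷ Ues) (v∉ , ind)) le))
      extend (suc fuel) es Ues ind inv K∣es K∤ le | yes (v , Uv , v∉) | d , 1≤d , indp , s | yes K∣d =
        extend fuel (powers A d v ++ es) (Allₚ.++⁺ (powers-inside d Uv) Ues) indp
          (Allₚ.++⁺ (blocks d ℕₚ.≤-refl) (All.map (Span-++ (powers A d v) es) inv))
          (subst (K ∣_) (sym len) (∣m∣n⇒∣m+n K∣d K∣es)) K∤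
          (ℕₚ.≤-trans le (subst₂ ℕ._≤_ refl (cong (fuel ℕ.+_) (sym len)) (ℕₚ.≤-trans (ℕₚ.≤-reflexive (sym (ℕₚ.+-suc fuel (length es))))
            (ℕₚ.+-monoʳ-≤ fuel (ℕₚ.+-monoˡ-≤ (length es) 1≤d)))))
        where
        len : length (powers A d v ++ es) ≡ d ℕ.+ length es
        len = trans (length-++ (powers A d v)) (cong (ℕ._+ length es) (length-powers A d v))
        next∈ : ∀ j → suc j ℕ.≤ d → Span (powers A d v ++ es) (iter A (suc j) v)
        next∈ j j<d with ℕₚ.m≤n⇒m<n∨m≡n j<d
        ... | inj₁ sj<d = iter∈powers A es d v (suc j) sj<d
        ... | inj₂ refl = s
        blocks : ∀ j → j ℕ.≤ d → All (λ e → Span (powers A d v ++ es) (A e)) (powers A j v)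
        blocks zero    _   = []
        blocks (suc j) j<d = next∈ j j<d ∷ blocks j (ℕₚ.<⇒≤ j<d)

      annihilated : ¬ K ∣ dim → Annihilated U A
      annihilated K∤ = extend dim [] [] tt [] (K ∣0) K∤ (ℕₚ.≤-reflexive (sym (ℕₚ.+-identityʳ dim)))

-- Square roots and quadratic equations over the complex numbers

module ComplexRoots (em : ExcludedMiddle 0ℓ) (𝓕 : RealClosedField) where

  open Basics em 𝓕
  open Order em 𝓕

  abstract
    -- Supplies as many distinct parameters κ for the pencil as the dimension count asks for.
    descending : ∀ n → ∃ λ xs → length xs ≡ n × AllPairs (λ x y → y < x) xs × ∃ λ b → All (_< b) xs
    descending zero    = [] , refl , [] , 0# , []
    descending (suc n) with descending n
    ... | xs , refl , pairs , b , below-b =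
          b ∷ xs , refl , below-b ∷ pairs , b + 1# , above b ∷ All.map (λ x<b → <-trans x<b (above b)) below-b

  abstract
    -- For b ≠ 0 take the modulus r with r² = a² + b², then x with x² = (r + a)/2, and y = b/(2x).
    complex-sqrt : ∀ a b → ∃ λ x → ∃ λ y → x * x - y * y ≡ a × 2# * (x * y) ≡ b
    complex-sqrt a b with em {b ≡ 0#}
    complex-sqrt a b | yes refl with compare a 0#
    ... | tri< a<0 _ _ = let y , yy = sqrt (- a) (neg-pos a<0) in
          0# , y , by-multiple 1# (sym yy) (solve 2 (λ y a → :0 :* :0 :- y :* y :+ :1 :* (y :* y) := a :+ :1 :* (:- a)) refl y a)
          , solve 1 (λ y → (:1 :+ :1) :* (:0 :* y) := :0) refl y
    ... | tri≈ _ refl _ = 0# , 0# , solve 0 (:0 :* :0 :- :0 :* :0 := :0) refl , solve 0 ((:1 :+ :1) :* (:0 :* :0) := :0) refl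
    ... | tri> _ _ 0<a = let x , xx = sqrt a 0<a in
          x , 0# , trans (solve 1 (λ x → x :* x :- :0 :* :0 := x :* x) refl x) xx , solve 1 (λ x → (:1 :+ :1) :* (x :* :0) := :0) refl x
    complex-sqrt a b | no b≢0 = x , ½ * b * i , real , imag
      where
      norm>0 : 0# < b * b + a * a
      norm>0 = +-pos-≤ (sq-pos b≢0) (sq-nonneg a)
      positive-root : ∀ z → 0# < z → ∃ λ r → 0# < r × r * r ≡ z
      positive-root z 0<z with sqrt z 0<z
      ... | r , rr with compare r 0#
      ...   | tri< r<0 _ _  = - r , neg-pos r<0 , trans (solve 1 (λ r → :- r :* :- r := r :* r) refl r) rr
      ...   | tri≈ _ refl _ = ⊥-elim (pos≢0 0<z (trans (sym rr) (zeroˡ 0#)))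
      ...   | tri> _ _ 0<r  = r , 0<r , rr
      r : F
      r = proj₁ (positive-root _ norm>0)
      0<r : 0# < r
      0<r = proj₁ (proj₂ (positive-root _ norm>0))
      rr : r * r ≡ b * b + a * a
      rr = proj₂ (proj₂ (positive-root _ norm>0))
      bb : (r + a) * (r - a) ≡ b * b
      bb = trans (solve 2 (λ r a → (r :+ a) :* (r :- a) := r :* r :- a :* a) refl r a)
            (trans (cong (_- a * a) rr) (solve 2 (λ b a → b :* b :+ a :* a :- a :* a := b :* b) refl b a))
      -- The numbers r + a and r - a have the positive product b² and the positive sum 2r, so r + a
      -- cannot fail to be positive.
      0<r+a : 0# < r + a
      0<r+a with <⊎≥ 0# (r + a)
      ... | inj₁ lt = lt
      ... | inj₂ ge with <⊎≥ 0# (r - a)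
      ...   | inj₁ 0<r-a = ⊥-elim (<⇒≱ (sq-pos b≢0) (nonpos ge))
        where
        nonpos : r + a ≤ 0# → b * b ≤ 0#
        nonpos (inj₁ lt) = inj₁ (subst (_< 0#) bb (*-neg-pos lt 0<r-a))
        nonpos (inj₂ e)  = inj₂ (trans (sym bb) (trans (cong (_* (r - a)) e) (zeroˡ (r - a))))
      ...   | inj₂ le = ⊥-elim (<⇒≱ (+-pos 0<r 0<r) (subst (_≤ 0#) (solve 2 (λ r a → (r :+ a) :+ (r :- a) := r :+ r) refl r a) (sum-nonpos ge le)))
        where
        sum-nonpos : ∀ {x y} → x ≤ 0# → y ≤ 0# → x + y ≤ 0#
        sum-nonpos {x} {y} (inj₁ x<0) (inj₁ y<0) = inj₁ (<-trans (subst (x + y <_) (+-identityˡ y) (+-mono-< x 0# y x<0)) y<0)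
        sum-nonpos {x} (inj₁ x<0) (inj₂ refl) = inj₁ (subst (_< 0#) (sym (+-identityʳ x)) x<0)
        sum-nonpos {y = y} (inj₂ refl) y≤0 = subst (_≤ 0#) (sym (+-identityˡ y)) y≤0
      0<xx : 0# < ½ * (r + a)
      0<xx = *-pos ½ (r + a) 0<½ 0<r+a
      x : F
      x = proj₁ (positive-root _ 0<xx)
      0<x : 0# < x
      0<x = proj₁ (proj₂ (positive-root _ 0<xx))
      xx : x * x ≡ ½ * (r + a)
      xx = proj₂ (proj₂ (positive-root _ 0<xx))
      i : F
      i = proj₁ (inverse x (pos≢0 0<x))
      xi : x * i ≡ 1#
      xi = proj₂ (inverse x (pos≢0 0<x))
      imag : 2# * (x * (½ * b * i)) ≡ b
      imag = trans (solve 4 (λ x h b i → (:1 :+ :1) :* (x :* (h :* b :* i)) := ((:1 :+ :1) :* h) :* (x :* i) :* b) refl x ½ b i)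
        (trans (cong₂ (λ s t → s * t * b) 2*½≡1 xi) (solve 1 (λ b → :1 :* :1 :* b := b) refl b))
      -- With x² = (r + a)/2 one has (b/2x)² = (r² - a²)/4x² = (r - a)/2.
      real : x * x - (½ * b * i) * (½ * b * i) ≡ a
      real = begin
        x * x - (½ * b * i) * (½ * b * i)
          ≡⟨ cong (_- (½ * b * i) * (½ * b * i)) xx ⟩
        ½ * (r + a) - (½ * b * i) * (½ * b * i)
          ≡⟨ cong (_-_ (½ * (r + a))) (trans (solve 3 (λ h b i → (h :* b :* i) :* (h :* b :* i) := h :* h :* (i :* i) :* (b :* b)) refl ½ b i)
               (trans (cong (½ * ½ * (i * i) *_) (sym bb))
                 (solve 4 (λ h i r a → h :* h :* (i :* i) :* ((r :+ a) :* (r :- a)) := (h :* (r :+ a)) :* (i :* i) :* (h :* (r :- a))) refl ½ i r a))) ⟩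
        ½ * (r + a) - (½ * (r + a)) * (i * i) * (½ * (r - a))
          ≡⟨ cong (λ z → ½ * (r + a) - z * (i * i) * (½ * (r - a))) (sym xx) ⟩
        ½ * (r + a) - (x * x) * (i * i) * (½ * (r - a))
          ≡⟨ cong (λ z → ½ * (r + a) - z) (solve 3 (λ x i z → (x :* x) :* (i :* i) :* z := (x :* i) :* (x :* i) :* z) refl x i (½ * (r - a))) ⟩
        ½ * (r + a) - (x * i) * (x * i) * (½ * (r - a))
          ≡⟨ cong (λ z → ½ * (r + a) - z * z * (½ * (r - a))) xi ⟩
        ½ * (r + a) - 1# * 1# * (½ * (r - a))
          ≡⟨ solve 3 (λ h r a → h :* (r :+ a) :- :1 :* :1 :* (h :* (r :- a)) := ((:1 :+ :1) :* h) :* a) refl ½ r a ⟩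
        (2# * ½) * a
          ≡⟨ trans (cong (_* a) 2*½≡1) (*-identityˡ a) ⟩
        a ∎
        where open ≡-Reasoning

  -- Complex numbers are pairs (real part, imaginary part).
  abstract
    complex-quadratic : ∀ pr pi qr qi → ∃ λ βr → ∃ λ βi →
      βr * βr - βi * βi + (pr * βr - pi * βi) + qr ≡ 0# × 2# * (βr * βi) + (pr * βi + pi * βr) + qi ≡ 0#
    complex-quadratic pr pi qr qi
      with complex-sqrt (pr * pr - pi * pi - 2# * 2# * qr) (2# * (pr * pi) - 2# * 2# * qi)
    ... | x , y , re , im = ½ * (x - pr) , ½ * (y - pi) ,
      -- The usual formula β = (√(p² - 4q) - p)/2 holds only modulo 2h = 1 for the half h; the
      -- multiple of 1 - 2h on the right is removed by `collapse`.
      trans (solve 7 (λ h pr pi qr qi x y →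
         (h :* (x :- pr)) :* (h :* (x :- pr)) :- (h :* (y :- pi)) :* (h :* (y :- pi)) :+ (pr :* (h :* (x :- pr)) :- pi :* (h :* (y :- pi))) :+ qr
         := h :* h :* (x :* x :- y :* y :- (pr :* pr :- pi :* pi :- (:1 :+ :1) :* (:1 :+ :1) :* qr))
            :+ (:1 :- (:1 :+ :1) :* h) :* (h :* (x :* pr :- pr :* pr :- y :* pi :+ pi :* pi) :+ (:1 :+ (:1 :+ :1) :* h) :* qr)) refl ½ pr pi qr qi x y)
       (collapse re) ,
      trans (solve 7 (λ h pr pi qr qi x y →
         (:1 :+ :1) :* ((h :* (x :- pr)) :* (h :* (y :- pi))) :+ (pr :* (h :* (y :- pi)) :+ pi :* (h :* (x :- pr))) :+ qi
         := h :* h :* ((:1 :+ :1) :* (x :* y) :- ((:1 :+ :1) :* (pr :* pi) :- (:1 :+ :1) :* (:1 :+ :1) :* qi))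
            :+ (:1 :- (:1 :+ :1) :* h) :* (h :* (x :* pi :+ pr :* y :- pr :* pi :- pr :* pi) :+ (:1 :+ (:1 :+ :1) :* h) :* qi)) refl ½ pr pi qr qi x y)
       (collapse im)
      where
      collapse : ∀ {k s t z} → s ≡ t → k * (s - t) + (1# - 2# * ½) * z ≡ 0#
      collapse {k} {s} {_} {z} refl = trans (cong (λ w → k * (s - s) + (1# - w) * z) 2*½≡1)
        (solve 3 (λ k s z → k :* (s :- s) :+ (:1 :- :1) :* z := :0) refl k s z)

-- Complex eigenvectors and Laplace's pencil

module Pencils (em : ExcludedMiddle 0ℓ) (𝓕 : RealClosedField) where

  open Basics em 𝓕
  open Order em 𝓕
  open LinearAlgebra em 𝓕
  open Annihilators em 𝓕
  open ComplexRoots em 𝓕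

  eliminated : ∀ {ttu A qr qi R S u v} → ttu + A + (qr * u - qi * v) ≡ 0# → R + qr ≡ 0# → S + qi ≡ 0# →
    ttu ≡ - A + (R * u - S * v)
  eliminated {ttu} {A} {qr} {qi} {R} {S} {u} {v} e₁ e₂ e₃ = by-multiple 1# e₁ (by-multiple (- u) e₂ (by-multiple v e₃
    (solve 8 (λ ttu A qr qi R S u v → ttu :+ :1 :* :0 :+ :- u :* :0 :+ v :* :0
        := :- A :+ (R :* u :- S :* v) :+ :1 :* (ttu :+ A :+ (qr :* u :- qi :* v)) :+ :- u :* (R :+ qr) :+ v :* (S :+ qi)) refl
       ttu A qr qi R S u v)))

  private
    -- Real and imaginary parts of the identity T²w - βTw = (- p - β)(Tw - βw), valid when T²w + pTw
    -- + qw = 0 and q = - β² - pβ. Here R + √-1 S is β² + pβ.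
    module Shift (pr pi βr βi u v tu tv : F) where
      R S : F
      R = βr * βr - βi * βi + (pr * βr - pi * βi)
      S = 2# * (βr * βi) + (pr * βi + pi * βr)

      re : - (pr * tu - pi * tv) + (R * u - S * v) - (βr * tu - βi * tv)
           ≡ (- pr - βr) * (tu - (βr * u - βi * v)) - (- pi - βi) * (tv - (βi * u + βr * v))
      re = solve 8 (λ pr pi br bi u v tu tv →
             :- (pr :* tu :- pi :* tv) :+ ((br :* br :- bi :* bi :+ (pr :* br :- pi :* bi)) :* u :- ((:1 :+ :1) :* (br :* bi) :+ (pr :* bi :+ pi :* br)) :* v) :- (br :* tu :- bi :* tv)
             := (:- pr :- br) :* (tu :- (br :* u :- bi :* v)) :- (:- pi :- bi) :* (tv :- (bi :* u :+ br :* v))) refl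
           pr pi βr βi u v tu tv

      im : - (pr * tv + pi * tu) + (R * v - - S * u) - (βi * tu + βr * tv)
           ≡ (- pi - βi) * (tu - (βr * u - βi * v)) + (- pr - βr) * (tv - (βi * u + βr * v))
      im = solve 8 (λ pr pi br bi u v tu tv →
             :- (pr :* tv :+ pi :* tu) :+ ((br :* br :- bi :* bi :+ (pr :* br :- pi :* bi)) :* v :- (:- ((:1 :+ :1) :* (br :* bi) :+ (pr :* bi :+ pi :* br))) :* u) :- (bi :* tu :+ br :* tv)
             := (:- pi :- bi) :* (tu :- (br :* u :- bi :* v)) :+ (:- pr :- br) :* (tv :- (bi :* u :+ br :* v))) refl
           pr pi βr βi u v tu tv

      module _ {ttu ttv qr qi : F} (rootRe : R + qr ≡ 0#) (rootIm : S + qi ≡ 0#) where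
        shift-re : ttu + (pr * tu - pi * tv) + (qr * u - qi * v) ≡ 0# →
          ttu - (βr * tu - βi * tv) ≡ (- pr - βr) * (tu - (βr * u - βi * v)) - (- pi - βi) * (tv - (βi * u + βr * v))
        shift-re e = trans (cong (_- (βr * tu - βi * tv)) (eliminated {qr = qr} {qi = qi} e rootRe rootIm)) re

        shift-im : ttv + (pr * tv + pi * tu) + (qr * v + qi * u) ≡ 0# →
          ttv - (βi * tu + βr * tv) ≡ (- pi - βi) * (tu - (βr * u - βi * v)) + (- pr - βr) * (tv - (βi * u + βr * v))
        shift-im e = trans (cong (_- (βi * tu + βr * tv)) (eliminated {qr = qr} {qi = - qi} e′ rootRe rootIm⁻)) im
          where
          e′ : ttv + (pr * tv + pi * tu) + (qr * v - - qi * u) ≡ 0#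
          e′ = trans (cong (ttv + (pr * tv + pi * tu) +_) (solve 4 (λ q v r u → q :* v :- :- r :* u := q :* v :+ r :* u) refl qr v qi u)) e
          rootIm⁻ : - S + - qi ≡ 0#
          rootIm⁻ = trans (solve 2 (λ S q → :- S :+ :- q := :- (S :+ q)) refl S qi) (trans (cong -_ rootIm) (solve 0 (:- :0 := :0) refl))

  module JointEigen (I : Set) (D : I → Set) where
    open VectorSpace I D
    open Linear
    open RealEigen I D

    -- The pair (u , v) stands for the complex vector u + √-1 v.
    NonZero₂ : V → V → Set
    NonZero₂ u v = ¬ (u ≈ 𝟘 × v ≈ 𝟘)

    Eigen₂ : (V → V) → F → F → V → V → Set
    Eigen₂ T αr αi u v = T u ≈ αr ⊡ u ⊟ αi ⊡ v × T v ≈ αi ⊡ u ⊞ αr ⊡ v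

    Quadratic₂ : (V → V) → F → F → F → F → V → V → Set
    Quadratic₂ T pr pi qr qi u v =
      T (T u) ⊞ (pr ⊡ T u ⊟ pi ⊡ T v) ⊞ (qr ⊡ u ⊟ qi ⊡ v) ≈ 𝟘 ×
      T (T v) ⊞ (pr ⊡ T v ⊞ pi ⊡ T u) ⊞ (qr ⊡ v ⊞ qi ⊡ u) ≈ 𝟘

    shiftRe shiftIm : (V → V) → F → F → V → V → V
    shiftRe T βr βi u v = T u ⊟ (βr ⊡ u ⊟ βi ⊡ v)
    shiftIm T βr βi u v = T v ⊟ (βi ⊡ u ⊞ βr ⊡ v)

    comb₂ : ∀ {T} → Linear T → ∀ a u b v → T (a ⊡ u ⊞ b ⊡ v) ≈ a ⊡ T u ⊞ b ⊡ T v
    comb₂ {T} LT a u b v i d = trans (comb LT a u (b ⊡ v) i d) (cong (a * T u i +_)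
      (trans (respects LT (λ i _ → sym (+-identityʳ (b * v i))) i d)
        (trans (comb LT b v 𝟘 i d) (trans (cong (b * T v i +_) (preserves-𝟘 LT i d)) (+-identityʳ (b * T v i))))))

    comb₂⁻ : ∀ {T} → Linear T → ∀ a u b v → T (a ⊡ u ⊟ b ⊡ v) ≈ a ⊡ T u ⊟ b ⊡ T v
    comb₂⁻ {T} LT a u b v i d = trans (respects LT (λ i _ → solve 3 (λ x b y → x :- b :* y := x :+ :- b :* y) refl (a * u i) b (v i)) i d)
      (trans (comb₂ LT a u (- b) v i d) (solve 3 (λ x b y → x :+ :- b :* y := x :- b :* y) refl (a * T u i) b (T v i)))

    -- With β a root of the quadratic and β′ the other one, either (T - β)w vanishes or it is an eigenvector for β′.
    complex-eigenvector : ∀ {T} → Linear T → (Φ : V → V → Set) →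
      (∀ βr βi u v → Φ u v → Φ (shiftRe T βr βi u v) (shiftIm T βr βi u v)) →
      ∀ pr pi qr qi u v → Φ u v → NonZero₂ u v → Quadratic₂ T pr pi qr qi u v →
      ∃ λ αr → ∃ λ αi → ∃ λ u′ → ∃ λ v′ → Φ u′ v′ × NonZero₂ u′ v′ × Eigen₂ T αr αi u′ v′
    complex-eigenvector {T} LT Φ shift pr pi qr qi u v Φuv nz (re , im) =
      from-root (proj₁ root) (proj₁ (proj₂ root)) (proj₁ (proj₂ (proj₂ root))) (proj₂ (proj₂ (proj₂ root)))
      where
      root = complex-quadratic pr pi qr qi

      shifted-eigen : ∀ βr βi → βr * βr - βi * βi + (pr * βr - pi * βi) + qr ≡ 0# →
        2# * (βr * βi) + (pr * βi + pi * βr) + qi ≡ 0# →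
        Eigen₂ T (- pr - βr) (- pi - βi) (shiftRe T βr βi u v) (shiftIm T βr βi u v)
      shifted-eigen βr βi rootRe rootIm =
            (λ i d → trans (diff LT (T u) (βr ⊡ u ⊟ βi ⊡ v) i d)
              (trans (cong (_-_ (T (T u) i)) (comb₂⁻ LT βr u βi v i d))
                (Shift.shift-re pr pi βr βi (u i) (v i) (T u i) (T v i) {T (T u) i} {T (T v) i} rootRe rootIm (re i d)))) ,
            (λ i d → trans (diff LT (T v) (βi ⊡ u ⊞ βr ⊡ v) i d)
              (trans (cong (_-_ (T (T v) i)) (comb₂ LT βi u βr v i d))
                (Shift.shift-im pr pi βr βi (u i) (v i) (T u i) (T v i) {T (T u) i} {T (T v) i} rootRe rootIm (im i d))))

      from-root : ∀ βr βi → βr * βr - βi * βi + (pr * βr - pi * βi) + qr ≡ 0# →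
        2# * (βr * βi) + (pr * βi + pi * βr) + qi ≡ 0# →
        ∃ λ αr → ∃ λ αi → ∃ λ u′ → ∃ λ v′ → Φ u′ v′ × NonZero₂ u′ v′ × Eigen₂ T αr αi u′ v′
      from-root βr βi rootRe rootIm with em {shiftRe T βr βi u v ≈ 𝟘 × shiftIm T βr βi u v ≈ 𝟘}
      ... | yes (u′≈0 , v′≈0) = βr , βi , u , v , Φuv , nz , (λ i d → x-y≡0⇒x≡y (u′≈0 i d)) , (λ i d → x-y≡0⇒x≡y (v′≈0 i d))
      ... | no nz′ = - pr - βr , - pi - βi , shiftRe T βr βi u v , shiftIm T βr βi u v , shift βr βi u v Φuv , nz′ , shifted-eigen βr βi rootRe rootIm

    Commute-sym : ∀ A B → Commute A B → Commute B A
    Commute-sym A B AB u = ≈-sym (AB u)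

    module CommonKernel {U} (SU : Subspace U) (B : Basis U)
      (M : F → V → V) (LM : ∀ κ → Linear (M κ)) (MU : ∀ κ {u} → U u → U (M κ u)) (MM : ∀ κ κ′ → Commute (M κ) (M κ′))
      where
      open Basis B

      KernelSum : List F → V → Set
      KernelSum []       u = u ≈ 𝟘
      KernelSum (κ ∷ κs) u = ∃ λ z → U z × M κ z ≈ 𝟘 × KernelSum κs (u ⊟ z)

      Disjoint : F → F → Set
      Disjoint κ κ′ = ∀ u → U u → M κ u ≈ 𝟘 → M κ′ u ≈ 𝟘 → u ≈ 𝟘

      KernelSum-resp : ∀ κs {u v} → u ≈ v → KernelSum κs u → KernelSum κs v
      KernelSum-resp []       u≈v s = ≈-trans (≈-sym u≈v) s
      KernelSum-resp (κ ∷ κs) u≈v (z , Uz , Mz , s) = z , Uz , Mz , KernelSum-resp κs (λ i d → cong (_- z i) (u≈v i d)) s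

      map-zero : ∀ κ κ′ {z} → M κ z ≈ 𝟘 → M κ (M κ′ z) ≈ 𝟘
      map-zero κ κ′ {z} Mz = ≈-trans (MM κ κ′ z) (≈-trans (respects (LM κ′) Mz) (preserves-𝟘 (LM κ′)))

      KernelSum-map : ∀ κ κs {u} → KernelSum κs u → KernelSum κs (M κ u)
      KernelSum-map κ []        s = ≈-trans (respects (LM κ) s) (preserves-𝟘 (LM κ))
      KernelSum-map κ (κ′ ∷ κs) {u} (z , Uz , Mz , s) =
        M κ z , MU κ Uz , map-zero κ′ κ Mz , KernelSum-resp κs (diff (LM κ) u z) (KernelSum-map κ κs s)

      -- Applying M κ to u - z reduces the claim for κ ∷ κ′ ∷ κs to the claims for κ′ ∷ κs and κ ∷ κs.
      direct : ∀ κ κs → AllPairs Disjoint (κ ∷ κs) → ∀ {u} → U u → M κ u ≈ 𝟘 → KernelSum κs u → u ≈ 𝟘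
      direct κ []        _ Uu Mu s = s
      direct κ (κ′ ∷ κs) ((dis ∷ diss) ∷ (diss′ ∷ rest)) {u} Uu Mu (z , Uz , Mz , s) =
        direct κ κs (diss ∷ rest) Uu Mu
          (KernelSum-resp κs (λ i d → trans (cong (_-_ (u i)) (z≈0 i d)) (solve 1 (λ x → x :- :0 := x) refl (u i))) s)
        where
        U-z : U (M κ (u ⊟ z))
        U-z = MU κ (Subspace.respects SU (λ i _ → solve 2 (λ u z → :- :1 :* z :+ u := u :- z) refl (u i) (z i)) (Subspace.comb SU (- 1#) Uz Uu))
        image : M κ (u ⊟ z) ≈ (- 1#) ⊡ M κ z
        image i d = trans (diff (LM κ) u z i d) (trans (cong (_- M κ z i) (Mu i d)) (solve 1 (λ z → :0 :- z := :- :1 :* z) refl (M κ z i)))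
        killed : M κ′ (M κ (u ⊟ z)) ≈ 𝟘
        killed i d = begin
          M κ′ (M κ (u ⊟ z)) i                ≡⟨ respects (LM κ′) image i d ⟩
          M κ′ ((- 1#) ⊡ M κ z) i             ≡⟨ respects (LM κ′) (λ i _ → sym (+-identityʳ (- 1# * M κ z i))) i d ⟩
          M κ′ ((- 1#) ⊡ M κ z ⊞ 𝟘) i         ≡⟨ comb (LM κ′) (- 1#) (M κ z) 𝟘 i d ⟩
          - 1# * M κ′ (M κ z) i + M κ′ 𝟘 i    ≡⟨ cong₂ (λ x y → - 1# * x + y) (map-zero κ′ κ Mz i d) (preserves-𝟘 (LM κ′) i d) ⟩
          - 1# * 0# + 0#                      ≡⟨ solve 0 (:- :1 :* :0 :+ :0 := :0) refl ⟩
          0#                                  ∎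
          where open ≡-Reasoning
        Mκ[u-z]≈0 : M κ (u ⊟ z) ≈ 𝟘
        Mκ[u-z]≈0 = direct κ′ κs (diss′ ∷ rest) U-z killed (KernelSum-map κ κs s)
        z≈0 : z ≈ 𝟘
        z≈0 = dis z Uz (λ i d → trans (solve 1 (λ z → z := :- (:- :1 :* z)) refl (M κ z i))
                (trans (cong -_ (trans (sym (image i d)) (Mκ[u-z]≈0 i d))) (solve 0 (:- :0 := :0) refl))) Mz

      module _ (w : F → V) (Uw : ∀ κ → U (w κ)) (w≉0 : ∀ κ → w κ ≉ 𝟘) (Mw : ∀ κ → M κ (w κ) ≈ 𝟘) where
        Span⇒KernelSum : ∀ κs {u} → Span (map w κs) u → KernelSum κs u
        Span⇒KernelSum []       s = s
        Span⇒KernelSum (κ ∷ κs) (c , s) = c ⊡ w κ , scaled (Uw κ) , killed , Span⇒KernelSum κs s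
          where
          scaled : ∀ {u} → U u → U (c ⊡ u)
          scaled {u} Uu = Subspace.respects SU (λ i _ → +-identityʳ (c * u i)) (Subspace.comb SU c Uu (Subspace.zero∈ SU))
          killed : M κ (c ⊡ w κ) ≈ 𝟘
          killed i d = trans (respects (LM κ) (λ i _ → sym (+-identityʳ (c * w κ i))) i d)
            (trans (comb (LM κ) c (w κ) 𝟘 i d) (trans (cong₂ (λ x y → c * x + y) (Mw κ i d) (preserves-𝟘 (LM κ) i d))
              (solve 1 (λ c → c :* :0 :+ :0 := :0) refl c)))

        independent : ∀ κs → AllPairs Disjoint κs → Indep (map w κs)
        independent []       _ = tt
        independent (κ ∷ κs) ap@(_ ∷ rest) =
          (λ s → w≉0 κ (direct κ κs ap (Uw κ) (Mw κ) (Span⇒KernelSum κs s))) , independent κs rest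

        -- Otherwise the kernels meet pairwise in 0 and, as the operators commute, their sum is
        -- direct. Vectors `w κ` for `suc dim` many κ would then be independent inside `U`.
        common-kernel : ∃ λ κ → ∃ λ κ′ → κ′ < κ × ∃ λ u → U u × u ≉ 𝟘 × M κ u ≈ 𝟘 × M κ′ u ≈ 𝟘
        common-kernel with em {∃ λ κ → ∃ λ κ′ → κ′ < κ × ∃ λ u → U u × u ≉ 𝟘 × M κ u ≈ 𝟘 × M κ′ u ≈ 𝟘}
        ... | yes found = found
        ... | no none   = let κs , len , desc , _ = descending (suc dim) in
              ⊥-elim (ℕₚ.<-irrefl refl (subst (ℕ._≤ dim) (trans (length-map w κs) len)
                (bound (map w κs) (Allₚ.map⁺ (All.universal Uw κs)) (independent κs (AllPairs.map disjoint desc)))))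
          where
          disjoint : ∀ {κ κ′} → κ′ < κ → Disjoint κ κ′
          disjoint {κ} {κ′} lt u Uu Mu M′u with em {u ≈ 𝟘}
          ... | yes u≈0 = u≈0
          ... | no u≉0  = ⊥-elim (none (κ , κ′ , lt , u , Uu , u≉0 , Mu , M′u))

    -- The real polynomial t² - 2 Re(α) t + |α|² has the root α, so it kills both the real and the
    -- imaginary part; one of them is not zero.
    Eigen₂⇒quadratic : ∀ {T} → Linear T → ∀ {αr αi u v} → Eigen₂ T αr αi u v → NonZero₂ u v →
      ∃ λ w → w ≉ 𝟘 × ∃ λ b → ∃ λ c → quadratic T b c w ≈ 𝟘
    Eigen₂⇒quadratic {T} LT {αr} {αi} {u} {v} (eu , ev) nz with em {u ≈ 𝟘}
    ... | no u≉0 = u , u≉0 , - (2# * αr) , αr * αr + αi * αi , λ i d →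
          trans (cong₂ (λ x y → x + (- (2# * αr) * y + (αr * αr + αi * αi) * u i))
                   (trans (respects LT eu i d) (trans (comb₂⁻ LT αr u αi v i d) (cong₂ (λ x y → αr * x - αi * y) (eu i d) (ev i d)))) (eu i d))
            (solve 4 (λ a b u v → a :* (a :* u :- b :* v) :- b :* (b :* u :+ a :* v) :+ (:- ((:1 :+ :1) :* a) :* (a :* u :- b :* v) :+ (a :* a :+ b :* b) :* u) := :0) refl αr αi (u i) (v i))
    ... | yes u≈0 = v , (λ v≈0 → nz (u≈0 , v≈0)) , - (2# * αr) , αr * αr + αi * αi , λ i d →
          trans (cong₂ (λ x y → x + (- (2# * αr) * y + (αr * αr + αi * αi) * v i))
                   (trans (respects LT ev i d) (trans (comb₂ LT αi u αr v i d) (cong₂ (λ x y → αi * x + αr * y) (eu i d) (ev i d)))) (ev i d))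
            (solve 4 (λ a b u v → b :* (a :* u :- b :* v) :+ a :* (b :* u :+ a :* v) :+ (:- ((:1 :+ :1) :* a) :* (b :* u :+ a :* v) :+ (a :* a :+ b :* b) :* v) := :0) refl αr αi (u i) (v i))

    -- Laplace's pencil X + Y + κ X Y. Two of its members with a common eigenvector give one for X + Y and X Y, and
    -- X² - (X + Y) X + X Y = 0.
    module Pencil {X Y} (LX : Linear X) (LY : Linear Y) (XY : Commute X Y) where

      pencil : F → V → V
      pencil κ u = X u ⊞ Y u ⊞ κ ⊡ X (Y u)

      comb₃ : ∀ {T} → Linear T → ∀ a b κ c → T (a ⊞ b ⊞ κ ⊡ c) ≈ T a ⊞ T b ⊞ κ ⊡ T c
      comb₃ {T} LT a b κ c i d = begin
        T (a ⊞ b ⊞ κ ⊡ c) i              ≡⟨ respects LT (λ i _ → solve 4 (λ a b k c → a :+ b :+ k :* c := k :* c :+ (:1 :* a :+ b)) refl (a i) (b i) κ (c i)) i d ⟩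
        T (κ ⊡ c ⊞ (1# ⊡ a ⊞ b)) i       ≡⟨ comb LT κ c (1# ⊡ a ⊞ b) i d ⟩
        κ * T c i + T (1# ⊡ a ⊞ b) i     ≡⟨ cong (κ * T c i +_) (comb LT 1# a b i d) ⟩
        κ * T c i + (1# * T a i + T b i) ≡⟨ solve 4 (λ a b k c → k :* c :+ (:1 :* a :+ b) := a :+ b :+ k :* c) refl (T a i) (T b i) κ (T c i) ⟩
        T a i + T b i + κ * T c i        ∎
        where open ≡-Reasoning

      pencil-linear : ∀ κ → Linear (pencil κ)
      pencil-linear κ = record
        { respects = λ u≈v i d → cong₂ (λ x y → x + κ * y) (cong₂ _+_ (respects LX u≈v i d) (respects LY u≈v i d))
                                   (respects LX (respects LY u≈v) i d)
        ; comb = λ k u v i d → trans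
            (cong₂ (λ x y → x + κ * y) (cong₂ _+_ (comb LX k u v i d) (comb LY k u v i d))
              (trans (respects LX (comb LY k u v) i d) (comb LX k (Y u) (Y v) i d)))
            (solve 8 (λ k κ xu xv yu yv zu zv → (k :* xu :+ xv) :+ (k :* yu :+ yv) :+ κ :* (k :* zu :+ zv)
               := k :* (xu :+ yu :+ κ :* zu) :+ (xv :+ yv :+ κ :* zv)) refl
              k κ (X u i) (X v i) (Y u i) (Y v i) (X (Y u) i) (X (Y v) i)) }

      pencil-comm : ∀ {T} → Linear T → Commute T X → Commute T Y → ∀ κ → Commute T (pencil κ)
      pencil-comm LT TX TY κ u i d = trans (comb₃ LT (X u) (Y u) κ (X (Y u)) i d)
        (cong₂ (λ x y → x + κ * y) (cong₂ _+_ (TX u i d) (TY u i d)) (trans (TX (Y u) i d) (respects LX (TY u) i d)))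

      pencils-comm : ∀ κ κ′ → Commute (pencil κ) (pencil κ′)
      pencils-comm κ κ′ = pencil-comm (pencil-linear κ)
        (Commute-sym X (pencil κ) (pencil-comm LX (λ _ _ _ → refl) XY κ))
        (Commute-sym Y (pencil κ) (pencil-comm LY (Commute-sym X Y XY) (λ _ _ _ → refl) κ)) κ′

      shift-subspace : ∀ {T} {W : V → Set} → Subspace W → (∀ {u} → W u → W (T u)) →
        ∀ βr βi u v → W u × W v → W (shiftRe T βr βi u v) × W (shiftIm T βr βi u v)
      shift-subspace {T} SW TW βr βi u v (Wu , Wv) =
        Subspace.respects SW (λ i _ → solve 5 (λ a u b v t → :- a :* u :+ (b :* v :+ t) := t :- (a :* u :- b :* v)) refl βr (u i) βi (v i) (T u i))
          (Subspace.comb SW (- βr) Wu (Subspace.comb SW βi Wv (TW Wu))) ,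
        Subspace.respects SW (λ i _ → solve 5 (λ a u b v t → :- b :* u :+ (:- a :* v :+ t) := t :- (b :* u :+ a :* v)) refl βr (u i) βi (v i) (T v i))
          (Subspace.comb SW (- βi) Wu (Subspace.comb SW (- βr) Wv (TW Wv)))

      -- Operators commuting with `S` preserve its eigenspaces, and T - β is such an operator.
      shift-eigen : ∀ {S T} → Linear S → Linear T → Commute S T → ∀ λr λi βr βi u v → Eigen₂ S λr λi u v →
        Eigen₂ S λr λi (shiftRe T βr βi u v) (shiftIm T βr βi u v)
      shift-eigen {S} {T} LS LT ST λr λi βr βi u v (eu , ev) =
        (λ i d → trans (diff LS (T u) (βr ⊡ u ⊟ βi ⊡ v) i d)
          (trans (cong₂ _-_ (trans (ST u i d) (trans (respects LT eu i d) (comb₂⁻ LT λr u λi v i d)))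
                            (trans (comb₂⁻ LS βr u βi v i d) (cong₂ (λ x y → βr * x - βi * y) (eu i d) (ev i d))))
            (re (u i) (v i) (T u i) (T v i)))) ,
        (λ i d → trans (diff LS (T v) (βi ⊡ u ⊞ βr ⊡ v) i d)
          (trans (cong₂ _-_ (trans (ST v i d) (trans (respects LT ev i d) (comb₂ LT λi u λr v i d)))
                            (trans (comb₂ LS βi u βr v i d) (cong₂ (λ x y → βi * x + βr * y) (eu i d) (ev i d))))
            (im (u i) (v i) (T u i) (T v i))))
        where
        re : ∀ u v tu tv → λr * tu - λi * tv - (βr * (λr * u - λi * v) - βi * (λi * u + λr * v))
                           ≡ λr * (tu - (βr * u - βi * v)) - λi * (tv - (βi * u + βr * v))
        re u v tu tv = solve 8 (λ lr li br bi u v tu tv →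
          lr :* tu :- li :* tv :- (br :* (lr :* u :- li :* v) :- bi :* (li :* u :+ lr :* v))
          := lr :* (tu :- (br :* u :- bi :* v)) :- li :* (tv :- (bi :* u :+ br :* v))) refl λr λi βr βi u v tu tv
        im : ∀ u v tu tv → λi * tu + λr * tv - (βi * (λr * u - λi * v) + βr * (λi * u + λr * v))
                           ≡ λi * (tu - (βr * u - βi * v)) + λr * (tv - (βi * u + βr * v))
        im u v tu tv = solve 8 (λ lr li br bi u v tu tv →
          li :* tu :+ lr :* tv :- (bi :* (lr :* u :- li :* v) :+ br :* (li :* u :+ lr :* v))
          := li :* (tu :- (br :* u :- bi :* v)) :+ lr :* (tv :- (bi :* u :+ br :* v))) refl λr λi βr βi u v tu tv

      kernel-subspace : ∀ {U T} → Subspace U → Linear T → Subspace (λ u → U u × T u ≈ 𝟘)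
      kernel-subspace SU LT = record
        { respects = λ u≈v (Uu , Tu) → Subspace.respects SU u≈v Uu , ≈-trans (≈-sym (respects LT u≈v)) Tu
        ; comb = λ c {u} {v} (Uu , Tu) (Uv , Tv) → Subspace.comb SU c Uu Uv ,
            λ i d → trans (comb LT c u v i d) (trans (cong₂ (λ x y → c * x + y) (Tu i d) (Tv i d)) (solve 1 (λ c → c :* :0 :+ :0 := :0) refl c))
        ; zero∈ = Subspace.zero∈ SU , preserves-𝟘 LT }

      quadratic⇒Quadratic₂ : ∀ {T b c u v} → quadratic T b c u ≈ 𝟘 → quadratic T b c v ≈ 𝟘 → Quadratic₂ T b 0# c 0# u v
      quadratic⇒Quadratic₂ {T} {b} {c} {u} {v} qu qv =
        (λ i d → trans (solve 7 (λ b c ttu tu u tv v → ttu :+ (b :* tu :- :0 :* tv) :+ (c :* u :- :0 :* v) := ttu :+ (b :* tu :+ c :* u)) refl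
                          b c (T (T u) i) (T u i) (u i) (T v i) (v i)) (qu i d)) ,
        (λ i d → trans (solve 7 (λ b c ttu tu u tv v → ttu :+ (b :* tu :+ :0 :* tv) :+ (c :* u :+ :0 :* v) := ttu :+ (b :* tu :+ c :* u)) refl
                          b c (T (T v) i) (T v i) (v i) (T u i) (u i)) (qv i d))

      module _ {U} (SU : Subspace U) (B : Basis U) (pencil-U : ∀ κ {u} → U u → U (pencil κ u))
               (annihilated : ∀ κ → Annihilated U (pencil κ)) where

        b c : F → F
        b κ = proj₁ (proj₂ (proj₂ (proj₂ (annihilated κ))))
        c κ = proj₁ (proj₂ (proj₂ (proj₂ (proj₂ (annihilated κ)))))

        M : F → V → V
        M κ = quadratic (pencil κ) (b κ) (c κ)

        LM : ∀ κ → Linear (M κ)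
        LM κ = quadratic-linear (pencil-linear κ) (b κ) (c κ)

        pencil-M : ∀ κ κ′ → Commute (pencil κ) (M κ′)
        pencil-M κ κ′ = quadratic-comm (pencil-linear κ′) (pencil-linear κ) (pencils-comm κ κ′) (b κ′) (c κ′)

        MM : ∀ κ κ′ → Commute (M κ) (M κ′)
        MM κ κ′ = Commute-sym (M κ′) (M κ) (quadratic-comm (pencil-linear κ) (LM κ′) (Commute-sym (pencil κ) (M κ′) (pencil-M κ κ′)) (b κ) (c κ))

        MU : ∀ κ {u} → U u → U (M κ u)
        MU κ {u} Uu = Subspace.respects SU (λ i _ → solve 5 (λ x b y c z → :1 :* x :+ (b :* y :+ (c :* z :+ :0)) := x :+ (b :* y :+ c :* z)) refl
                                                      (pencil κ (pencil κ u) i) (b κ) (pencil κ u i) (c κ) (u i))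
          (Subspace.comb SU 1# (pencil-U κ (pencil-U κ Uu)) (Subspace.comb SU (b κ) (pencil-U κ Uu) (Subspace.comb SU (c κ) Uu (Subspace.zero∈ SU))))

        module Two (κ κ′ λr λi λr′ λi′ i : F) ([κ-κ′]i≡1 : (κ - κ′) * i ≡ 1#) {u v : V}
                   (e : Eigen₂ (pencil κ) λr λi u v) (e′ : Eigen₂ (pencil κ′) λr′ λi′ u v) where
          -- The eigenvalue of X Y, namely (λ - λ′)/(κ - κ′), from the difference of the two
          -- eigenvalue equations. Below, ν = λ - κμ is that of X + Y.
          μr μi : F
          μr = i * (λr - λr′)
          μi = i * (λi - λi′)

          product-term : ∀ {x y z a a′} → x + y + κ * z ≡ a → x + y + κ′ * z ≡ a′ → z ≡ i * (a - a′)
          product-term {x} {y} {z} refl refl = by-multiple z (sym [κ-κ′]i≡1)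
            (solve 6 (λ x y z k k′ i → z :+ z :* ((k :- k′) :* i) := i :* (x :+ y :+ k :* z :- (x :+ y :+ k′ :* z)) :+ z :* :1) refl x y z κ κ′ i)

          product-re : X (Y u) ≈ μr ⊡ u ⊟ μi ⊡ v
          product-re j d = trans (product-term (proj₁ e j d) (proj₁ e′ j d))
            (solve 7 (λ i a b a′ b′ u v → i :* ((a :* u :- b :* v) :- (a′ :* u :- b′ :* v)) := i :* (a :- a′) :* u :- i :* (b :- b′) :* v) refl
               i λr λi λr′ λi′ (u j) (v j))

          product-im : X (Y v) ≈ μi ⊡ u ⊞ μr ⊡ v
          product-im j d = trans (product-term (proj₂ e j d) (proj₂ e′ j d))
            (solve 7 (λ i a b a′ b′ u v → i :* ((b :* u :+ a :* v) :- (b′ :* u :+ a′ :* v)) := i :* (b :- b′) :* u :+ i :* (a :- a′) :* v) refl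
               i λr λi λr′ λi′ (u j) (v j))

          νr νi : F
          νr = λr - κ * μr
          νi = λi - κ * μi

          sum-re : X u ⊞ Y u ≈ νr ⊡ u ⊟ νi ⊡ v
          sum-re j d = sums (proj₁ e j d) (product-re j d)
            where
            sums : ∀ {s z} → s + κ * z ≡ λr * u j - λi * v j → z ≡ μr * u j - μi * v j → s ≡ νr * u j - νi * v j
            sums {s} p refl = by-multiple 1# p (solve 8 (λ s k a b mr mi u v → s :+ :1 :* (a :* u :- b :* v)
              := (a :- k :* mr) :* u :- (b :- k :* mi) :* v :+ :1 :* (s :+ k :* (mr :* u :- mi :* v))) refl s κ λr λi μr μi (u j) (v j))

          sum-im : X v ⊞ Y v ≈ νi ⊡ u ⊞ νr ⊡ v
          sum-im j d = sums (proj₂ e j d) (product-im j d)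
            where
            sums : ∀ {s z} → s + κ * z ≡ λi * u j + λr * v j → z ≡ μi * u j + μr * v j → s ≡ νi * u j + νr * v j
            sums {s} p refl = by-multiple 1# p (solve 8 (λ s k a b mr mi u v → s :+ :1 :* (b :* u :+ a :* v)
              := (b :- k :* mi) :* u :+ (a :- k :* mr) :* v :+ :1 :* (s :+ k :* (mi :* u :+ mr :* v))) refl s κ λr λi μr μi (u j) (v j))

          X-sum : ∀ u → X (X u ⊞ Y u) ≈ X (X u) ⊞ X (Y u)
          X-sum u j d = trans (respects LX (λ j _ → cong (_+ Y u j) (sym (*-identityˡ (X u j)))) j d)
            (trans (comb LX 1# (X u) (Y u) j d) (cong (_+ X (Y u) j) (*-identityˡ (X (X u) j))))

          square : Quadratic₂ X (- νr) (- νi) μr μi u v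
          square =
            (λ j d → expand₁ (trans (sym (X-sum u j d)) (trans (respects LX sum-re j d) (comb₂⁻ LX νr u νi v j d))) (product-re j d)) ,
            (λ j d → expand₂ (trans (sym (X-sum v j d)) (trans (respects LX sum-im j d) (comb₂ LX νi u νr v j d))) (product-im j d))
            where
            expand₁ : ∀ {xx xy m xu xv} → xx + xy ≡ νr * xu - νi * xv → xy ≡ m → xx + (- νr * xu - - νi * xv) + m ≡ 0#
            expand₁ {xx} {m = m} {xu} {xv} p refl = by-multiple 1# p (solve 6 (λ xx m xu xv a b → xx :+ (:- a :* xu :- :- b :* xv) :+ m :+ :1 :* (a :* xu :- b :* xv)
              := :0 :+ :1 :* (xx :+ m)) refl xx m xu xv νr νi)
            expand₂ : ∀ {xx xy xu xv mu mv} → xx + xy ≡ νi * xu + νr * xv → xy ≡ mu + mv → xx + (- νr * xv + - νi * xu) + (mv + mu) ≡ 0#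
            expand₂ {xx} {_} {xu} {xv} {mu} {mv} p refl = by-multiple 1# p (solve 7 (λ xx mu mv xu xv a b → xx :+ (:- a :* xv :+ :- b :* xu) :+ (mv :+ mu) :+ :1 :* (b :* xu :+ a :* xv)
              := :0 :+ :1 :* (xx :+ (mu :+ mv))) refl xx mu mv xu xv νr νi)

          X-annihilated : NonZero₂ u v → ∃ λ w → w ≉ 𝟘 × ∃ λ b → ∃ λ c → quadratic X b c w ≈ 𝟘
          X-annihilated nz = last (complex-eigenvector LX (λ _ _ → ⊤) (λ _ _ _ _ _ → tt) (- νr) (- νi) μr μi u v tt nz square)
            where
            last : (∃ λ αr → ∃ λ αi → ∃ λ u′ → ∃ λ v′ → ⊤ × NonZero₂ u′ v′ × Eigen₂ X αr αi u′ v′) →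
              ∃ λ w → w ≉ 𝟘 × ∃ λ b → ∃ λ c → quadratic X b c w ≈ 𝟘
            last (_ , _ , _ , _ , _ , nz′ , e″) = Eigen₂⇒quadratic LX e″ nz′

        -- The vector `u₀` is read as the complex vector `(u₀ , 𝟘)`. An eigenvector for κ is sought
        -- inside the kernel of `M κ′`, then one for κ′ inside the eigenspace already found; the
        -- invariant Φ of `complex-eigenvector` keeps track of these spaces.
        two-members : ∀ κ κ′ → κ′ < κ → (∃ λ u → U u × u ≉ 𝟘 × M κ u ≈ 𝟘 × M κ′ u ≈ 𝟘) →
          ∃ λ w → w ≉ 𝟘 × ∃ λ b → ∃ λ c → quadratic X b c w ≈ 𝟘
        two-members κ κ′ κ′<κ (u₀ , Uu₀ , u₀≉0 , Mu₀ , M′u₀) =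
          first (complex-eigenvector (pencil-linear κ) (λ u v → W u × W v) (shift-subspace SW W-closed)
            (b κ) 0# (c κ) 0# u₀ 𝟘 ((Uu₀ , M′u₀) , Subspace.zero∈ SW) (λ p → u₀≉0 (proj₁ p))
            (quadratic⇒Quadratic₂ {pencil κ} Mu₀ (preserves-𝟘 (LM κ))))
          where
          W : V → Set
          W u = U u × M κ′ u ≈ 𝟘
          SW : Subspace W
          SW = kernel-subspace SU (LM κ′)
          W-closed : ∀ {u} → W u → W (pencil κ u)
          W-closed {u} (Uu , Mu) = pencil-U κ Uu ,
            ≈-trans (≈-sym (pencil-M κ κ′ u)) (≈-trans (respects (pencil-linear κ) Mu) (preserves-𝟘 (pencil-linear κ)))

          second : ∀ {λr λi} → (∃ λ λr′ → ∃ λ λi′ → ∃ λ u → ∃ λ v → Eigen₂ (pencil κ) λr λi u v × NonZero₂ u v × Eigen₂ (pencil κ′) λr′ λi′ u v) →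
            ∃ λ w → w ≉ 𝟘 × ∃ λ b → ∃ λ c → quadratic X b c w ≈ 𝟘
          second {λr} {λi} (λr′ , λi′ , u , v , e , nz , e′) =
            Two.X-annihilated κ κ′ λr λi λr′ λi′ _ (proj₂ (inverse (κ - κ′) (pos≢0 (0<-diff κ′<κ)))) e e′ nz
          first : (∃ λ λr → ∃ λ λi → ∃ λ u → ∃ λ v → (W u × W v) × NonZero₂ u v × Eigen₂ (pencil κ) λr λi u v) →
            ∃ λ w → w ≉ 𝟘 × ∃ λ b → ∃ λ c → quadratic X b c w ≈ 𝟘
          first (λr , λi , u , v , ((_ , M′u) , (_ , M′v)) , nz , e) = second
            (complex-eigenvector (pencil-linear κ′) (Eigen₂ (pencil κ) λr λi)
              (shift-eigen (pencil-linear κ) (pencil-linear κ′) (pencils-comm κ κ′) λr λi)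
              (b κ′) 0# (c κ′) 0# u v e nz (quadratic⇒Quadratic₂ {pencil κ′} M′u M′v))

        pencil-eigenvector : ∃ λ w → w ≉ 𝟘 × ∃ λ b → ∃ λ c → quadratic X b c w ≈ 𝟘
        pencil-eigenvector =
          let κ , κ′ , κ′<κ , common = CommonKernel.common-kernel SU B M LM MU MM
                (λ κ → proj₁ (annihilated κ)) (λ κ → proj₁ (proj₂ (annihilated κ))) (λ κ → proj₁ (proj₂ (proj₂ (annihilated κ))))
                (λ κ → proj₂ (proj₂ (proj₂ (proj₂ (proj₂ (annihilated κ))))))
          in two-members κ κ′ κ′<κ common

-- Shift operators on symmetric arrays

module SymmetricArrays (em : ExcludedMiddle 0ℓ) (𝓕 : RealClosedField) where

  open Basics em 𝓕
  open LinearAlgebra em 𝓕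
  open Annihilators em 𝓕
  open Pencils em 𝓕

  -- Arrays indexed by i, j < n, with X and Y shifting each index along the linear recurrence
  -- s (n) = - (p applied to s 0, …, s (n - 1)), so that the monic polynomial with lower coefficients p kills X.
  module Arrays (p : List F) (m : ℕ) (length-p : length p ≡ suc m) where

    Index : Set
    Index = ℕ × ℕ

    n : ℕ
    n = suc m

    Inside : Index → Set
    Inside (i , j) = i ℕ.< n × j ℕ.< n

    open VectorSpace Index Inside
    open Linear
    open RealEigen Index Inside using (Basis; quadratic)

    step : (ℕ → F) → ℕ → F
    step s i with suc i ℕ.<? n
    ... | yes _ = s (suc i)
    ... | no _  = - lin p s

    step-inner : ∀ s i → suc i ℕ.< n → step s i ≡ s (suc i)
    step-inner s i i<m with suc i ℕ.<? n
    ... | yes _  = refl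
    ... | no i≮m = ⊥-elim (i≮m i<m)

    step-last : ∀ s → step s m ≡ - lin p s
    step-last s with suc m ℕ.<? n
    ... | yes m<m = ⊥-elim (ℕₚ.<-irrefl refl m<m)
    ... | no _    = refl

    lin-cong-< : ∀ q {s t} → (∀ k → k ℕ.< length q → s k ≡ t k) → lin q s ≡ lin q t
    lin-cong-< []      s≗t = refl
    lin-cong-< (a ∷ q) s≗t = cong₂ (λ x y → a * x + y) (s≗t (length q) (ℕₚ.n<1+n _))
      (lin-cong-< q (λ k k< → s≗t k (ℕₚ.m<n⇒m<1+n k<)))

    step-cong : ∀ {s t} i → (∀ k → k ℕ.< n → s k ≡ t k) → step s i ≡ step t i
    step-cong i s≗t with suc i ℕ.<? n
    ... | yes i<m = s≗t (suc i) i<m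
    ... | no _    = cong -_ (lin-cong-< p (λ k k< → s≗t k (subst (k ℕ.<_) length-p k<)))

    step-comb : ∀ c s t i → step (λ k → c * s k + t k) i ≡ c * step s i + step t i
    step-comb c s t i with suc i ℕ.<? n
    ... | yes _ = refl
    ... | no _  = trans (cong -_ (lin-+ p c s t)) (solve 3 (λ c x y → :- (c :* x :+ y) := c :* :- x :+ :- y) refl c (lin p s) (lin p t))

    step-zero : ∀ i → step (λ _ → 0#) i ≡ 0#
    step-zero i = trans (step-cong i (λ _ _ → solve 0 (:0 := :- :1 :* :0 :+ :0) refl))
      (trans (step-comb (- 1#) (λ _ → 0#) (λ _ → 0#) i) (solve 1 (λ x → :- :1 :* x :+ x := :0) refl (step (λ _ → 0#) i)))

    lin-step : ∀ q (t : ℕ → ℕ → F) j → lin q (λ k → step (t k) j) ≡ step (λ l → lin q (λ k → t k l)) j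
    lin-step []      t j = sym (step-zero j)
    lin-step (a ∷ q) t j = trans (cong (a * step (t (length q)) j +_) (lin-step q t j))
      (sym (step-comb a (t (length q)) (λ l → lin q (λ k → t k l)) j))

    step-neg : ∀ s j → - step s j ≡ step (λ l → - s l) j
    step-neg s j = sym (trans (step-cong j (λ k _ → solve 1 (λ x → :- x := :- :1 :* x :+ :0) refl (s k)))
      (trans (step-comb (- 1#) s (λ _ → 0#) j)
        (trans (cong (- 1# * step s j +_) (step-zero j)) (solve 1 (λ x → :- :1 :* x :+ :0 := :- x) refl (step s j)))))

    X Y : V → V
    X B (i , j) = step (λ k → B (k , j)) i
    Y B (i , j) = step (λ k → B (i , k)) j

    X-linear : Linear X
    X-linear = record
      { respects = λ u≈v (i , j) (_ , j<n) → step-cong i (λ k k<n → u≈v (k , j) (k<n , j<n))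
      ; comb = λ c u v (i , j) _ → step-comb c (λ k → u (k , j)) (λ k → v (k , j)) i }

    Y-linear : Linear Y
    Y-linear = record
      { respects = λ u≈v (i , j) (i<n , _) → step-cong j (λ k k<n → u≈v (i , k) (i<n , k<n))
      ; comb = λ c u v (i , j) _ → step-comb c (λ k → u (i , k)) (λ k → v (i , k)) j }

    X-Y : Commute X Y
    X-Y B (i , j) _ with suc i ℕ.<? n
    ... | yes _ = refl
    ... | no _  = trans (cong -_ (lin-step p (λ k l → B (k , l)) j)) (step-neg (λ l → lin p (λ k → B (k , l))) j)

    iter-linear : ∀ {A} → Linear A → ∀ k → Linear (iter A k)
    iter-linear LA zero    = record { respects = λ e → e ; comb = λ _ _ _ _ _ → refl }
    iter-linear {A} LA (suc k) = record
      { respects = λ e → respects LA (respects (iter-linear LA k) e)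
      ; comb = λ c u v → ≈-trans (respects LA (comb (iter-linear LA k) c u v)) (comb LA c (iter A k u) (iter A k v)) }

    iter-X : ∀ k i j B → k ℕ.+ i ℕ.< n → iter X k B (i , j) ≡ B (k ℕ.+ i , j)
    iter-X zero    i j B _  = refl
    iter-X (suc k) i j B lt = trans (step-inner (λ l → iter X k B (l , j)) i (ℕₚ.≤-<-trans (ℕ.s≤s (ℕₚ.m≤n+m i k)) lt))
      (trans (iter-X k (suc i) j B (subst (ℕ._< n) (sym (ℕₚ.+-suc k i)) lt)) (cong (λ l → B (l , j)) (ℕₚ.+-suc k i)))

    iter-suc : ∀ k B → iter X (suc k) B ≈ iter X k (X B)
    iter-suc k B = ≈-sym (iter-commute {X} {X} X-linear (λ _ _ _ → refl) k B)

    -- At first index 0 the powers of `X` below the n-th read off the entries of `B`, and the n-th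
    -- power is given by the recurrence, which is exactly the relation claimed.
    annihilates₀ : ∀ B j → j ℕ.< n → act X (1# ∷ p) B (0 , j) ≡ 0#
    annihilates₀ B j j<n = begin
      1# * iter X (length p) B (0 , j) + act X p B (0 , j)
        ≡⟨ cong₂ (λ l y → 1# * iter X l B (0 , j) + y) length-p
             (lin-cong-< p (λ k k< → trans (iter-X k 0 j B (subst (ℕ._< n) (sym (ℕₚ.+-identityʳ k)) (subst (k ℕ.<_) length-p k<)))
                (cong (λ l → B (l , j)) (ℕₚ.+-identityʳ k)))) ⟩
      1# * iter X n B (0 , j) + lin p (λ k → B (k , j))
        ≡⟨ cong (λ x → 1# * x + lin p (λ k → B (k , j))) (iter-suc m B (0 , j) (ℕ.s≤s ℕ.z≤n , j<n)) ⟩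
      1# * iter X m (X B) (0 , j) + lin p (λ k → B (k , j))
        ≡⟨ cong (λ x → 1# * x + lin p (λ k → B (k , j)))
             (trans (iter-X m 0 j (X B) (subst (ℕ._< n) (sym (ℕₚ.+-identityʳ m)) (ℕₚ.n<1+n m)))
               (trans (cong (λ l → X B (l , j)) (ℕₚ.+-identityʳ m)) (step-last (λ k → B (k , j))))) ⟩
      1# * - lin p (λ k → B (k , j)) + lin p (λ k → B (k , j))
        ≡⟨ solve 1 (λ x → :1 :* :- x :+ x := :0) refl (lin p (λ k → B (k , j))) ⟩
      0# ∎
      where open ≡-Reasoning

    -- The i-th power of `X` moves index i to index 0 and commutes with p(X), which reduces the
    -- claim to index 0.
    annihilates : ∀ B → act X (1# ∷ p) B ≈ 𝟘
    annihilates B (i , j) (i<n , j<n) = begin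
      act X (1# ∷ p) B (i , j)             ≡⟨ cong (λ l → act X (1# ∷ p) B (l , j)) (sym (ℕₚ.+-identityʳ i)) ⟩
      act X (1# ∷ p) B (i ℕ.+ 0 , j)       ≡⟨ sym (iter-X i 0 j (act X (1# ∷ p) B) (subst (ℕ._< n) (sym (ℕₚ.+-identityʳ i)) i<n)) ⟩
      iter X i (act X (1# ∷ p) B) (0 , j)  ≡⟨ sym (act-commute {X} {iter X i} X-linear (iter-linear X-linear i) (λ u → ≈-sym (iter-commute {X} {X} X-linear (λ _ _ _ → refl) i u)) (1# ∷ p) B (0 , j) (ℕ.s≤s ℕ.z≤n , j<n)) ⟩
      act X (1# ∷ p) (iter X i B) (0 , j)  ≡⟨ annihilates₀ (iter X i B) j j<n ⟩
      0#                                   ∎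
      where open ≡-Reasoning

    Symmetric : V → Set
    Symmetric B = ∀ i j → i ℕ.< n → j ℕ.< n → B (i , j) ≡ B (j , i)

    symmetric-subspace : Subspace Symmetric
    symmetric-subspace = record
      { respects = λ u≈v Su i j i<n j<n → trans (sym (u≈v (i , j) (i<n , j<n))) (trans (Su i j i<n j<n) (u≈v (j , i) (j<n , i<n)))
      ; comb = λ c Su Sv i j i<n j<n → cong₂ (λ x y → c * x + y) (Su i j i<n j<n) (Sv i j i<n j<n)
      ; zero∈ = λ _ _ _ _ → refl }

    open JointEigen Index Inside
    open Pencil X-linear Y-linear X-Y using (pencil; pencil-linear; pencil-eigenvector)

    -- Transposition exchanges `X` and `Y`; their sum is invariant under this, and so is their
    -- product because they commute.
    pencil-symmetric : ∀ κ {u} → Symmetric u → Symmetric (pencil κ u)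
    pencil-symmetric κ {u} Su i j i<n j<n = begin
      X u (i , j) + Y u (i , j) + κ * X (Y u) (i , j)
        ≡⟨ cong₂ (λ x y → x + κ * y) (trans (cong₂ _+_ (transpose i j j<n) (sym (transpose j i i<n))) (+-comm (Y u (j , i)) (X u (j , i))))
             (trans (step-cong i (λ k k<n → sym (transpose j k k<n))) (sym (X-Y u (j , i) (j<n , i<n)))) ⟩
      X u (j , i) + Y u (j , i) + κ * X (Y u) (j , i) ∎
      where
      open ≡-Reasoning
      transpose : ∀ i j → j ℕ.< n → X u (i , j) ≡ Y u (j , i)
      transpose i j j<n = step-cong i (λ k k<n → Su k j k<n j<n)

    Valid : Index → Set
    Valid (i , j) = i ℕ.≤ j × j ℕ.< n

    Valid⇒Inside : ∀ {q} → Valid q → Inside q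
    Valid⇒Inside (i≤j , j<n) = ℕₚ.≤-<-trans i≤j j<n , j<n

    swap : Index → Index
    swap (i , j) = j , i

    -- Symmetrised matrix unit. The disjunction, unlike a sum of two matrix units, gives 1 on the
    -- diagonal as well.
    indicator : Index → V
    indicator q r with em {q ≡ r ⊎ q ≡ swap r}
    ... | yes _ = 1#
    ... | no _  = 0#

    indicator-self : ∀ q → indicator q q ≡ 1#
    indicator-self q with em {q ≡ q ⊎ q ≡ swap q}
    ... | yes _ = refl
    ... | no ¬e = ⊥-elim (¬e (inj₁ refl))

    indicator-other : ∀ q r → Valid q → Valid r → ¬ q ≡ r → indicator q r ≡ 0#
    indicator-other q r Vq Vr q≢r with em {q ≡ r ⊎ q ≡ swap r}
    ... | no _            = refl
    ... | yes (inj₁ q≡r)  = ⊥-elim (q≢r q≡r)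
    ... | yes (inj₂ refl) = ⊥-elim (q≢r (cong₂ _,_ (ℕₚ.≤-antisym (proj₁ Vq) (proj₁ Vr)) (ℕₚ.≤-antisym (proj₁ Vr) (proj₁ Vq))))

    indicator-symmetric : ∀ q → Symmetric (indicator q)
    indicator-symmetric q i j _ _ with em {q ≡ (i , j) ⊎ q ≡ (j , i)} | em {q ≡ (j , i) ⊎ q ≡ (i , j)}
    ... | yes _ | yes _ = refl
    ... | no _  | no _  = refl
    ... | yes e | no ¬e = ⊥-elim (¬e ([ inj₂ , inj₁ ]′ e))
    ... | no ¬e | yes e = ⊥-elim (¬e ([ inj₂ , inj₁ ]′ e))

    indicators-span : ∀ qs → All Valid qs → ∀ {u} → Symmetric u → (∀ r → Valid r → r ∉ qs → u r ≡ 0#) →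
      Span (map indicator qs) u
    indicators-span [] _ {u} Su zero-off (i , j) (i<n , j<n) with ℕₚ.≤-total i j
    ... | inj₁ i≤j = zero-off (i , j) (i≤j , j<n) (λ ())
    ... | inj₂ j≤i = trans (Su i j i<n j<n) (zero-off (j , i) (j≤i , i<n) (λ ()))
    indicators-span (q ∷ qs) (Vq ∷ Vqs) {u} Su zero-off = u q , indicators-span qs Vqs
      (λ i j i<n j<n → cong₂ (λ x y → x - u q * y) (Su i j i<n j<n) (indicator-symmetric q i j i<n j<n))
      off
      where
      off : ∀ r → Valid r → r ∉ qs → u r - u q * indicator q r ≡ 0#
      off r Vr r∉ with em {q ≡ r}
      ... | yes refl = trans (cong (λ x → u q - u q * x) (indicator-self q)) (solve 1 (λ x → x :- x :* :1 := :0) refl (u q))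
      ... | no q≢r   = trans (cong₂ (λ x y → x - u q * y) (zero-off r Vr λ { (here r≡q) → q≢r (sym r≡q) ; (there r∈) → r∉ r∈ })
                                (indicator-other q r Vq Vr q≢r)) (solve 1 (λ x → :0 :- x :* :0 := :0) refl (u q))

    indicators-indep : ∀ qs → All Valid qs → AllPairs (λ q r → ¬ q ≡ r) qs → Indep (map indicator qs)
    indicators-indep []       _ _ = tt
    indicators-indep (q ∷ qs) (Vq ∷ Vqs) (q∉ ∷ distinct) =
      (λ s → 0≢1 (trans (sym (Span-least vanishing (map indicator qs)
          (Allₚ.map⁺ (All.map (λ {r} (Vr , q≢r) → indicator-other r q Vr Vq (λ r≡q → q≢r (sym r≡q))) (All.zip (Vqs , q∉)))) s))
        (indicator-self q))) ,
      indicators-indep qs Vqs distinct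
      where
      vanishing : Subspace (λ u → u q ≡ 0#)
      vanishing = record
        { respects = λ u≈v e → trans (sym (u≈v q (Valid⇒Inside Vq))) e
        ; comb = λ c e f → trans (cong₂ (λ x y → c * x + y) e f) (solve 1 (λ c → c :* :0 :+ :0 := :0) refl c)
        ; zero∈ = refl }

    row : ℕ → ℕ → List Index
    row zero    j = []
    row (suc k) j = (k , j) ∷ row k j

    pairs : ℕ → List Index
    pairs zero    = []
    pairs (suc j) = row (suc j) j ++ pairs j

    row-all : ∀ k j → All (λ q → proj₁ q ℕ.< k × proj₂ q ≡ j) (row k j)
    row-all zero    j = []
    row-all (suc k) j = (ℕₚ.n<1+n k , refl) ∷ All.map (λ (i<k , e) → ℕₚ.m<n⇒m<1+n i<k , e) (row-all k j)

    pairs-all : ∀ k → All (λ q → proj₁ q ℕ.≤ proj₂ q × proj₂ q ℕ.< k) (pairs k)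
    pairs-all zero    = []
    pairs-all (suc j) = Allₚ.++⁺ (All.map (λ { (i< , refl) → ℕₚ.≤-pred i< , ℕₚ.n<1+n j }) (row-all (suc j) j))
      (All.map (λ (i≤ , lt) → i≤ , ℕₚ.m<n⇒m<1+n lt) (pairs-all j))

    row-∈ : ∀ k j i → i ℕ.< k → (i , j) ∈ row k j
    row-∈ (suc k) j i (ℕ.s≤s i≤k) with ℕₚ.m≤n⇒m<n∨m≡n i≤k
    ... | inj₁ i<k  = there (row-∈ k j i i<k)
    ... | inj₂ refl = here refl

    pairs-∈ : ∀ k i j → i ℕ.≤ j → j ℕ.< k → (i , j) ∈ pairs k
    pairs-∈ (suc k) i j i≤j (ℕ.s≤s j≤k) with ℕₚ.m≤n⇒m<n∨m≡n j≤k
    ... | inj₁ j<k  = ∈-++⁺ʳ (row (suc k) k) (pairs-∈ k i j i≤j j<k)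
    ... | inj₂ refl = ∈-++⁺ˡ (row-∈ (suc j) j i (ℕ.s≤s i≤j))

    row-distinct : ∀ k j → AllPairs (λ q r → ¬ q ≡ r) (row k j)
    row-distinct zero    j = []
    row-distinct (suc k) j = All.map (λ { (i<k , _) refl → ℕₚ.<-irrefl refl i<k }) (row-all k j) ∷ row-distinct k j

    pairs-distinct : ∀ k → AllPairs (λ q r → ¬ q ≡ r) (pairs k)
    pairs-distinct zero    = []
    pairs-distinct (suc j) = AllPairsₚ.++⁺ (row-distinct (suc j) j) (pairs-distinct j)
      (All.map (λ { (_ , refl) → All.map (λ { (_ , j<j) refl → ℕₚ.<-irrefl refl j<j }) (pairs-all j) }) (row-all (suc j) j))

    symmetric-basis : Basis Symmetric
    symmetric-basis = record
      { vectors = map indicator (pairs n)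
      ; inside  = Allₚ.map⁺ (All.universal indicator-symmetric (pairs n))
      ; indep   = indicators-indep (pairs n) (pairs-all n) (pairs-distinct n)
      ; spans   = λ Su → indicators-span (pairs n) (pairs-all n) Su (λ (i , j) (i≤j , j<n) ∉ → ⊥-elim (∉ (pairs-∈ n i j i≤j j<n))) }

    length-row : ∀ k j → length (row k j) ≡ k
    length-row zero    j = refl
    length-row (suc k) j = cong suc (length-row k j)

    length-pairs : ∀ k → 2 ℕ.* length (pairs k) ≡ k ℕ.* suc k
    length-pairs zero    = refl
    length-pairs (suc j) = begin
      2 ℕ.* length (row (suc j) j ++ pairs j)                      ≡⟨ cong (2 ℕ.*_) (length-++ (row (suc j) j)) ⟩
      2 ℕ.* (length (row (suc j) j) ℕ.+ length (pairs j))          ≡⟨ ℕₚ.*-distribˡ-+ 2 (length (row (suc j) j)) (length (pairs j)) ⟩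
      2 ℕ.* length (row (suc j) j) ℕ.+ 2 ℕ.* length (pairs j)      ≡⟨ cong₂ (λ x y → 2 ℕ.* x ℕ.+ y) (length-row (suc j) j) (length-pairs j) ⟩
      2 ℕ.* suc j ℕ.+ j ℕ.* suc j                                  ≡⟨ sym (ℕₚ.*-distribʳ-+ (suc j) 2 j) ⟩
      (2 ℕ.+ j) ℕ.* suc j                                          ≡⟨ ℕₚ.*-comm (2 ℕ.+ j) (suc j) ⟩
      suc j ℕ.* suc (suc j)                                        ∎
      where open ≡-Reasoning

    dimension : 2 ℕ.* Basis.dim symmetric-basis ≡ n ℕ.* suc n
    dimension = trans (cong (2 ℕ.*_) (length-map indicator (pairs n))) (length-pairs n)

    X-annihilated : ∀ K → (∀ q → ¬ K ∣ length q → Factors q) → ¬ K ∣ Basis.dim symmetric-basis →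
      ∃ λ w → w ≉ 𝟘 × ∃ λ b → ∃ λ c → quadratic X b c w ≈ 𝟘
    X-annihilated K factor K∤ = pencil-eigenvector symmetric-subspace symmetric-basis (λ κ {u} → pencil-symmetric κ {u})
      (λ κ → RealEigen.annihilated Index Inside symmetric-subspace (pencil-linear κ) (λ {u} → pencil-symmetric κ {u}) symmetric-basis K factor K∤)

-- Linear and quadratic factors of polynomials over F

module Factorisation (em : ExcludedMiddle 0ℓ) (𝓕 : RealClosedField) where

  open Basics em 𝓕
  open Order em 𝓕
  open LinearAlgebra em 𝓕
  open Annihilators em 𝓕
  open SymmetricArrays em 𝓕

  eval : List F → F → F
  eval p x = lin p (pow x)

  lin-zero : ∀ p {s} → (∀ k → s k ≡ 0#) → lin p s ≡ 0#
  lin-zero []      z = refl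
  lin-zero (a ∷ p) z = trans (cong₂ (λ x y → a * x + y) (z (length p)) (lin-zero p z)) (solve 1 (λ a → a :* :0 :+ :0 := :0) refl a)

  lin-scale : ∀ p c s → lin p (λ k → c * s k) ≡ c * lin p s
  lin-scale p c s = trans (lin-cong p (λ k → sym (+-identityʳ (c * s k))))
    (trans (lin-+ p c s (λ _ → 0#)) (trans (cong (c * lin p s +_) (lin-zero p (λ _ → refl))) (+-identityʳ (c * lin p s))))

  abstract
    -- Horner's scheme. As it holds for all sequences, it serves both for powers of a number and for
    -- orbits of an operator.
    divide-linear : ∀ r a a₁ p → ∃ λ q → ∃ λ t → length q ≡ length p ×
      ∀ s → lin (a ∷ a₁ ∷ p) s ≡ lin (a ∷ q) (λ k → s (suc k) - r * s k) + t * s 0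
    divide-linear r a a₁ [] = [] , a₁ + r * a , refl , λ s →
      solve 5 (λ r a a₁ x y → a :* x :+ (a₁ :* y :+ :0) := a :* (x :- r :* y) :+ :0 :+ (a₁ :+ r :* a) :* y) refl r a a₁ (s 1) (s 0)
    divide-linear r a a₁ (a₂ ∷ p) with divide-linear r (a₁ + r * a) a₂ p
    ... | q , t , len , ih = (a₁ + r * a) ∷ q , t , cong suc len , λ s →
      trans (solve 6 (λ r a a₁ x y z → a :* x :+ (a₁ :* y :+ z) := a :* (x :- r :* y) :+ ((a₁ :+ r :* a) :* y :+ z)) refl
               r a a₁ (s (suc (suc (length p)))) (s (suc (length p))) (lin (a₂ ∷ p) s))
        (trans (cong₂ (λ l z → a * (s (suc (suc l)) - r * s (suc l)) + z) (sym len) (ih s))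
          (sym (+-assoc _ (lin ((a₁ + r * a) ∷ q) (λ k → s (suc k) - r * s k)) (t * s 0))))

  abstract
    divide-quadratic : ∀ b c a a₁ a₂ p → ∃ λ q → ∃ λ r → ∃ λ t → length q ≡ length p ×
      ∀ s → lin (a ∷ a₁ ∷ a₂ ∷ p) s ≡ lin (a ∷ q) (λ k → s (suc (suc k)) + (b * s (suc k) + c * s k)) + (r * s 1 + t * s 0)
    divide-quadratic b c a a₁ a₂ [] = [] , a₁ - a * b , a₂ - a * c , refl , λ s →
      solve 8 (λ b c a a₁ a₂ x y z → a :* x :+ (a₁ :* y :+ (a₂ :* z :+ :0))
         := a :* (x :+ (b :* y :+ c :* z)) :+ :0 :+ ((a₁ :- a :* b) :* y :+ (a₂ :- a :* c) :* z)) refl b c a a₁ a₂ (s 2) (s 1) (s 0)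
    divide-quadratic b c a a₁ a₂ (a₃ ∷ p) with divide-quadratic b c (a₁ - a * b) (a₂ - a * c) a₃ p
    ... | q , r , t , len , ih = (a₁ - a * b) ∷ q , r , t , cong suc len , λ s →
      trans (regroup (s (3 ℕ.+ length p)) (s (2 ℕ.+ length p)) (s (suc (length p))) (lin (a₃ ∷ p) s))
        (trans (cong₂ (λ l z → a * (s (3 ℕ.+ l) + (b * s (2 ℕ.+ l) + c * s (suc l))) + z) (sym len) (ih s))
          (sym (+-assoc _ (lin ((a₁ - a * b) ∷ q) (λ k → s (suc (suc k)) + (b * s (suc k) + c * s k))) (r * s 1 + t * s 0))))
      where
      regroup : ∀ x y z w → a * x + (a₁ * y + (a₂ * z + w)) ≡ a * (x + (b * y + c * z)) + ((a₁ - a * b) * y + ((a₂ - a * c) * z + w))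
      regroup x y z w = solve 9 (λ b c a a₁ a₂ x y z w → a :* x :+ (a₁ :* y :+ (a₂ :* z :+ w))
        := a :* (x :+ (b :* y :+ c :* z)) :+ ((a₁ :- a :* b) :* y :+ ((a₂ :- a :* c) :* z :+ w))) refl b c a a₁ a₂ x y z w

  module _ {I : Set} {D : I → Set} where
    open VectorSpace I D
    open Linear
    open RealEigen I D using (quadratic; quadratic-linear; quadratic-comm; shifted; shifted-linear; shifted-comm)

    cancel : ∀ {t w} → w ≉ 𝟘 → t ⊡ w ≈ 𝟘 → t ≡ 0#
    cancel {t} {w} w≉0 tw≈0 with em {t ≡ 0#}
    ... | yes t≡0 = t≡0
    ... | no t≢0  = ⊥-elim (w≉0 (λ i d → [ (λ t≡0 → ⊥-elim (t≢0 t≡0)) , (λ w≡0 → w≡0) ]′ (zero-product t (w i) (tw≈0 i d))))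

    iter-kills : ∀ {A G} → Linear A → Commute A G → ∀ {w} → G w ≈ 𝟘 → ∀ k → G (iter A k w) ≈ 𝟘
    iter-kills {A} {G} LA AG {w} Gw k i d = trans (sym (iter-commute {A} {G} LA AG k w i d)) (go k i d)
      where
      go : ∀ k → iter A k (G w) ≈ 𝟘
      go zero    = Gw
      go (suc k) = ≈-trans (respects LA (go k)) (preserves-𝟘 LA)

    monic : ∀ p (s : ℕ → F) → s (length p) + lin p s ≡ lin (1# ∷ p) s
    monic p s = cong (_+ lin p s) (sym (*-identityˡ (s (length p))))

    -- Applied to `w`, the multiple of A - r disappears and only the remainder `t` times `w` is
    -- left; so `t` is 0 and the division is exact.
    linear-factor : ∀ {A} → Linear A → ∀ a₁ p {w} → w ≉ 𝟘 → act A (1# ∷ a₁ ∷ p) w ≈ 𝟘 → ∀ r → shifted A r w ≈ 𝟘 → Factors (a₁ ∷ p)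
    linear-factor {A} LA a₁ p {w} w≉0 Pw r Aw with divide-linear r 1# a₁ p
    ... | q , t , len , division = inj₁ (r , q , cong suc len , λ s → trans (monic (a₁ ∷ p) s) (trans (division s)
          (trans (cong (λ t → lin (1# ∷ q) (λ k → s (suc k) - r * s k) + t * s 0) t≡0)
            (solve 2 (λ l x → l :+ :0 :* x := l) refl (lin (1# ∷ q) (λ k → s (suc k) - r * s k)) (s 0)))))
      where
      t≡0 : t ≡ 0#
      t≡0 = cancel w≉0 (λ i d → begin
        t * w i                                        ≡⟨ sym (+-identityˡ (t * w i)) ⟩
        0# + t * w i                                   ≡⟨ cong (_+ t * w i) (sym (lin-zero (1# ∷ q) (λ k → iter-kills {A} {shifted A r} LA (shifted-comm LA r) Aw k i d))) ⟩
        lin (1# ∷ q) (λ k → iter A (suc k) w i - r * iter A k w i) + t * w i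
                                                       ≡⟨ sym (division (λ k → iter A k w i)) ⟩
        act A (1# ∷ a₁ ∷ p) w i                        ≡⟨ Pw i d ⟩
        0#                                             ∎)
        where open ≡-Reasoning

    -- The remainder leaves r A w + t w = 0. Either r and t are both 0 and the division is exact, or
    -- r ≠ 0 and `w` is an eigenvector for - t/r, which gives a linear factor.
    quadratic-factor : ∀ {A} → Linear A → ∀ a₁ a₂ p {w} → w ≉ 𝟘 → act A (1# ∷ a₁ ∷ a₂ ∷ p) w ≈ 𝟘 →
      ∀ b c → quadratic A b c w ≈ 𝟘 → Factors (a₁ ∷ a₂ ∷ p)
    quadratic-factor {A} LA a₁ a₂ p {w} w≉0 Pw b c Qw with divide-quadratic b c 1# a₁ a₂ p
    ... | q , r , t , len , division = cases em em
      where
      remainder : ∀ i → D i → r * A w i + t * w i ≡ 0#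
      remainder i d = begin
        r * A w i + t * w i                            ≡⟨ sym (+-identityˡ _) ⟩
        0# + (r * A w i + t * w i)
          ≡⟨ cong (_+ (r * A w i + t * w i)) (sym (lin-zero (1# ∷ q)
               (λ k → iter-kills {A} {quadratic A b c} LA (quadratic-comm LA LA (λ _ _ _ → refl) b c) Qw k i d))) ⟩
        lin (1# ∷ q) (λ k → iter A (suc (suc k)) w i + (b * iter A (suc k) w i + c * iter A k w i)) + (r * A w i + t * w i)
          ≡⟨ sym (division (λ k → iter A k w i)) ⟩
        act A (1# ∷ a₁ ∷ a₂ ∷ p) w i                   ≡⟨ Pw i d ⟩
        0#                                             ∎
        where open ≡-Reasoning
      cases : Dec (r ≡ 0#) → Dec (t ≡ 0#) → Factors (a₁ ∷ a₂ ∷ p)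
      cases (yes refl) (yes refl) = inj₂ (b , c , q , cong (λ l → suc (suc l)) len , λ s → trans (monic (a₁ ∷ a₂ ∷ p) s) (trans (division s)
        (solve 3 (λ l x y → l :+ (:0 :* x :+ :0 :* y) := l) refl (lin (1# ∷ q) (λ k → s (suc (suc k)) + (b * s (suc k) + c * s k))) (s 1) (s 0))))
      cases (yes refl) (no t≢0) = ⊥-elim (t≢0 (cancel w≉0 (λ i d → trans (solve 3 (λ t w x → t :* w := :0 :* x :+ t :* w) refl t (w i) (A w i)) (remainder i d))))
      cases (no r≢0) _ with inverse r r≢0
      ... | r⁻¹ , rr⁻¹≡1 = linear-factor LA a₁ (a₂ ∷ p) w≉0 Pw (- (t * r⁻¹)) (λ i d → begin
        A w i - - (t * r⁻¹) * w i                   ≡⟨ by-multiple (- A w i) rr⁻¹≡1 (solve 5 (λ r j t x w → x :- :- (t :* j) :* w :+ :- x :* :1 := j :* (r :* x :+ t :* w) :+ :- x :* (r :* j)) refl r r⁻¹ t (A w i) (w i)) ⟩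
        r⁻¹ * (r * A w i + t * w i)                 ≡⟨ trans (cong (r⁻¹ *_) (remainder i d)) (zeroʳ r⁻¹) ⟩
        0#                                          ∎)
        where open ≡-Reasoning

  coefficient : List F → ℕ → F
  coefficient []      k = 0#
  coefficient (a ∷ p) k with k ℕ.≟ length p
  ... | yes _ = a
  ... | no _  = coefficient p k

  coefficient-here : ∀ a p → coefficient (a ∷ p) (length p) ≡ a
  coefficient-here a p with length p ℕ.≟ length p
  ... | yes _ = refl
  ... | no ¬e = ⊥-elim (¬e refl)

  coefficient-there : ∀ a p k → k ℕ.< length p → coefficient (a ∷ p) k ≡ coefficient p k
  coefficient-there a p k k< with k ℕ.≟ length p
  ... | yes refl = ⊥-elim (ℕₚ.<-irrefl refl k<)
  ... | no _     = refl

  sumF-cong : ∀ n {f g : Fin n → F} → (∀ i → f i ≡ g i) → sumF n f ≡ sumF n g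
  sumF-cong zero    f≗g = refl
  sumF-cong (suc n) f≗g = cong₂ _+_ (f≗g Fin.zero) (sumF-cong n (λ i → f≗g (Fin.suc i)))

  sumF-last : ∀ n (f : ℕ → F) → sumF (suc n) (λ i → f (toℕ i)) ≡ f n + sumF n (λ i → f (toℕ i))
  sumF-last zero    f = refl
  sumF-last (suc n) f = trans (cong (f 0 +_) (sumF-last n (λ k → f (suc k))))
    (solve 3 (λ x y z → x :+ (y :+ z) := y :+ (x :+ z)) refl (f 0) (f (suc n)) (sumF n (λ i → f (suc (toℕ i)))))

  sumF-lin : ∀ p s → sumF (length p) (λ i → coefficient p (toℕ i) * s (toℕ i)) ≡ lin p s
  sumF-lin []      s = refl
  sumF-lin (a ∷ p) s = trans (sumF-last (length p) (λ k → coefficient (a ∷ p) k * s k))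
    (cong₂ (λ x y → x * s (length p) + y) (coefficient-here a p)
      (trans (sumF-cong (length p) (λ i → cong (_* s (toℕ i)) (coefficient-there a p (toℕ i) (toℕ<n i)))) (sumF-lin p s)))

  abstract
    -- The root is an eigenvalue of multiplication by `x` on a one-dimensional space, so the
    -- operator version of the factor lemma applies.
    odd-factor : ∀ m p → length p ≡ suc (m ℕ.+ m) → Factors p
    odd-factor m (a ∷ p) len with oddRoot m (λ i → coefficient (a ∷ p) (toℕ i))
    ... | x , root = linear-factor {I = ⊤} {D = λ _ → ⊤} scaling a p {w = λ _ → 1#} (λ 1≈0 → 0≢1 (sym (1≈0 tt tt)))
            (λ _ _ → trans (lin-cong (1# ∷ a ∷ p) iter-pow) (trans (sym (monic {I = ⊤} {D = λ _ → ⊤} (a ∷ p) (pow x))) root′))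
            x (λ _ _ → solve 1 (λ x → x :* :1 :- x :* :1 := :0) refl x)
      where
      open VectorSpace ⊤ (λ _ → ⊤)
      scaling : Linear (x ⊡_)
      scaling = record
        { respects = λ e i d → cong (x *_) (e i d)
        ; comb = λ c u v i _ → solve 4 (λ x c u v → x :* (c :* u :+ v) := c :* (x :* u) :+ x :* v) refl x c (u i) (v i) }
      iter-pow : ∀ k → iter (x ⊡_) k (λ _ → 1#) tt ≡ pow x k
      iter-pow zero    = refl
      iter-pow (suc k) = cong (x *_) (iter-pow k)
      root′ : pow x (length (a ∷ p)) + lin (a ∷ p) (pow x) ≡ 0#
      root′ = trans (cong₂ _+_ (cong (pow x) len)
        (trans (sym (sumF-lin (a ∷ p) (pow x))) (cong (λ n → sumF n (λ i → coefficient (a ∷ p) (toℕ i) * pow x (toℕ i))) len))) root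

  abstract
    parity : ∀ n → ∃ λ m → n ≡ m ℕ.+ m ⊎ n ≡ suc (m ℕ.+ m)
    parity zero    = 0 , inj₁ refl
    parity (suc n) with parity n
    ... | m , inj₁ e = m , inj₂ (cong suc e)
    ... | m , inj₂ e = suc m , inj₁ (cong suc (trans e (sym (ℕₚ.+-suc m m))))

  2∤odd : ∀ m → ¬ 2 ∣ suc (m ℕ.+ m)
  2∤odd m (divides q e) with parity q
  ... | _ = ℕₚ.even≢odd q m (trans (ℕₚ.*-comm 2 q) (trans (sym e) (cong (λ z → suc (m ℕ.+ z)) (sym (ℕₚ.+-identityʳ m)))))

  odd-cancel : ∀ k x m → 2 ℕ.^ k ∣ x ℕ.* suc (m ℕ.+ m) → 2 ℕ.^ k ∣ x
  odd-cancel zero    x m _ = 1∣ x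
  odd-cancel (suc k) x m d with euclidsLemma x (suc (m ℕ.+ m)) prime[2] (∣-trans (m∣m*n (2 ℕ.^ k)) d)
  ... | inj₂ 2∣o = ⊥-elim (2∤odd m 2∣o)
  ... | inj₁ (divides y refl) = subst (2 ℕ.* 2 ℕ.^ k ∣_) (ℕₚ.*-comm 2 y) (*-monoʳ-∣ 2 (odd-cancel k y m
          (*-cancelˡ-∣ 2 (subst (2 ℕ.* 2 ℕ.^ k ∣_) (trans (cong (ℕ._* suc (m ℕ.+ m)) (ℕₚ.*-comm y 2)) (ℕₚ.*-assoc 2 y (suc (m ℕ.+ m)))) d))))

  abstract
    -- If n is even, n + 1 is odd and can be cancelled in n (n + 1), which is twice the dimension of
    -- the symmetric arrays. So 2^k does not divide this dimension when 2^(k+1) does not divide n.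
    -- The induction hypothesis factors the minimal polynomials of the Krylov blocks, which do not
    -- have the degree n.
    factors-by-valuation : ∀ k p → ¬ 2 ℕ.^ k ∣ length p → Factors p
    factors-by-valuation zero    p 1∤ = ⊥-elim (1∤ (1∣ length p))
    factors-by-valuation (suc k) p ∤p with parity (length p)
    ... | m , inj₂ odd = odd-factor m p odd
    factors-by-valuation (suc k) []           ∤p | m , inj₁ even = ⊥-elim (∤p (_ ∣0))
    factors-by-valuation (suc k) (a ∷ [])     ∤p | m , inj₁ even = ⊥-elim (2∤odd 0 (divides m (trans even (trans (cong (m ℕ.+_) (sym (ℕₚ.+-identityʳ m))) (ℕₚ.*-comm 2 m)))))
    factors-by-valuation (suc k) (a₁ ∷ a₂ ∷ p) ∤p | m , inj₁ even =
      let w , w≉0 , b , c , Qw = A.X-annihilated (2 ℕ.^ k) (factors-by-valuation k) ∤dim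
      in quadratic-factor A.X-linear a₁ a₂ p w≉0 (A.annihilates w) b c Qw
      where
      module A = Arrays (a₁ ∷ a₂ ∷ p) (suc (length p)) refl
      ∤dim : ¬ 2 ℕ.^ k ∣ RealEigen.Basis.dim A.symmetric-basis
      ∤dim d = ∤p (odd-cancel (suc k) (2 ℕ.+ length p) m (subst (2 ℕ.^ suc k ∣_)
        (trans A.dimension (cong (λ l → (2 ℕ.+ length p) ℕ.* suc l) even)) (*-monoʳ-∣ 2 d)))

  n<2^n : ∀ n → n ℕ.< 2 ℕ.^ n
  n<2^n zero    = ℕ.s≤s ℕ.z≤n
  n<2^n (suc n) = ℕₚ.+-mono-≤ {1} (ℕₚ.≤-trans (ℕ.s≤s ℕ.z≤n) (n<2^n n)) (ℕₚ.≤-trans (n<2^n n) (ℕₚ.m≤m+n (2 ℕ.^ n) 0))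

  abstract
    factors : ∀ a p → Factors (a ∷ p)
    factors a p = factors-by-valuation (suc (length p)) (a ∷ p)
      (λ d → ℕₚ.<-irrefl refl (ℕₚ.<-≤-trans (n<2^n (suc (length p))) (∣⇒≤ d)))

-- The intermediate value theorem for polynomials

module SignChanges (em : ExcludedMiddle 0ℓ) (𝓕 : RealClosedField) where

  open Basics em 𝓕
  open Order em 𝓕
  open LinearAlgebra em 𝓕
  open ComplexRoots em 𝓕
  open Factorisation em 𝓕

  product<0 : ∀ {x y} → x * y < 0# → x < 0# ⊎ y < 0#
  product<0 {x} {y} xy<0 with <⊎≥ x 0# | <⊎≥ y 0#
  ... | inj₁ x<0 | _        = inj₁ x<0
  ... | inj₂ _   | inj₁ y<0 = inj₂ y<0
  ... | inj₂ 0≤x | inj₂ 0≤y = ⊥-elim (<⇒≱ xy<0 (nonneg 0≤x 0≤y))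
    where
    nonneg : ∀ {x y} → 0# ≤ x → 0# ≤ y → 0# ≤ x * y
    nonneg (inj₁ 0<x)  (inj₁ 0<y)  = inj₁ (*-pos _ _ 0<x 0<y)
    nonneg {x} (inj₁ _) (inj₂ refl) = inj₂ (sym (zeroʳ x))
    nonneg {y = y} (inj₂ refl) _   = inj₂ (sym (zeroˡ y))

  Root : (F → F) → F → F → Set
  Root f u v = ∃ λ z → u < z × z < v × f z ≡ 0#

  abstract
    linear-root : ∀ r {u v} → u < v → (u - r) * (v - r) < 0# → u < r × r < v
    linear-root r {u} {v} u<v sc with <⊎≥ u r | <⊎≥ r v
    ... | inj₁ u<r | inj₁ r<v = u<r , r<v
    ... | inj₂ r≤u | _ = ⊥-elim (<⇒≱ sc (le r≤u))
      where
      le : r ≤ u → 0# ≤ (u - r) * (v - r)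
      le (inj₁ r<u)  = inj₁ (*-pos _ _ (0<-diff r<u) (0<-diff (<-trans r<u u<v)))
      le (inj₂ refl) = inj₂ (solve 2 (λ u v → :0 := (u :- u) :* (v :- u)) refl u v)
    ... | inj₁ u<r | inj₂ v≤r = ⊥-elim (<⇒≱ sc (le v≤r))
      where
      le : v ≤ r → 0# ≤ (u - r) * (v - r)
      le (inj₁ v<r)  = inj₁ (subst (0# <_) (solve 3 (λ r u v → (r :- u) :* (r :- v) := (u :- r) :* (v :- r)) refl r u v)
                         (*-pos _ _ (0<-diff u<r) (0<-diff v<r)))
      le (inj₂ refl) = inj₂ (solve 2 (λ u v → :0 := (u :- v) :* (v :- v)) refl u v)

  -- Either the quadratic has a root β, and then splits, or its complex root is not real and it is a sum of two squares.
  by-complex-root : ∀ b c {u v} → u < v → (u * u + (b * u + c)) * (v * v + (b * v + c)) < 0# →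
    ∀ r s → r * r - s * s + (b * r - 0# * s) + c ≡ 0# → 2# * (r * s) + (b * s + 0# * r) + 0# ≡ 0# →
    Root (λ x → x * x + (b * x + c)) u v
  by-complex-root b c {u} {v} u<v sc r s re im with em {s ≡ 0#}
  ... | yes refl = [ first , second ]′ (product<0 (subst (_< 0#) regroup sc))
    where
    g : F → F
    g x = x * x + (b * x + c)
    split : ∀ x → g x ≡ (x - r) * (x - (- b - r))
    split x = by-multiple 1# re (solve 4 (λ x b c r → x :* x :+ (b :* x :+ c) :+ :1 :* :0
      := (x :- r) :* (x :- (:- b :- r)) :+ :1 :* (r :* r :- :0 :* :0 :+ (b :* r :- :0 :* :0) :+ c)) refl x b c r)
    regroup : g u * g v ≡ ((u - r) * (v - r)) * ((u - (- b - r)) * (v - (- b - r)))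
    regroup = trans (cong₂ _*_ (split u) (split v)) (solve 4 (λ a b c d → (a :* b) :* (c :* d) := (a :* c) :* (b :* d)) refl (u - r) (u - (- b - r)) (v - r) (v - (- b - r)))
    first : (u - r) * (v - r) < 0# → Root g u v
    first neg′ = let u<r , r<v = linear-root r u<v neg′ in r , u<r , r<v ,
      trans (split r) (solve 2 (λ r b → (r :- r) :* (r :- (:- b :- r)) := :0) refl r b)
    second : (u - (- b - r)) * (v - (- b - r)) < 0# → Root g u v
    second neg′ = let u<r , r<v = linear-root (- b - r) u<v neg′ in - b - r , u<r , r<v ,
      trans (split (- b - r)) (solve 2 (λ r b → (:- b :- r :- r) :* (:- b :- r :- (:- b :- r)) := :0) refl r b)
  ... | no s≢0 = ⊥-elim (<-irrefl (<-trans sc (*-pos _ _ (positive u) (positive v))))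
    where
    -- The imaginary part of the equation is s (2r + b) = 0.
    2r+b≡0 : 2# * r + b ≡ 0#
    2r+b≡0 = [ (λ s≡0 → ⊥-elim (s≢0 s≡0)) , (λ e → e) ]′ (zero-product s (2# * r + b)
      (trans (solve 3 (λ s r b → s :* ((:1 :+ :1) :* r :+ b) := (:1 :+ :1) :* (r :* s) :+ (b :* s :+ :0 :* r) :+ :0) refl s r b) im))
    positive : ∀ x → 0# < x * x + (b * x + c)
    positive x = subst (0# <_) (by-multiple (- 1#) re (by-multiple (r - x) 2r+b≡0
      (solve 5 (λ x b c r s → s :* s :+ (x :- r) :* (x :- r) :+ :- :1 :* :0 :+ (r :- x) :* :0 := x :* x :+ (b :* x :+ c)
         :+ :- :1 :* (r :* r :- s :* s :+ (b :* r :- :0 :* s) :+ c) :+ (r :- x) :* ((:1 :+ :1) :* r :+ b)) refl x b c r s)))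
      (+-pos-≤ (sq-pos s≢0) (sq-nonneg (x - r)))

  abstract
    quadratic-root : ∀ b c {u v} → u < v → (u * u + (b * u + c)) * (v * v + (b * v + c)) < 0# →
      Root (λ x → x * x + (b * x + c)) u v
    quadratic-root b c u<v sc = by-complex-root b c u<v sc _ _
        (proj₁ (proj₂ (proj₂ (complex-quadratic b 0# c 0#)))) (proj₂ (proj₂ (proj₂ (complex-quadratic b 0# c 0#))))

  eval-scale : ∀ c p x → eval (map (c *_) p) x ≡ c * eval p x
  eval-scale c []      x = sym (zeroʳ c)
  eval-scale c (a ∷ p) x = trans (cong₂ (λ n y → c * a * pow x n + y) (length-map (c *_) p) (eval-scale c p x))
    (solve 4 (λ c a x y → c :* a :* x :+ c :* y := c :* (a :* x :+ y)) refl c a (pow x (length p)) (eval p x))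

  -- If a product changes sign between `u` and `v`, so does one of its factors, and a root of the
  -- factor is a root of the product.
  shrink : ∀ {f g h : F → F} {u v} → (∀ x → f x ≡ g x * h x) → f u * f v < 0# →
    (g u * g v < 0# → Root g u v) → (h u * h v < 0# → Root h u v) → Root f u v
  shrink {f} {g} {h} {u} {v} f≗gh sc rg rh = [ (λ n → root₁ (rg n)) , (λ n → root₂ (rh n)) ]′
    (product<0 (subst (_< 0#) (trans (cong₂ _*_ (f≗gh u) (f≗gh v))
      (solve 4 (λ a b c d → (a :* b) :* (c :* d) := (a :* c) :* (b :* d)) refl (g u) (h u) (g v) (h v))) sc))
    where
    root₁ : Root g u v → Root f u v
    root₁ (z , u<z , z<v , gz) = z , u<z , z<v , trans (f≗gh z) (trans (cong (_* h z) gz) (zeroˡ (h z)))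
    root₂ : Root h u v → Root f u v
    root₂ (z , u<z , z<v , hz) = z , u<z , z<v , trans (f≗gh z) (trans (cong (g z *_) hz) (zeroʳ (g z)))

  -- The intermediate value theorem, by splitting off linear and quadratic factors.
  abstract
    sign-change-root : ∀ n p {u v} → length p ℕ.≤ n → u < v → eval p u * eval p v < 0# → Root (eval p) u v
    sign-change-root n       []      _    u<v sc = ⊥-elim (<-irrefl (subst (_< 0#) (zeroˡ 0#) sc))
    sign-change-root (suc n) (a ∷ p) {u} {v} (ℕ.s≤s p≤n) u<v sc with em {a ≡ 0#}
    ... | yes refl = shrink {g = λ _ → 1#} {h = eval p} (λ x → solve 2 (λ x y → :0 :* x :+ y := :1 :* y) refl (pow x (length p)) (eval p x)) sc
            (λ n → ⊥-elim (<-irrefl (<-trans n (*-pos _ _ 0<1 0<1)))) (sign-change-root n p p≤n u<v)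
    ... | no a≢0 = proper p p≤n sc
      where
      constant : ∀ {c} → c * c < 0# → Root (λ _ → c) u v
      constant {c} n = ⊥-elim (<⇒≱ n (sq-nonneg c))
      proper : ∀ p → length p ℕ.≤ n → eval (a ∷ p) u * eval (a ∷ p) v < 0# → Root (eval (a ∷ p)) u v
      proper []       _    sc = ⊥-elim (<⇒≱ sc (sq-nonneg (a * 1# + 0#)))
      proper (b ∷ p′) p≤n sc = by-factors (factors (a⁻¹ * b) (map (a⁻¹ *_) p′))
        where
        full : List F
        full = b ∷ p′
        a⁻¹ : F
        a⁻¹ = proj₁ (inverse a a≢0)
        p/a : List F
        p/a = map (a⁻¹ *_) full
        -- `Factors` speaks of monic polynomials, so the leading coefficient is split off as a
        -- constant factor, which cannot change sign.
        normalised : ∀ x → eval (a ∷ full) x ≡ a * (pow x (length p/a) + eval p/a x)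
        normalised x = trans (by-multiple (- eval full x) (proj₂ (inverse a a≢0))
            (solve 4 (λ a i x y → a :* x :+ y :+ :- y :* :1 := a :* (x :+ i :* y) :+ :- y :* (a :* i)) refl a a⁻¹ (pow x (length full)) (eval full x)))
          (cong (a *_) (cong₂ _+_ (cong (pow x) (sym (length-map (a⁻¹ *_) full))) (sym (eval-scale a⁻¹ full x))))
        by-factors : Factors p/a → Root (eval (a ∷ full)) u v
        by-factors (inj₁ (r , q , len , fact)) = shrink {g = λ _ → a} normalised sc constant
          (λ sc → shrink {g = λ x → x - r} {h = eval (1# ∷ q)}
            (λ x → trans (fact (pow x)) (trans (lin-cong (1# ∷ q) (λ k → solve 3 (λ x r y → x :* y :- r :* y := (x :- r) :* y) refl x r (pow x k)))
                                          (lin-scale (1# ∷ q) (x - r) (pow x)))) sc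
            (λ sc → let u<r , r<v = linear-root r u<v sc in r , u<r , r<v , -‿inverseʳ r)
            (sign-change-root n (1# ∷ q) (ℕₚ.≤-trans (ℕₚ.≤-reflexive (trans len (length-map (a⁻¹ *_) full))) p≤n) u<v))
        by-factors (inj₂ (b , c , q , len , fact)) = shrink {g = λ _ → a} normalised sc constant
          (λ sc → shrink {g = λ x → x * x + (b * x + c)} {h = eval (1# ∷ q)}
            (λ x → trans (fact (pow x)) (trans (lin-cong (1# ∷ q) (λ k → solve 4 (λ x b c y → x :* (x :* y) :+ (b :* (x :* y) :+ c :* y)
                      := (x :* x :+ (b :* x :+ c)) :* y) refl x b c (pow x k)))
                                          (lin-scale (1# ∷ q) (x * x + (b * x + c)) (pow x)))) sc
            (quadratic-root b c u<v)
            (sign-change-root n (1# ∷ q) (ℕₚ.≤-trans (ℕₚ.n≤1+n _) (ℕₚ.≤-trans (ℕₚ.≤-reflexive (trans len (length-map (a⁻¹ *_) full))) p≤n)) u<v))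

-- Polynomial functions: zeros, signs, derivatives, monotonicity

module PolynomialFunctions (em : ExcludedMiddle 0ℓ) (𝓕 : RealClosedField) where

  open Basics em 𝓕
  open Order em 𝓕
  open LinearAlgebra em 𝓕
  open Factorisation em 𝓕
  open SignChanges em 𝓕

  infixl 6 _∔_
  infixl 7 _∙_
  -- Unlike `Term`, these have negation and any set of variables; the coefficients with respect to
  -- one variable are again expressions in the others.
  data Ex (V : Set) : Set where
    at        : V → Ex V
    𝟎 𝟏       : Ex V
    _∔_ _∙_   : Ex V → Ex V → Ex V
    ⁻_        : Ex V → Ex V

  ev : ∀ {V} → Ex V → (V → F) → F
  ev (at v)  ρ = ρ v
  ev 𝟎       ρ = 0#
  ev 𝟏       ρ = 1#
  ev (d ∔ e) ρ = ev d ρ + ev e ρ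
  ev (d ∙ e) ρ = ev d ρ * ev e ρ
  ev (⁻ e)   ρ = - ev e ρ

  ev-cong : ∀ {V} (e : Ex V) {ρ σ} → (∀ v → ρ v ≡ σ v) → ev e ρ ≡ ev e σ
  ev-cong (at v)  ρ≗σ = ρ≗σ v
  ev-cong 𝟎       ρ≗σ = refl
  ev-cong 𝟏       ρ≗σ = refl
  ev-cong (d ∔ e) ρ≗σ = cong₂ _+_ (ev-cong d ρ≗σ) (ev-cong e ρ≗σ)
  ev-cong (d ∙ e) ρ≗σ = cong₂ _*_ (ev-cong d ρ≗σ) (ev-cong e ρ≗σ)
  ev-cong (⁻ e)   ρ≗σ = cong -_ (ev-cong e ρ≗σ)

  spec : ∀ {W} → (W → F) → List (Ex W) → List F
  spec ρ = map (λ e → ev e ρ)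

  -- The classifier tells the main variable (nothing) from the remaining ones.
  module _ {V W : Set} (classify : V → Maybe W) where

    -- Lowest degree first here, since sums are then aligned.
    add mul : List (Ex W) → List (Ex W) → List (Ex W)
    add []      q       = q
    add p       []      = p
    add (a ∷ p) (b ∷ q) = (a ∔ b) ∷ add p q
    mul []      q = []
    mul (a ∷ p) q = add (map (a ∙_) q) (𝟎 ∷ mul p q)

    ascending : Ex V → List (Ex W)
    ascending (at v) with classify v
    ... | nothing = 𝟎 ∷ 𝟏 ∷ []
    ... | just w  = at w ∷ []
    ascending 𝟎       = []
    ascending 𝟏       = 𝟏 ∷ []
    ascending (d ∔ e) = add (ascending d) (ascending e)
    ascending (d ∙ e) = mul (ascending d) (ascending e)
    ascending (⁻ e)   = map ⁻_ (ascending e)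

    backwards : List (Ex W) → List (Ex W)
    backwards []      = []
    backwards (a ∷ p) = backwards p ∷ʳ a

    coefficients : Ex V → List (Ex W)
    coefficients e = backwards (ascending e)

    module _ (ρ : W → F) (x : F) where
      horner : List (Ex W) → F
      horner []      = 0#
      horner (a ∷ p) = ev a ρ + x * horner p

      horner-add : ∀ p q → horner (add p q) ≡ horner p + horner q
      horner-add []      q       = sym (+-identityˡ (horner q))
      horner-add (a ∷ p) []      = sym (+-identityʳ _)
      horner-add (a ∷ p) (b ∷ q) = trans (cong (λ z → ev a ρ + ev b ρ + x * z) (horner-add p q))
        (solve 5 (λ a b x p q → a :+ b :+ x :* (p :+ q) := a :+ x :* p :+ (b :+ x :* q)) refl (ev a ρ) (ev b ρ) x (horner p) (horner q))

      horner-scale : ∀ a q → horner (map (a ∙_) q) ≡ ev a ρ * horner q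
      horner-scale a []      = sym (zeroʳ (ev a ρ))
      horner-scale a (b ∷ q) = trans (cong (λ z → ev a ρ * ev b ρ + x * z) (horner-scale a q))
        (solve 4 (λ a b x q → a :* b :+ x :* (a :* q) := a :* (b :+ x :* q)) refl (ev a ρ) (ev b ρ) x (horner q))

      horner-mul : ∀ p q → horner (mul p q) ≡ horner p * horner q
      horner-mul []      q = sym (zeroˡ (horner q))
      horner-mul (a ∷ p) q = trans (horner-add (map (a ∙_) q) (𝟎 ∷ mul p q))
        (trans (cong₂ (λ y z → y + (0# + x * z)) (horner-scale a q) (horner-mul p q))
          (solve 4 (λ a q x p → a :* q :+ (:0 :+ x :* (p :* q)) := (a :+ x :* p) :* q) refl (ev a ρ) (horner q) x (horner p)))

      horner-neg : ∀ p → horner (map ⁻_ p) ≡ - horner p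
      horner-neg []      = solve 0 (:0 := :- :0) refl
      horner-neg (a ∷ p) = trans (cong (λ z → - ev a ρ + x * z) (horner-neg p))
        (solve 3 (λ a x p → :- a :+ x :* :- p := :- (a :+ x :* p)) refl (ev a ρ) x (horner p))

      valuation : V → F
      valuation v = maybe ρ x (classify v)

      horner-ascending : ∀ e → horner (ascending e) ≡ ev e valuation
      horner-ascending (at v) with classify v
      ... | nothing = solve 1 (λ x → :0 :+ x :* (:1 :+ x :* :0) := x) refl x
      ... | just w  = solve 2 (λ x w → w :+ x :* :0 := w) refl x (ρ w)
      horner-ascending 𝟎       = refl
      horner-ascending 𝟏       = solve 1 (λ x → :1 :+ x :* :0 := :1) refl x
      horner-ascending (d ∔ e) = trans (horner-add (ascending d) (ascending e)) (cong₂ _+_ (horner-ascending d) (horner-ascending e))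
      horner-ascending (d ∙ e) = trans (horner-mul (ascending d) (ascending e)) (cong₂ _*_ (horner-ascending d) (horner-ascending e))
      horner-ascending (⁻ e)   = trans (horner-neg (ascending e)) (cong -_ (horner-ascending e))

      lin-snoc : ∀ p a s → lin (p ∷ʳ a) s ≡ lin p (λ k → s (suc k)) + a * s 0
      lin-snoc []      a s = solve 2 (λ a x → a :* x :+ :0 := :0 :+ a :* x) refl a (s 0)
      lin-snoc (b ∷ p) a s = trans (cong₂ (λ n z → b * s n + z) (trans (length-++ p) (ℕₚ.+-comm (length p) 1)) (lin-snoc p a s))
        (sym (+-assoc (b * s (suc (length p))) (lin p (λ k → s (suc k))) (a * s 0)))

      eval-backwards : ∀ p → eval (spec ρ (backwards p)) x ≡ horner p
      eval-backwards []      = refl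
      eval-backwards (a ∷ p) = begin
        eval (spec ρ (backwards p ∷ʳ a)) x               ≡⟨ cong (λ l → eval l x) (map-++ (λ e → ev e ρ) (backwards p) (a ∷ [])) ⟩
        eval (spec ρ (backwards p) ∷ʳ ev a ρ) x          ≡⟨ lin-snoc (spec ρ (backwards p)) (ev a ρ) (pow x) ⟩
        lin (spec ρ (backwards p)) (λ k → x * pow x k) + ev a ρ * 1#
          ≡⟨ cong (_+ ev a ρ * 1#) (trans (lin-scale (spec ρ (backwards p)) x (pow x)) (cong (x *_) (eval-backwards p))) ⟩
        x * horner p + ev a ρ * 1#                       ≡⟨ solve 2 (λ y a → y :+ a :* :1 := a :+ y) refl (x * horner p) (ev a ρ) ⟩
        ev a ρ + x * horner p                            ∎
        where open ≡-Reasoning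

      abstract
        eval-coefficients : ∀ e → eval (spec ρ (coefficients e)) x ≡ ev e valuation
        eval-coefficients e = trans (eval-backwards (ascending e)) (horner-ascending e)

  -- In the expression, `just c` stands for the constant c and `nothing` for the argument.
  record PolyFn (f : F → F) : Set where
    constructor polyFn
    field
      expr   : Ex (Maybe F)
      agrees : ∀ x → f x ≡ ev expr (maybe (λ c → c) x)
  open PolyFn

  PolyFn-cong : ∀ {f g} → (∀ x → f x ≡ g x) → PolyFn f → PolyFn g
  PolyFn-cong f≗g (polyFn e a) = polyFn e (λ x → trans (sym (f≗g x)) (a x))

  const-poly : ∀ c → PolyFn (λ _ → c)
  const-poly c = polyFn (at (just c)) (λ _ → refl)

  id-poly : PolyFn (λ x → x)
  id-poly = polyFn (at nothing) (λ _ → refl)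

  +-poly : ∀ {f g} → PolyFn f → PolyFn g → PolyFn (λ x → f x + g x)
  +-poly (polyFn d a) (polyFn e b) = polyFn (d ∔ e) (λ x → cong₂ _+_ (a x) (b x))

  *-poly : ∀ {f g} → PolyFn f → PolyFn g → PolyFn (λ x → f x * g x)
  *-poly (polyFn d a) (polyFn e b) = polyFn (d ∙ e) (λ x → cong₂ _*_ (a x) (b x))

  neg-poly : ∀ {f} → PolyFn f → PolyFn (λ x → - f x)
  neg-poly (polyFn e a) = polyFn (⁻ e) (λ x → cong -_ (a x))

  ev-poly : ∀ {V} (e : Ex V) (σ : F → V → F) → (∀ v → PolyFn (λ x → σ x v)) → PolyFn (λ x → ev e (σ x))
  ev-poly (at v)  σ p = p v
  ev-poly 𝟎       σ p = const-poly 0#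
  ev-poly 𝟏       σ p = const-poly 1#
  ev-poly (d ∔ e) σ p = +-poly (ev-poly d σ p) (ev-poly e σ p)
  ev-poly (d ∙ e) σ p = *-poly (ev-poly d σ p) (ev-poly e σ p)
  ev-poly (⁻ e)   σ p = neg-poly (ev-poly e σ p)

  pow-poly : ∀ n → PolyFn (λ x → pow x n)
  pow-poly zero    = const-poly 1#
  pow-poly (suc n) = *-poly id-poly (pow-poly n)

  eval-poly : ∀ p → PolyFn (eval p)
  eval-poly []      = const-poly 0#
  eval-poly (a ∷ p) = +-poly (*-poly (const-poly a) (pow-poly (length p))) (eval-poly p)

  abstract
    as-list : ∀ {f} → PolyFn f → ∃ λ p → ∀ x → f x ≡ eval p x
    as-list (polyFn e a) = spec (λ c → c) (coefficients (λ v → v) e) , λ x → trans (a x) (sym (eval-coefficients (λ v → v) (λ c → c) x e))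

  abstract
    ivt : ∀ {f} → PolyFn f → ∀ {u v} → u < v → f u * f v < 0# → Root f u v
    ivt P {u} {v} u<v sc with as-list P
    ... | p , f≗p with sign-change-root (length p) p ℕₚ.≤-refl u<v (subst (_< 0#) (cong₂ _*_ (f≗p u) (f≗p v)) sc)
    ...   | z , u<z , z<v , pz = z , u<z , z<v , trans (f≗p z) pz

  ivt↑ : ∀ {f} → PolyFn f → ∀ {u v} → u < v → f u < 0# → 0# < f v → Root f u v
  ivt↑ P u<v fu fv = ivt P u<v (*-neg-pos fu fv)

  ivt↓ : ∀ {f} → PolyFn f → ∀ {u v} → u < v → 0# < f u → f v < 0# → Root f u v
  ivt↓ P u<v fu fv = ivt P u<v (subst (_< 0#) (*-comm _ _) (*-neg-pos fv fu))

  Roots : (F → F) → Set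
  Roots f = ∃ λ rs → ∀ x → f x ≡ 0# → x ∈ rs

  abstract
    -- Splitting off x - r keeps the leading coefficient `a`, so the process ends at the latest at a
    -- nonzero constant.
    roots-list : ∀ n a p → length p ℕ.≤ n → ¬ a ≡ 0# → Roots (eval (a ∷ p))
    roots-list n a [] _ a≢0 = [] , λ x e → ⊥-elim (a≢0 (trans (solve 1 (λ a → a := a :* :1 :+ :0) refl a) e))
    roots-list (suc n) a (b ∷ p) (ℕ.s≤s p≤n) a≢0 with em {∃ λ r → eval (a ∷ b ∷ p) r ≡ 0#}
    ... | no none = [] , λ x e → ⊥-elim (none (x , e))
    ... | yes (r , root) with divide-linear r a b p
    ...   | q , t , len , division with roots-list n a q (subst (ℕ._≤ n) (sym len) p≤n) a≢0
    ...     | rs , all = r ∷ rs , λ x e → [ (λ x-r≡0 → here (x-y≡0⇒x≡y x-r≡0)) , (λ q≡0 → there (all x q≡0)) ]′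
                (zero-product (x - r) (eval (a ∷ q) x) (trans (sym (factored x)) e))
      where
      split : ∀ x → eval (a ∷ b ∷ p) x ≡ (x - r) * eval (a ∷ q) x + t
      split x = trans (division (pow x)) (cong₂ _+_
        (trans (lin-cong (a ∷ q) (λ k → solve 3 (λ x r y → x :* y :- r :* y := (x :- r) :* y) refl x r (pow x k))) (lin-scale (a ∷ q) (x - r) (pow x)))
        (solve 1 (λ t → t :* :1 := t) refl t))
      t≡0 : t ≡ 0#
      t≡0 = trans (solve 3 (λ r e t → t := (r :- r) :* e :+ t) refl r (eval (a ∷ q) r) t) (trans (sym (split r)) root)
      factored : ∀ x → eval (a ∷ b ∷ p) x ≡ (x - r) * eval (a ∷ q) x
      factored x = trans (split x) (trans (cong ((x - r) * eval (a ∷ q) x +_) t≡0) (+-identityʳ _))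

  abstract
    roots : ∀ {f} → PolyFn f → ∀ {c} → ¬ f c ≡ 0# → Roots f
    roots {f} P {c} fc≢0 with as-list P
    ... | p , f≗p = let rs , all = go p (λ e → fc≢0 (trans (f≗p c) e)) in rs , λ x e → all x (trans (sym (f≗p x)) e)
      where
      go : ∀ p → ¬ eval p c ≡ 0# → Roots (eval p)
      go []      e≢0 = ⊥-elim (e≢0 refl)
      go (a ∷ p) e≢0 with em {a ≡ 0#}
      ... | no a≢0   = roots-list (length p) a p ℕₚ.≤-refl a≢0
      ... | yes refl = let drop x = solve 2 (λ x y → :0 :* x :+ y := y) refl (pow x (length p)) (eval p x)
                           rs , all = go p (λ e → e≢0 (trans (drop c) e)) in rs , λ x e → all x (trans (sym (drop x)) e)

  same-sign : ∀ {f} → PolyFn f → ∀ {u v} → u < v → ¬ f u ≡ 0# → ¬ f v ≡ 0# → ¬ Root f u v → sgn (f u) ≡ sgn (f v)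
  same-sign {f} P {u} {v} u<v fu≢0 fv≢0 no-root with compare (f u) 0# | compare (f v) 0#
  ... | tri≈ _ e _  | _           = ⊥-elim (fu≢0 e)
  ... | _           | tri≈ _ e _  = ⊥-elim (fv≢0 e)
  ... | tri< _ _ _  | tri< _ _ _  = refl
  ... | tri> _ _ _  | tri> _ _ _  = refl
  ... | tri< l _ _  | tri> _ _ g  = ⊥-elim (no-root (ivt↑ P u<v l g))
  ... | tri> _ _ g  | tri< l _ _  = ⊥-elim (no-root (ivt↓ P u<v g l))

  -- Base d e says that the interval (d , e) belongs to a filter base.
  record Germ (Base : F → F → Set) : Set where
    field
      nonempty : ∀ {d e} → Base d e → d < e
      meet     : ∀ {d e d′ e′} → Base d e → Base d′ e′ → ∃ λ d″ → ∃ λ e″ → Base d″ e″ × d ≤ d″ × d′ ≤ d″ × e″ ≤ e × e″ ≤ e′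
      -- No point stays in all intervals; hence finitely many zeros can be avoided.
      avoid    : ∀ r → ∃ λ d → ∃ λ e → Base d e × ¬ (d < r × r < e)

  module _ {Base : F → F → Set} (G : Germ Base) where
    open Germ G

    abstract
      avoid-all : ∀ rs → ∃ λ d → ∃ λ e → Base d e × (∀ x → d < x → x < e → x ∉ rs)
      avoid-all []       = let d , e , B , _ = avoid 0# in d , e , B , λ _ _ _ ()
      avoid-all (r ∷ rs) with avoid r | avoid-all rs
      ... | d , e , B , out | d′ , e′ , B′ , outs with meet B B′
      ...   | d″ , e″ , B″ , d≤ , d′≤ , ≤e , ≤e′ = d″ , e″ , B″ , λ x d<x x<e →
              λ { (here refl) → out (≤-<-trans d≤ d<x , <-≤-trans x<e ≤e)
                ; (there x∈)  → outs x (≤-<-trans d′≤ d<x) (<-≤-trans x<e ≤e′) x∈ }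

    abstract
      nonvanishing : ∀ {f} → PolyFn f → ∀ {c} → ¬ f c ≡ 0# → ∃ λ d → ∃ λ e → Base d e × (∀ x → d < x → x < e → ¬ f x ≡ 0#)
      nonvanishing P fc≢0 with roots P fc≢0
      ... | rs , all with avoid-all rs
      ...   | d , e , B , out = d , e , B , λ x d<x x<e fx≡0 → out x d<x x<e (all x fx≡0)

    abstract
      -- A polynomial function that is not identically zero has finitely many zeros. An interval
      -- avoiding them carries no sign change, by the intermediate value theorem.
      constant-sign : ∀ {f} → PolyFn f → ∃ λ d → ∃ λ e → Base d e × ∃ λ σ → ∀ x → d < x → x < e → sgn (f x) ≡ σ
      constant-sign {f} P with em {∃ λ c → ¬ f c ≡ 0#}
      ... | no none = let d , e , B , _ = avoid 0# in d , e , B , ⊙ , λ x _ _ → sgn-zero (zeros x)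
        where
        zeros : ∀ x → f x ≡ 0#
        zeros x with em {f x ≡ 0#}
        ... | yes e = e
        ... | no ¬e = ⊥-elim (none (x , ¬e))
      ... | yes (c , fc≢0) with nonvanishing P fc≢0
      ...   | d , e , B , nz with between (nonempty B)
      ...     | m , d<m , m<e = d , e , B , sgn (f m) , same
        where
        inside-root : ∀ {u v} → d < u → v < e → Root f u v → ⊥
        inside-root d<u v<e (z , u<z , z<v , fz) = nz z (<-trans d<u u<z) (<-trans z<v v<e) fz
        same : ∀ x → d < x → x < e → sgn (f x) ≡ sgn (f m)
        same x d<x x<e with compare x m
        ... | tri< x<m _ _  = same-sign P x<m (nz x d<x x<e) (nz m d<m m<e) (inside-root d<x m<e)
        ... | tri≈ _ refl _ = refl
        ... | tri> _ _ m<x  = sym (same-sign P m<x (nz m d<m m<e) (nz x d<x x<e) (inside-root d<m x<e))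

    abstract
      constant-signs : ∀ {A : Set} (f : A → F → F) → (∀ i → PolyFn (f i)) → ∀ is → ∃ λ d → ∃ λ e → Base d e ×
        (∀ x y → d < x → x < e → d < y → y < e → ∀ i → i ∈ is → sgn (f i x) ≡ sgn (f i y))
      constant-signs f P []       = let d , e , B , _ = avoid 0# in d , e , B , λ _ _ _ _ _ _ _ ()
      constant-signs f P (i ∷ is) with constant-sign (P i) | constant-signs f P is
      ... | d , e , B , σ , con | d′ , e′ , B′ , cons with meet B B′
      ...   | d″ , e″ , B″ , d≤ , d′≤ , ≤e , ≤e′ = d″ , e″ , B″ , λ x y d<x x<e d<y y<e →
              λ { _ (here refl) → trans (con x (≤-<-trans d≤ d<x) (<-≤-trans x<e ≤e)) (sym (con y (≤-<-trans d≤ d<y) (<-≤-trans y<e ≤e)))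
                ; j (there j∈)  → cons x y (≤-<-trans d′≤ d<x) (<-≤-trans x<e ≤e′) (≤-<-trans d′≤ d<y) (<-≤-trans y<e ≤e′) j j∈ }

  right-germ : ∀ c b → c < b → Germ (λ d e → d ≡ c × c < e × e ≤ b)
  right-germ c b c<b = record
    { nonempty = λ { (refl , c<e , _) → c<e }
    ; meet = λ { {e = e} {e′ = e′} (refl , c<e , e≤b) (refl , c<e′ , e′≤b) →
        let m , m≤e , m≤e′ , which = min e e′ in
        c , m , (refl , [ (λ m≡e → subst (c <_) (sym m≡e) c<e) , (λ m≡e′ → subst (c <_) (sym m≡e′) c<e′) ]′ which , ≤-trans m≤e e≤b)
        , ≤-refl , ≤-refl , m≤e , m≤e′ }
    ; avoid = λ r → avoid′ r }
    where
    avoid′ : ∀ r → ∃ λ d → ∃ λ e → (d ≡ c × c < e × e ≤ b) × ¬ (d < r × r < e)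
    avoid′ r with <⊎≥ c r
    ... | inj₂ r≤c = c , b , (refl , c<b , ≤-refl) , λ (c<r , _) → <⇒≱ c<r r≤c
    ... | inj₁ c<r with min r b
    ...   | m , m≤r , m≤b , inj₁ refl = c , m , (refl , c<r , m≤b) , λ (_ , r<m) → <⇒≱ r<m m≤r
    ...   | m , m≤r , m≤b , inj₂ refl = c , m , (refl , c<b , m≤b) , λ (_ , r<m) → <⇒≱ r<m m≤r

  left-germ : ∀ c b → b < c → Germ (λ d e → e ≡ c × d < c × b ≤ d)
  left-germ c b b<c = record
    { nonempty = λ { (refl , d<c , _) → d<c }
    ; meet = λ { {d = d} {d′ = d′} (refl , d<c , b≤d) (refl , d′<c , b≤d′) →
        let m , d≤m , d′≤m , which = max d d′ in
        m , c , (refl , [ (λ m≡d → subst (_< c) (sym m≡d) d<c) , (λ m≡d′ → subst (_< c) (sym m≡d′) d′<c) ]′ which , ≤-trans b≤d d≤m)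
        , d≤m , d′≤m , ≤-refl , ≤-refl }
    ; avoid = avoid′ }
    where
    avoid′ : ∀ r → ∃ λ d → ∃ λ e → (e ≡ c × d < c × b ≤ d) × ¬ (d < r × r < e)
    avoid′ r with <⊎≥ r c
    ... | inj₂ c≤r = b , c , (refl , b<c , ≤-refl) , λ (_ , r<c) → <⇒≱ r<c c≤r
    ... | inj₁ r<c with max r b
    ...   | m , r≤m , b≤m , inj₁ refl = m , c , (refl , r<c , b≤m) , λ (m<r , _) → <⇒≱ m<r r≤m
    ...   | m , r≤m , b≤m , inj₂ refl = m , c , (refl , b<c , b≤m) , λ (m<r , _) → <⇒≱ m<r r≤m

  abstract
    positive-right : ∀ {f} → PolyFn f → ∀ {c b} → c < b → 0# < f c → ∃ λ e → c < e × e ≤ b × (∀ x → c < x → x < e → 0# < f x)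
    positive-right {f} P {c} {b} c<b 0<fc with nonvanishing (right-germ c b c<b) P (pos≢0 0<fc)
    ... | _ , e , (refl , c<e , e≤b) , nz = e , c<e , e≤b , positive
      where
      positive : ∀ x → c < x → x < e → 0# < f x
      positive x c<x x<e with <⊎≥ 0# (f x)
      ... | inj₁ 0<fx          = 0<fx
      ... | inj₂ (inj₂ fx≡0)   = ⊥-elim (nz x c<x x<e fx≡0)
      ... | inj₂ (inj₁ fx<0)   = let z , c<z , z<x , fz = ivt↓ P c<x 0<fc fx<0 in ⊥-elim (nz z c<z (<-trans z<x x<e) fz)

  abstract
    positive-left : ∀ {f} → PolyFn f → ∀ {c b} → b < c → 0# < f c → ∃ λ d → d < c × b ≤ d × (∀ x → d < x → x < c → 0# < f x)
    positive-left {f} P {c} {b} b<c 0<fc with nonvanishing (left-germ c b b<c) P (pos≢0 0<fc)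
    ... | d , _ , (refl , d<c , b≤d) , nz = d , d<c , b≤d , positive
      where
      positive : ∀ x → d < x → x < c → 0# < f x
      positive x d<x x<c with <⊎≥ 0# (f x)
      ... | inj₁ 0<fx          = 0<fx
      ... | inj₂ (inj₂ fx≡0)   = ⊥-elim (nz x d<x x<c fx≡0)
      ... | inj₂ (inj₁ fx<0)   = let z , x<z , z<c , fz = ivt↑ P x<c fx<0 0<fc in ⊥-elim (nz z (<-trans d<x x<z) z<c fz)

  -- The derivative is characterised by f x - f c = (x - c) K x with K polynomial and K c = f′ c.
  record HasDer (f f′ : F → F) : Set where
    field
      poly : PolyFn f
      slope : ∀ c → ∃ λ K → PolyFn K × (∀ x → f x - f c ≡ (x - c) * K x) × K c ≡ f′ c
  open HasDer

  HasDer-cong : ∀ {f g f′ g′} → (∀ x → f x ≡ g x) → (∀ x → f′ x ≡ g′ x) → HasDer f f′ → HasDer g g′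
  HasDer-cong f≗g f′≗g′ H = record
    { poly = PolyFn-cong f≗g (poly H)
    ; slope = λ c → let K , PK , eq₁ , eq₂ = slope H c in
        K , PK , (λ x → trans (sym (cong₂ _-_ (f≗g x) (f≗g c))) (eq₁ x)) , trans eq₂ (f′≗g′ c) }

  const-der : ∀ a → HasDer (λ _ → a) (λ _ → 0#)
  const-der a = record { poly = const-poly a ; slope = λ c → (λ _ → 0#) , const-poly 0# , (λ x → solve 3 (λ a x c → a :- a := (x :- c) :* :0) refl a x c) , refl }

  id-der : HasDer (λ x → x) (λ _ → 1#)
  id-der = record { poly = id-poly ; slope = λ c → (λ _ → 1#) , const-poly 1# , (λ x → solve 2 (λ x c → x :- c := (x :- c) :* :1) refl x c) , refl }

  +-der : ∀ {f g f′ g′} → HasDer f f′ → HasDer g g′ → HasDer (λ x → f x + g x) (λ x → f′ x + g′ x)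
  +-der {f} {g} Hf Hg = record
    { poly = +-poly (poly Hf) (poly Hg)
    ; slope = λ c → let K , PK , e₁ , e₂ = slope Hf c ; L , PL , d₁ , d₂ = slope Hg c in
        (λ x → K x + L x) , +-poly PK PL ,
        (λ x → trans (solve 4 (λ a b c d → a :+ b :- (c :+ d) := (a :- c) :+ (b :- d)) refl (f x) (g x) (f c) (g c))
                 (trans (cong₂ _+_ (e₁ x) (d₁ x)) (sym (distribˡ (x - c) (K x) (L x))))) ,
        cong₂ _+_ e₂ d₂ }

  *-der : ∀ {f g f′ g′} → HasDer f f′ → HasDer g g′ → HasDer (λ x → f x * g x) (λ x → f′ x * g x + f x * g′ x)
  *-der {f} {g} Hf Hg = record
    { poly = *-poly (poly Hf) (poly Hg)
    ; slope = λ c → let K , PK , e₁ , e₂ = slope Hf c ; L , PL , d₁ , d₂ = slope Hg c in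
        (λ x → K x * g c + f x * L x) , +-poly (*-poly PK (const-poly (g c))) (*-poly (poly Hf) PL) ,
        (λ x → trans (solve 4 (λ a b c d → a :* b :- c :* d := (a :- c) :* d :+ a :* (b :- d)) refl (f x) (g x) (f c) (g c))
                 (trans (cong₂ (λ y z → y * g c + f x * z) (e₁ x) (d₁ x))
                   (solve 6 (λ x c k g f l → (x :- c) :* k :* g :+ f :* ((x :- c) :* l) := (x :- c) :* (k :* g :+ f :* l)) refl x c (K x) (g c) (f x) (L x)))) ,
        cong₂ (λ y z → y * g c + f c * z) e₂ d₂ }

  neg-der : ∀ {f f′} → HasDer f f′ → HasDer (λ x → - f x) (λ x → - f′ x)
  neg-der {f} {f′} H = HasDer-cong (λ x → solve 1 (λ y → :- :1 :* y := :- y) refl (f x))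
    (λ x → solve 2 (λ y z → :0 :* y :+ :- :1 :* z := :- z) refl (f x) (f′ x)) (*-der (const-der (- 1#)) H)

  abstract
    least : ∀ (P : F → Set) rs → (∃ λ x → x ∈ rs × P x) → ∃ λ x → P x × (∀ y → y ∈ rs → P y → x ≤ y)
    least P (r ∷ rs) (x , x∈ , Px) with em {∃ λ y → y ∈ rs × P y}
    least P (r ∷ rs) (x , here refl , Px) | no none = x , Px , λ { y (here refl) _ → ≤-refl ; y (there y∈) Py → ⊥-elim (none (y , y∈ , Py)) }
    least P (r ∷ rs) (x , there x∈ , Px)  | no none = ⊥-elim (none (x , x∈ , Px))
    ... | yes some with least P rs some
    ...   | z , Pz , min-z with em {P r × r < z}
    ...     | yes (Pr , r<z) = r , Pr , λ { y (here refl) _ → ≤-refl ; y (there y∈) Py → inj₁ (<-≤-trans r<z (min-z y y∈ Py)) }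
    ...     | no ¬r          = z , Pz , λ { y (here refl) Py → ≮⇒≥ (λ y<z → ¬r (Py , y<z)) ; y (there y∈) Py → min-z y y∈ Py }

  -- Otherwise f - f c is positive just right of c and has a least zero z beyond, just left of which it is negative.
  abstract
    increasing-closed : ∀ {f f′ c d} → HasDer f f′ → c < d → (∀ x → c ≤ x → x ≤ d → 0# < f′ x) → f c < f d
    increasing-closed {f} {f′} {c} {d} H c<d pos with <⊎≥ (f c) (f d)
    ... | inj₁ fc<fd = fc<fd
    ... | inj₂ fd≤fc = ⊥-elim (contradict (slope H c))
      where
      q : F → F
      q x = f x - f c
      Pq : PolyFn q
      Pq = +-poly (poly H) (const-poly (- f c))
      contradict : (∃ λ K → PolyFn K × (∀ x → f x - f c ≡ (x - c) * K x) × K c ≡ f′ c) → ⊥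
      contradict (K , PK , e₁ , e₂) = step₁ (positive-right PK c<d (subst (0# <_) (sym e₂) (pos c ≤-refl (inj₁ c<d))))
        where
        step₁ : (∃ λ e → c < e × e ≤ d × (∀ x → c < x → x < e → 0# < K x)) → ⊥
        step₁ (e , c<e , e≤d , Kpos) = step₂ (between c<e)
          where
          step₂ : (∃ λ x₁ → c < x₁ × x₁ < e) → ⊥
          step₂ (x₁ , c<x₁ , x₁<e) = step₃ (least (λ z → x₁ < z × z ≤ d × q z ≡ 0#) (proj₁ zeros) exists)
            where
            0<qx₁ : 0# < q x₁
            0<qx₁ = subst (0# <_) (sym (e₁ x₁)) (*-pos _ _ (0<-diff c<x₁) (Kpos x₁ c<x₁ x₁<e))
            zeros : Roots q
            zeros = roots Pq (pos≢0 0<qx₁)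
            x₁<d : x₁ < d
            x₁<d = <-≤-trans x₁<e e≤d
            qd≤0 : f d ≤ f c → q d ≤ 0#
            qd≤0 (inj₁ lt) = inj₁ (<-by (f c - f d) (0<-diff lt) (solve 2 (λ c d → :0 := d :- c :+ (c :- d)) refl (f c) (f d)))
            qd≤0 (inj₂ e)  = inj₂ (trans (cong (_- f c) e) (-‿inverseʳ (f c)))
            exists : ∃ λ z → z ∈ proj₁ zeros × x₁ < z × z ≤ d × q z ≡ 0#
            exists with qd≤0 fd≤fc
            ... | inj₂ qd≡0 = d , proj₂ zeros d qd≡0 , x₁<d , ≤-refl , qd≡0
            ... | inj₁ qd<0 = let z , x₁<z , z<d , qz = ivt↓ Pq x₁<d 0<qx₁ qd<0 in z , proj₂ zeros z qz , x₁<z , inj₁ z<d , qz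
            step₃ : (∃ λ z → (x₁ < z × z ≤ d × q z ≡ 0#) × (∀ y → y ∈ proj₁ zeros → x₁ < y × y ≤ d × q y ≡ 0# → z ≤ y)) → ⊥
            step₃ (z , (x₁<z , z≤d , qz≡0) , least-z) = step₄ (slope H z)
              where
              step₄ : (∃ λ L → PolyFn L × (∀ x → f x - f z ≡ (x - z) * L x) × L z ≡ f′ z) → ⊥
              step₄ (L , PL , d₁ , d₂) with positive-left PL x₁<z (subst (0# <_) (sym d₂) (pos z (inj₁ (<-trans c<x₁ x₁<z)) z≤d))
              ... | b , b<z , x₁≤b , Lpos with between b<z
              ...   | x , b<x , x<z = let y , x₁<y , y<x , qy = ivt↓ Pq (≤-<-trans x₁≤b b<x) 0<qx₁ qx<0 in
                        <⇒≱ (<-trans y<x x<z) (least-z y (proj₂ zeros y qy) (x₁<y , ≤-trans (inj₁ (<-trans y<x x<z)) z≤d , qy))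
                where
                qx<0 : q x < 0#
                qx<0 = subst (_< 0#) (trans (sym (d₁ x)) (cong (_-_ (f x)) (x-y≡0⇒x≡y qz≡0)))
                         (*-neg-pos (<-by (z - x) (0<-diff x<z) (solve 2 (λ x z → :0 := x :- z :+ (z :- x)) refl x z)) (Lpos x b<x x<z))

  abstract
    -- The derivative is controlled only at inner points, where the closed version applies. If f u
    -- exceeded f c, then f would take the value f c again strictly between `u` and `c`, against
    -- monotonicity inside; similarly on the right.
    increasing : ∀ {f f′ u v} → HasDer f f′ → u < v → (∀ x → u < x → x < v → 0# < f′ x) → f u < f v
    increasing {f} {f′} {u} {v} H u<v pos with between u<v
    ... | c , u<c , c<v with between c<v
    ...   | d , c<d , d<v = ≤-<-trans (≮⇒≥ left) (<-≤-trans (inner u<c c<d d<v) (≮⇒≥ right))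
      where
      inner : ∀ {x y} → u < x → x < y → y < v → f x < f y
      inner u<x x<y y<v = increasing-closed H x<y (λ z x≤z z≤y → pos z (<-≤-trans u<x x≤z) (≤-<-trans z≤y y<v))
      level : ∀ a → PolyFn (λ x → f x - a)
      level a = +-poly (poly H) (const-poly (- a))
      below-0 : ∀ {x a} → x < a → x - a < 0#
      below-0 {x} {a} x<a = <-by (a - x) (0<-diff x<a) (solve 2 (λ x a → :0 := x :- a :+ (a :- x)) refl x a)
      left : ¬ f c < f u
      left fc<fu with between u<c
      ... | x , u<x , x<c =
        let z , u<z , z<x , e = ivt↓ (level (f c)) u<x (0<-diff fc<fu) (below-0 (inner u<x x<c (<-trans c<d d<v)))
        in <-irrefl (subst (_< f c) (x-y≡0⇒x≡y e) (inner u<z (<-trans z<x x<c) (<-trans c<d d<v)))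
      right : ¬ f v < f d
      right fv<fd with between d<v
      ... | x , d<x , x<v =
        let z , x<z , z<v , e = ivt↓ (level (f d)) x<v (0<-diff (inner (<-trans u<c c<d) d<x x<v)) (below-0 fv<fd)
        in <-irrefl (subst (f d <_) (x-y≡0⇒x≡y e) (inner (<-trans u<c c<d) (<-trans d<x x<z) z<v))

  tilt : ∀ fu fv u v i → (v - u) * i ≡ 1# → fv + (fu - fv) * i * v ≡ fu + (fu - fv) * i * u
  tilt fu fv u v i [v-u]i≡1 = by-multiple (fu - fv) [v-u]i≡1
    (solve 5 (λ fu fv u v i → fv :+ (fu :- fv) :* i :* v :+ (fu :- fv) :* :1 := fu :+ (fu :- fv) :* i :* u :+ (fu :- fv) :* ((v :- u) :* i))
       refl fu fv u v i)

  add-slope : ∀ {f f′} → HasDer f f′ → ∀ ε → HasDer (λ x → f x + ε * x) (λ x → f′ x + ε)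
  add-slope {f} {f′} H ε = HasDer-cong (λ _ → refl) (λ x → cong (f′ x +_) (solve 2 (λ x e → :0 :* x :+ e :* :1 := e) refl x ε))
    (+-der H (*-der (const-der ε) id-der))

  abstract
    -- If f v < f u, adding the linear function with slope ε = (f u - f v)/(v - u) makes the values
    -- at both ends equal, although the derivative has become positive.
    nondecreasing : ∀ {f f′ u v} → HasDer f f′ → u < v → (∀ x → u < x → x < v → 0# ≤ f′ x) → f u ≤ f v
    nondecreasing {f} {f′} {u} {v} H u<v nonneg = ≮⇒≥ tilted
      where
      tilted : ¬ f v < f u
      tilted fv<fu = <-irrefl (subst (f u + ε * u <_) (tilt (f u) (f v) u v i [v-u]i≡1) (increasing (add-slope H ε) u<v
          (λ x u<x x<v → subst (0# <_) (+-comm ε (f′ x)) (+-pos-≤ 0<ε (nonneg x u<x x<v)))))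
        where
        i : F
        i = proj₁ (inverse (v - u) (pos≢0 (0<-diff u<v)))
        [v-u]i≡1 : (v - u) * i ≡ 1#
        [v-u]i≡1 = proj₂ (inverse (v - u) (pos≢0 (0<-diff u<v)))
        ε : F
        ε = (f u - f v) * i
        0<ε : 0# < ε
        0<ε = *-pos _ _ (0<-diff fv<fu) (inverse-pos (0<-diff u<v) [v-u]i≡1)

  abstract
    constant : ∀ {f f′ u v} → HasDer f f′ → u < v → (∀ x → u < x → x < v → f′ x ≡ 0#) → f u ≡ f v
    constant {f} {f′} {u} {v} H u<v zeros = ≤-antisym (nondecreasing H u<v (λ x u<x x<v → inj₂ (sym (zeros x u<x x<v))))
      (reflect (nondecreasing (neg-der H) u<v (λ x u<x x<v → inj₂ (trans (solve 0 (:0 := :- :0) refl) (cong -_ (sym (zeros x u<x x<v)))))))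
      where
      reflect : ∀ {x y} → - x ≤ - y → y ≤ x
      reflect {x} {y} (inj₁ lt) = inj₁ (subst₂ _<_ (-‿involutive y) (-‿involutive x) (neg-mono-< lt))
      reflect {x} {y} (inj₂ e)  = inj₂ (trans (sym (-‿involutive y)) (trans (cong -_ (sym e)) (-‿involutive x)))

-- Formal derivatives, pseudo-remainders and finite closed sets of polynomials

module PseudoRemainders (em : ExcludedMiddle 0ℓ) (𝓕 : RealClosedField) where

  open Basics em 𝓕
  open Order em 𝓕
  open Factorisation em 𝓕
  open PolynomialFunctions em 𝓕

  times : ℕ → F → F
  times zero    a = 0#
  times (suc n) a = a + times n a

  timesₑ : ∀ {W} → ℕ → Ex W → Ex W
  timesₑ zero    a = 𝟎
  timesₑ (suc n) a = a ∔ timesₑ n a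

  -- The multiplication by natural numbers is a parameter, so that the same definition covers
  -- numerical coefficients and expressions.
  derivative : {A : Set} → (ℕ → A → A) → List A → List A
  derivative _×_ []          = []
  derivative _×_ (a ∷ [])    = []
  derivative _×_ (a ∷ b ∷ p) = (suc (length p) × a) ∷ derivative _×_ (b ∷ p)

  length-derivative : ∀ {A : Set} (_×_ : ℕ → A → A) a p → length (derivative _×_ (a ∷ p)) ≡ length p
  length-derivative _×_ a []      = refl
  length-derivative _×_ a (b ∷ p) = cong suc (length-derivative _×_ b p)

  ev-times : ∀ {W} n (a : Ex W) ρ → ev (timesₑ n a) ρ ≡ times n (ev a ρ)
  ev-times zero    a ρ = refl
  ev-times (suc n) a ρ = cong (ev a ρ +_) (ev-times n a ρ)

  spec-derivative : ∀ {W} (ρ : W → F) p → spec ρ (derivative timesₑ p) ≡ derivative times (spec ρ p)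
  spec-derivative ρ []          = refl
  spec-derivative ρ (a ∷ [])    = refl
  spec-derivative ρ (a ∷ b ∷ p) = cong₂ _∷_
    (trans (ev-times (suc (length p)) a ρ) (cong (λ n → times (suc n) (ev a ρ)) (sym (length-map (λ e → ev e ρ) p)))) (spec-derivative ρ (b ∷ p))

  times-pos : ∀ n {a} → 0# < a → 0# < times (suc n) a
  times-pos zero    0<a = subst (0# <_) (sym (+-identityʳ _)) 0<a
  times-pos (suc n) 0<a = +-pos 0<a (times-pos n 0<a)

  times-*1 : ∀ n a → times n a ≡ a * times n 1#
  times-*1 zero    a = sym (zeroʳ a)
  times-*1 (suc n) a = trans (cong (a +_) (times-*1 n a)) (solve 2 (λ a t → a :+ a :* t := a :* (:1 :+ t)) refl a (times n 1#))

  times≢0 : ∀ n {a} → ¬ a ≡ 0# → ¬ times (suc n) a ≡ 0#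
  times≢0 n {a} a≢0 e = nonzero-* a≢0 (pos≢0 (times-pos n 0<1)) (trans (sym (times-*1 (suc n) a)) e)

  power-der : ∀ a n → HasDer (λ x → a * pow x (suc n)) (λ x → times (suc n) a * pow x n)
  power-der a zero = HasDer-cong (λ x → solve 2 (λ a x → a :* x := a :* (x :* :1)) refl a x)
    (λ x → solve 2 (λ a x → :0 :* x :+ a :* :1 := (a :+ :0) :* :1) refl a x) (*-der (const-der a) id-der)
  power-der a (suc n) = HasDer-cong (λ x → solve 3 (λ a x y → x :* (a :* (x :* y)) := a :* (x :* (x :* y))) refl a x (pow x n))
    (λ x → solve 4 (λ a x y t → :1 :* (a :* (x :* y)) :+ x :* ((a :+ t) :* y) := (a :+ (a :+ t)) :* (x :* y)) refl a x (pow x n) (times n a))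
    (*-der id-der (power-der a n))

  eval-der : ∀ p → HasDer (eval p) (eval (derivative times p))
  eval-der []          = const-der 0#
  eval-der (a ∷ [])    = HasDer-cong (λ x → solve 1 (λ a → a := a :* :1 :+ :0) refl a) (λ _ → refl) (const-der a)
  eval-der (a ∷ b ∷ p) = HasDer-cong (λ _ → refl) (λ x → cong (λ n → times (suc (length p)) a * pow x n + eval (derivative times (b ∷ p)) x) (sym (length-derivative times b p)))
    (+-der (power-der a (length p)) (eval-der (b ∷ p)))

  pow-+ : ∀ x m n → pow x (m ℕ.+ n) ≡ pow x m * pow x n
  pow-+ x zero    n = sym (*-identityˡ (pow x n))
  pow-+ x (suc m) n = trans (cong (x *_) (pow-+ x m n)) (sym (*-assoc x (pow x m) (pow x n)))

  -- b p - a xᵈ q where d is the difference of the degrees, computed by aligning the leading coefficients.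
  combine : ∀ {W} → Ex W → Ex W → List (Ex W) → List (Ex W) → List (Ex W)
  combine a b []      q       = []
  combine a b (x ∷ p) []      = (b ∙ x) ∷ combine a b p []
  combine a b (x ∷ p) (y ∷ q) = (b ∙ x ∔ ⁻ (a ∙ y)) ∷ combine a b p q

  length-combine : ∀ {W} (a b : Ex W) p q → length (combine a b p q) ≡ length p
  length-combine a b []      q       = refl
  length-combine a b (x ∷ p) []      = cong suc (length-combine a b p [])
  length-combine a b (x ∷ p) (y ∷ q) = cong suc (length-combine a b p q)

  module _ {W : Set} (ρ : W → F) where
    ⟦_⟧_ : List (Ex W) → F → F
    ⟦ p ⟧ x = eval (spec ρ p) x

    ⟦∷⟧ : ∀ a p x → ⟦ a ∷ p ⟧ x ≡ ev a ρ * pow x (length p) + ⟦ p ⟧ x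
    ⟦∷⟧ a p x = cong (λ n → ev a ρ * pow x n + ⟦ p ⟧ x) (length-map (λ e → ev e ρ) p)

    eval-combine : ∀ a b p q x → length q ℕ.≤ length p →
      ⟦ combine a b p q ⟧ x ≡ ev b ρ * ⟦ p ⟧ x - ev a ρ * (pow x (length p ℕ.∸ length q) * ⟦ q ⟧ x)
    eval-combine a b [] [] x _ = solve 2 (λ a b → :0 := b :* :0 :- a :* (:1 :* :0)) refl (ev a ρ) (ev b ρ)
    eval-combine a b (c ∷ p) [] x _ = trans (⟦∷⟧ (b ∙ c) (combine a b p []) x)
      (trans (cong₂ (λ n z → ev b ρ * ev c ρ * pow x n + z) (length-combine a b p []) (eval-combine a b p [] x ℕ.z≤n))
        (trans (solve 7 (λ a b c y p z w → b :* c :* y :+ (b :* p :- a :* (z :* :0)) := b :* (c :* y :+ p) :- a :* (w :* :0)) refl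
           (ev a ρ) (ev b ρ) (ev c ρ) (pow x (length p)) (⟦ p ⟧ x) (pow x (length p)) (pow x (suc (length p))))
          (cong (λ z → ev b ρ * z - ev a ρ * (pow x (suc (length p)) * 0#)) (sym (⟦∷⟧ c p x)))))
    eval-combine a b (c ∷ p) (d ∷ q) x (ℕ.s≤s q≤p) = trans (⟦∷⟧ (b ∙ c ∔ ⁻ (a ∙ d)) (combine a b p q) x)
      (trans (cong₂ (λ n z → (ev b ρ * ev c ρ + - (ev a ρ * ev d ρ)) * pow x n + z) (length-combine a b p q) (eval-combine a b p q x q≤p))
        (trans (cong (λ z → (ev b ρ * ev c ρ + - (ev a ρ * ev d ρ)) * z + (ev b ρ * ⟦ p ⟧ x - ev a ρ * (pow x (length p ℕ.∸ length q) * ⟦ q ⟧ x))) split)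
          (trans (solve 8 (λ a b c d y z p q → (b :* c :+ :- (a :* d)) :* (y :* z) :+ (b :* p :- a :* (y :* q))
                    := b :* (c :* (y :* z) :+ p) :- a :* (y :* (d :* z :+ q))) refl
                    (ev a ρ) (ev b ρ) (ev c ρ) (ev d ρ) (pow x (length p ℕ.∸ length q)) (pow x (length q)) (⟦ p ⟧ x) (⟦ q ⟧ x))
            (cong₂ (λ y z → ev b ρ * y - ev a ρ * (pow x (length p ℕ.∸ length q) * z))
              (trans (cong (λ z → ev c ρ * z + ⟦ p ⟧ x) (sym split)) (sym (⟦∷⟧ c p x))) (sym (⟦∷⟧ d q x))))))
      where
      split : pow x (length p) ≡ pow x (length p ℕ.∸ length q) * pow x (length q)
      split = trans (cong (pow x) (sym (ℕₚ.m∸n+n≡m q≤p))) (pow-+ x (length p ℕ.∸ length q) (length q))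

    reduce-step : ∀ a b p q x → length q ℕ.≤ length p → ⟦ b ∷ q ⟧ x ≡ 0# → ev b ρ * ⟦ a ∷ p ⟧ x ≡ ⟦ combine a b p q ⟧ x
    reduce-step a b p q x q≤p root = begin
      ev b ρ * ⟦ a ∷ p ⟧ x                              ≡⟨ cong (ev b ρ *_) (⟦∷⟧ a p x) ⟩
      ev b ρ * (ev a ρ * pow x (length p) + ⟦ p ⟧ x)
        ≡⟨ cong (λ z → ev b ρ * (ev a ρ * z + ⟦ p ⟧ x)) (trans (cong (pow x) (sym (ℕₚ.m∸n+n≡m q≤p))) (pow-+ x (length p ℕ.∸ length q) (length q))) ⟩
      ev b ρ * (ev a ρ * (y * pow x (length q)) + ⟦ p ⟧ x)
        ≡⟨ by-multiple (- (ev a ρ * y)) (sym (trans (sym (⟦∷⟧ b q x)) root)) (solve 6 (λ a b y z p q → b :* (a :* (y :* z) :+ p) :+ :- (a :* y) :* (b :* z :+ q)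
             := b :* p :- a :* (y :* q) :+ :- (a :* y) :* :0) refl (ev a ρ) (ev b ρ) y (pow x (length q)) (⟦ p ⟧ x) (⟦ q ⟧ x)) ⟩
      ev b ρ * ⟦ p ⟧ x - ev a ρ * (y * ⟦ q ⟧ x)         ≡⟨ sym (eval-combine a b p q x q≤p) ⟩
      ⟦ combine a b p q ⟧ x ∎
      where
      open ≡-Reasoning
      y = pow x (length p ℕ.∸ length q)

  -- Pseudo-remainder of p modulo b ∷ q, for fuel at least the length of p.
  remainder : ∀ {W} → ℕ → List (Ex W) → Ex W → List (Ex W) → List (Ex W)
  remainder zero    p       b q = p
  remainder (suc n) []      b q = []
  remainder (suc n) (a ∷ p) b q with length q ℕ.≤? length p
  ... | yes _ = remainder n (combine a b p q) b q
  ... | no _  = a ∷ p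

  length-remainder : ∀ {W} n (p : List (Ex W)) b q → length p ℕ.≤ n → length (remainder n p b q) ℕ.≤ length q
  length-remainder zero    []      b q _ = ℕ.z≤n
  length-remainder (suc n) []      b q _ = ℕ.z≤n
  length-remainder (suc n) (a ∷ p) b q (ℕ.s≤s p≤n) with length q ℕ.≤? length p
  ... | yes _  = length-remainder n (combine a b p q) b q (subst (ℕ._≤ n) (sym (length-combine a b p q)) p≤n)
  ... | no q≰p = ℕₚ.≰⇒> q≰p

  remainder-short : ∀ {W} n (p : List (Ex W)) b q → length p ℕ.≤ length q → remainder n p b q ≡ p
  remainder-short zero    p       b q _ = refl
  remainder-short (suc n) []      b q _ = refl
  remainder-short (suc n) (a ∷ p) b q p<q with length q ℕ.≤? length p
  ... | yes q≤p = ⊥-elim (ℕₚ.<⇒≱ p<q q≤p)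
  ... | no _    = refl

  -- Each reduction step multiplies by the leading coefficient `b` once. The exponent is found
  -- before `ρ` and `x` are given, so the relation can be compared at two parameter points.
  remainder-at-root : ∀ {W} n (p : List (Ex W)) b q → ∃ λ k → ∀ (ρ : W → F) x → eval (spec ρ (b ∷ q)) x ≡ 0# →
    pow (ev b ρ) k * eval (spec ρ p) x ≡ eval (spec ρ (remainder n p b q)) x
  remainder-at-root zero    p       b q = 0 , λ ρ x _ → *-identityˡ _
  remainder-at-root (suc n) []      b q = 0 , λ ρ x _ → *-identityˡ _
  remainder-at-root (suc n) (a ∷ p) b q with length q ℕ.≤? length p
  ... | no _    = 0 , λ ρ x _ → *-identityˡ _
  ... | yes q≤p with remainder-at-root n (combine a b p q) b q
  ...   | k , ih = suc k , λ ρ x root →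
            trans (solve 3 (λ b y z → b :* y :* z := y :* (b :* z)) refl (ev b ρ) (pow (ev b ρ) k) (eval (spec ρ (a ∷ p)) x))
              (trans (cong (pow (ev b ρ) k *_) (reduce-step ρ a b p q x q≤p root)) (ih ρ x root))

  module _ {W : Set} where
    private
      P : Set
      P = List (Ex W)

    rest : P → P
    rest []      = []
    rest (_ ∷ p) = p

    rem : P → P → P
    rem p []      = []
    rem p (b ∷ q) = remainder (length p) p b q

    operations : P × P → List P
    operations (p , q) = rest p ∷ derivative timesₑ p ∷ rem p q ∷ []

    -- Closure is required only for lists longer than `j`, so that it can be achieved from the long
    -- lists downwards; at 0 only the empty list is exempt.
    ClosedAbove : ℕ → List P → Set
    ClosedAbove j C = ∀ p q → p ∈ C → q ∈ C → j ℕ.< length p → j ℕ.< length q → ∀ r → r ∈ operations (p , q) → r ∈ C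

    -- A result other than `p` is shorter than `p`, and either also shorter than `q` or obtained
    -- from `p` alone. This makes the closure finite.
    shorter : ∀ p q → 0 ℕ.< length p → 0 ℕ.< length q → ∀ r → r ∈ operations (p , q) →
      r ≡ p ⊎ length r ℕ.< length p × (length r ℕ.< length q ⊎ r ∈ operations (p , p))
    shorter (a ∷ p) q _ _ r (here refl) = inj₂ (ℕₚ.n<1+n _ , inj₂ (here refl))
    shorter (a ∷ p) q _ _ r (there (here refl)) =
      inj₂ (ℕₚ.≤-reflexive (cong suc (length-derivative timesₑ a p)) , inj₂ (there (here refl)))
    shorter (a ∷ p) (b ∷ q) _ _ r (there (there (here refl))) with ℕₚ.≤-total (length (a ∷ p)) (length q)
    ... | inj₁ p≤q = inj₁ (remainder-short (length (a ∷ p)) (a ∷ p) b q p≤q)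
    ... | inj₂ q≤p with ℕₚ.m≤n⇒m<n∨m≡n q≤p
    ...   | inj₁ q<p = inj₂ (ℕₚ.≤-<-trans short q<p , inj₁ (ℕ.s≤s short))
      where
      short : length (rem (a ∷ p) (b ∷ q)) ℕ.≤ length q
      short = length-remainder (length (a ∷ p)) (a ∷ p) b q ℕₚ.≤-refl
    ...   | inj₂ q≡p = inj₁ (remainder-short (length (a ∷ p)) (a ∷ p) b q (ℕₚ.≤-reflexive (sym q≡p)))

    abstract
      -- Only results of length at most `j` are added, which imposes nothing new at this level. A
      -- longer result other than `p` comes from lists longer than itself, for which `C` is closed
      -- already.
      close : ∀ j C → ClosedAbove j C → ∃ λ C′ → C ⊆ C′ × ClosedAbove 0 C′
      close zero    C closed = C , (λ p∈ → p∈) , closed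
      close (suc j) C closed = let C′ , sub , closed″ = close j (C ++ new) closed′ in C′ , (λ p∈ → sub (∈-++⁺ˡ p∈)) , closed″
        where
        short? : (r : P) → Dec (length r ℕ.< suc j)
        short? r = length r ℕ.<? suc j
        candidates new : List P
        candidates = concatMap operations (cartesianProduct C C)
        new = filter short? candidates
        long∈C : ∀ p → p ∈ C ++ new → suc j ℕ.≤ length p → p ∈ C
        long∈C p p∈ j<p with ∈-++⁻ C p∈
        ... | inj₁ p∈C = p∈C
        ... | inj₂ p∈new = ⊥-elim (ℕₚ.<⇒≱ (proj₂ (∈-filter⁻ short? {xs = candidates} p∈new)) j<p)
        closed′ : ClosedAbove j (C ++ new)
        closed′ p q p∈ q∈ j<p j<q r r∈ with short? r
        ... | yes short = ∈-++⁺ʳ C (∈-filter⁺ short?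
                (∈-concatMap⁺ operations (lose (∈-cartesianProduct⁺ (long∈C p p∈ j<p) (long∈C q q∈ j<q)) r∈)) short)
        ... | no long with shorter p q (ℕₚ.≤-<-trans ℕ.z≤n j<p) (ℕₚ.≤-<-trans ℕ.z≤n j<q) r r∈
        ...   | inj₁ refl = p∈
        ...   | inj₂ (r<p , inj₁ r<q) = ∈-++⁺ˡ (closed p q (long∈C p p∈ j<p) (long∈C q q∈ j<q)
                  (ℕₚ.≤-<-trans (ℕₚ.≮⇒≥ long) r<p) (ℕₚ.≤-<-trans (ℕₚ.≮⇒≥ long) r<q) r r∈)
        ...   | inj₂ (r<p , inj₂ r∈′) = ∈-++⁺ˡ (closed p p (long∈C p p∈ j<p) (long∈C p p∈ j<p)
                  (ℕₚ.≤-<-trans (ℕₚ.≮⇒≥ long) r<p) (ℕₚ.≤-<-trans (ℕₚ.≮⇒≥ long) r<p) r r∈′)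

      length-bound : ∀ (C : List P) → ∃ λ j → ∀ p → p ∈ C → length p ℕ.≤ j
      length-bound []      = 0 , λ _ ()
      length-bound (p ∷ C) = let j , bound = length-bound C in length p ℕ.+ j ,
        λ { _ (here refl) → ℕₚ.m≤m+n (length p) j ; q (there q∈) → ℕₚ.≤-trans (bound q q∈) (ℕₚ.m≤n+m j (length p)) }

      closure : ∀ (L : List P) → ∃ λ C → L ⊆ C × ClosedAbove 0 C
      closure L = let j , bound = length-bound L in
        close j L (λ p q p∈ _ j<p _ → ⊥-elim (ℕₚ.<⇒≱ j<p (bound p p∈)))

-- Signs far out, and zeros of monotone polynomials

module Splittings (em : ExcludedMiddle 0ℓ) (𝓕 : RealClosedField) where

  open Basics em 𝓕
  open Order em 𝓕
  open Factorisation em 𝓕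
  open SignChanges em 𝓕
  open PolynomialFunctions em 𝓕

  <-max : ∀ x y → ∃ λ z → x ≤ z × y ≤ z
  <-max x y = let z , x≤z , y≤z , _ = max x y in z , x≤z , y≤z

  abstract
    -- With n the length of the tail, write a xⁿ⁺¹ + b xⁿ + ... as (xⁿ + ...) + (a x + b - 1) xⁿ.
    -- The first summand is positive far out by induction, the second is nonnegative once x ≥ 0 and
    -- x ≥ (1 - b)/a.
    eventually-positive : ∀ p a → 0# < a → ∃ λ B → ∀ x → B ≤ x → 0# < eval (a ∷ p) x
    eventually-positive []      a 0<a = 0# , λ x _ → subst (0# <_) (solve 1 (λ a → a := a :* :1 :+ :0) refl a) 0<a
    eventually-positive (b ∷ p) a 0<a with eventually-positive p 1# 0<1
    ... | B , pos = proj₁ bound , λ x bound≤x →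
            let B≤x = ≤-trans (proj₁ (proj₂ bound)) bound≤x
                M≤x = ≤-trans (proj₁ (proj₂ (proj₂ bound))) bound≤x
                0≤x = ≤-trans (proj₂ (proj₂ (proj₂ bound))) bound≤x
            in subst (0# <_) (rearrange x) (+-pos-≤ (pos x B≤x) (*-nonneg (head-large x M≤x) (pow-nonneg x 0≤x (length p))))
      where
      a⁻¹ M : F
      a⁻¹ = proj₁ (inverse a (pos≢0 0<a))
      M = a⁻¹ * (1# - b)
      aa⁻¹≡1 : a * a⁻¹ ≡ 1#
      aa⁻¹≡1 = proj₂ (inverse a (pos≢0 0<a))
      bound : ∃ λ z → B ≤ z × M ≤ z × 0# ≤ z
      bound = let m , B≤m , M≤m = <-max B M ; z , m≤z , 0≤z = <-max m 0# in z , ≤-trans B≤m m≤z , ≤-trans M≤m m≤z , 0≤z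
      *-nonneg : ∀ {x y} → 0# ≤ x → 0# ≤ y → 0# ≤ x * y
      *-nonneg (inj₁ 0<x)  (inj₁ 0<y)  = inj₁ (*-pos _ _ 0<x 0<y)
      *-nonneg {x} (inj₁ _) (inj₂ refl) = inj₂ (sym (zeroʳ x))
      *-nonneg {y = y} (inj₂ refl) _   = inj₂ (sym (zeroˡ y))
      pow-nonneg : ∀ x → 0# ≤ x → ∀ n → 0# ≤ pow x n
      pow-nonneg x 0≤x zero    = inj₁ 0<1
      pow-nonneg x 0≤x (suc n) = *-nonneg 0≤x (pow-nonneg x 0≤x n)
      head-large : ∀ x → M ≤ x → 0# ≤ a * x + b - 1#
      head-large x (inj₁ M<x) = inj₁ (subst (0# <_) (by-multiple (b - 1#) aa⁻¹≡1
        (solve 4 (λ a i b x → a :* (x :- i :* (:1 :- b)) :+ (b :- :1) :* :1 := a :* x :+ b :- :1 :+ (b :- :1) :* (a :* i)) refl a a⁻¹ b x))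
        (*-pos _ _ 0<a (0<-diff M<x)))
      head-large x (inj₂ refl) = inj₂ (by-multiple (1# - b) (sym aa⁻¹≡1)
        (solve 3 (λ a i b → :0 :+ (:1 :- b) :* (a :* i) := a :* (i :* (:1 :- b)) :+ b :- :1 :+ (:1 :- b) :* :1) refl a a⁻¹ b))
      rearrange : ∀ x → eval (1# ∷ p) x + (a * x + b - 1#) * pow x (length p) ≡ eval (a ∷ b ∷ p) x
      rearrange x = solve 5 (λ a b x y z → :1 :* y :+ z :+ (a :* x :+ b :- :1) :* y := a :* (x :* y) :+ (b :* y :+ z)) refl a b x (pow x (length p)) (eval p x)

  leading : List Sgn → Sgn
  leading []      = ⊙
  leading (⊙ ∷ s) = leading s
  leading (⊖ ∷ s) = ⊖
  leading (⊕ ∷ s) = ⊕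

  abstract
    eventual-sign : ∀ p → ∃ λ B → ∀ x → B ≤ x → sgn (eval p x) ≡ leading (map sgn p)
    eventual-sign []      = 0# , λ x _ → sgn-zero refl
    eventual-sign (a ∷ p) with sgn a in sa
    ... | ⊙ = let B , e = eventual-sign p in B , λ x B≤x →
              trans (cong sgn (trans (cong (λ a → a * pow x (length p) + eval p x) (sgn⇒zero sa))
                (solve 2 (λ y z → :0 :* y :+ z := z) refl (pow x (length p)) (eval p x)))) (e x B≤x)
    ... | ⊕ = let B , pos = eventually-positive p a (sgn⇒pos sa) in B , λ x B≤x → sgn-pos (pos x B≤x)
    ... | ⊖ = let B , pos = eventually-positive (map (- 1# *_) p) (- 1# * a) (subst (0# <_) (solve 1 (λ a → :- a := :- :1 :* a) refl a) (neg-pos (sgn⇒neg sa)))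
              in B , λ x B≤x → sgn-neg (subst₂ _<_ (negated x) refl (neg-neg (pos x B≤x)))
      where
      negated : ∀ x → - eval (- 1# * a ∷ map (- 1# *_) p) x ≡ eval (a ∷ p) x
      negated x = trans (cong -_ (eval-scale (- 1#) (a ∷ p) x)) (solve 1 (λ z → :- (:- :1 :* z) := z) refl (eval (a ∷ p) x))

  alternate : ℕ → F → F
  alternate zero    a = a
  alternate (suc n) a = - alternate n a

  flip : List F → List F
  flip []      = []
  flip (a ∷ p) = alternate (length p) a ∷ flip p

  length-flip : ∀ p → length (flip p) ≡ length p
  length-flip []      = refl
  length-flip (a ∷ p) = cong suc (length-flip p)

  pow-alternate : ∀ n a x → alternate n a * pow x n ≡ a * pow (- x) n
  pow-alternate zero    a x = refl
  pow-alternate (suc n) a x = trans (solve 3 (λ a x y → :- a :* (x :* y) := :- x :* (a :* y)) refl (alternate n a) x (pow x n))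
    (trans (cong (- x *_) (pow-alternate n a x)) (solve 3 (λ a x y → :- x :* (a :* y) := a :* (:- x :* y)) refl a x (pow (- x) n)))

  eval-flip : ∀ p x → eval (flip p) x ≡ eval p (- x)
  eval-flip []      x = refl
  eval-flip (a ∷ p) x = cong₂ _+_ (trans (cong (λ n → alternate (length p) a * pow x n) (length-flip p)) (pow-alternate (length p) a x)) (eval-flip p x)

  flip-signs : ∀ p q → map sgn p ≡ map sgn q → map sgn (flip p) ≡ map sgn (flip q)
  flip-signs []      []      _ = refl
  flip-signs (a ∷ p) (b ∷ q) e = cong₂ _∷_ (trans (alternate-sign (length p) (proj₁ (∷-injective e))) (cong (λ n → sgn (alternate n b)) same-length))
                                           (flip-signs p q (proj₂ (∷-injective e)))
    where
    alternate-sign : ∀ n {a b} → sgn a ≡ sgn b → sgn (alternate n a) ≡ sgn (alternate n b)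
    alternate-sign zero    e = e
    alternate-sign (suc n) {a} {b} e = trans (sgn-opp (alternate n a)) (trans (cong (⊖ ·ₛ_) (alternate-sign n e)) (sym (sgn-opp (alternate n b))))
    same-length : length p ≡ length q
    same-length = trans (sym (length-map sgn p)) (trans (cong length (proj₂ (∷-injective e))) (length-map sgn q))

  -- A pair of matching intervals either needs no further cut or is cut at one zero on each side.
  data Split (f f′ : F → F) (lo lo′ hi hi′ : F) : Set where
    unsplit : (∀ x x′ → lo < x → x < hi → lo′ < x′ → x′ < hi′ → sgn (f x) ≡ sgn (f′ x′)) → Split f f′ lo lo′ hi hi′
    split   : ∀ z z′ → lo < z → z < hi → lo′ < z′ → z′ < hi′ → f z ≡ 0# → f′ z′ ≡ 0# →
      (∀ x x′ → lo < x → x < z → lo′ < x′ → x′ < z′ → sgn (f x) ≡ sgn (f′ x′)) →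
      (∀ x x′ → z < x → x < hi → z′ < x′ → x′ < hi′ → sgn (f x) ≡ sgn (f′ x′)) → Split f f′ lo lo′ hi hi′

  Increasing : (F → F) → F → F → Set
  Increasing f lo hi = ∀ x y → lo ≤ x → x < y → y ≤ hi → f x < f y

  abstract
    -- For an increasing function the signs at the two ends decide whether there is a zero inside,
    -- and these signs agree on both lines.
    split-increasing : ∀ {f f′ lo lo′ hi hi′} → PolyFn f → PolyFn f′ → lo < hi → lo′ < hi′ → Increasing f lo hi → Increasing f′ lo′ hi′ →
      sgn (f lo) ≡ sgn (f′ lo′) → sgn (f hi) ≡ sgn (f′ hi′) → Split f f′ lo lo′ hi hi′
    split-increasing {f} {f′} {lo} {lo′} {hi} {hi′} P P′ lo<hi lo′<hi′ inc inc′ elo ehi with <⊎≥ (f lo) 0# | <⊎≥ 0# (f hi)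
    ... | inj₂ 0≤flo | _ = unsplit λ x x′ lo<x x<hi lo′<x′ x′<hi′ →
            trans (sgn-pos (≤-<-trans 0≤flo (inc lo x ≤-refl lo<x (inj₁ x<hi))))
              (sym (sgn-pos (≤-<-trans (transfer 0≤flo) (inc′ lo′ x′ ≤-refl lo′<x′ (inj₁ x′<hi′)))))
      where
      transfer : 0# ≤ f lo → 0# ≤ f′ lo′
      transfer (inj₁ 0<) = inj₁ (sgn⇒pos (trans (sym elo) (sgn-pos 0<)))
      transfer (inj₂ 0≡) = inj₂ (sym (sgn⇒zero (trans (sym elo) (sgn-zero (sym 0≡)))))
    ... | inj₁ _ | inj₂ fhi≤0 = unsplit λ x x′ lo<x x<hi lo′<x′ x′<hi′ →
            trans (sgn-neg (<-≤-trans (inc x hi (inj₁ lo<x) x<hi ≤-refl) fhi≤0))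
              (sym (sgn-neg (<-≤-trans (inc′ x′ hi′ (inj₁ lo′<x′) x′<hi′ ≤-refl) (transfer fhi≤0))))
      where
      transfer : f hi ≤ 0# → f′ hi′ ≤ 0#
      transfer (inj₁ <0) = inj₁ (sgn⇒neg (trans (sym ehi) (sgn-neg <0)))
      transfer (inj₂ ≡0) = inj₂ (sgn⇒zero (trans (sym ehi) (sgn-zero ≡0)))
    ... | inj₁ flo<0 | inj₁ 0<fhi
      with ivt↑ P lo<hi flo<0 0<fhi | ivt↑ P′ lo′<hi′ (sgn⇒neg (trans (sym elo) (sgn-neg flo<0))) (sgn⇒pos (trans (sym ehi) (sgn-pos 0<fhi)))
    ...   | z , lo<z , z<hi , fz | z′ , lo′<z′ , z′<hi′ , f′z′ = split z z′ lo<z z<hi lo′<z′ z′<hi′ fz f′z′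
            (λ x x′ lo<x x<z lo′<x′ x′<z′ →
              trans (sgn-neg (subst (f x <_) fz (inc x z (inj₁ lo<x) x<z (inj₁ z<hi))))
                (sym (sgn-neg (subst (f′ x′ <_) f′z′ (inc′ x′ z′ (inj₁ lo′<x′) x′<z′ (inj₁ z′<hi′))))))
            (λ x x′ z<x x<hi z′<x′ x′<hi′ →
              trans (sgn-pos (subst (_< f x) fz (inc z x (inj₁ lo<z) z<x (inj₁ x<hi))))
                (sym (sgn-pos (subst (_< f′ x′) f′z′ (inc′ z′ x′ (inj₁ lo′<z′) z′<x′ (inj₁ x′<hi′))))))

  Split-neg : ∀ {f f′ lo lo′ hi hi′} → Split (λ x → - f x) (λ x → - f′ x) lo lo′ hi hi′ → Split f f′ lo lo′ hi hi′
  Split-neg {f} {f′} = λ where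
      (unsplit s) → unsplit λ x x′ a b c d → cancel-neg (s x x′ a b c d)
      (split z z′ a b c d fz f′z′ l r) → split z z′ a b c d (cancel-zero fz) (cancel-zero f′z′)
        (λ x x′ a b c d → cancel-neg (l x x′ a b c d)) (λ x x′ a b c d → cancel-neg (r x x′ a b c d))
    where
    cancel-neg : ∀ {x y} → sgn (- x) ≡ sgn (- y) → sgn x ≡ sgn y
    cancel-neg {x} {y} e = ·ₛ-cancel ⊖ (λ ()) (trans (sym (sgn-opp x)) (trans e (sgn-opp y)))
    cancel-zero : ∀ {x} → - x ≡ 0# → x ≡ 0#
    cancel-zero {x} e = trans (sym (-‿involutive x)) (trans (cong -_ e) (solve 0 (:- :0 := :0) refl))

  powₛ : Sgn → ℕ → Sgn
  powₛ s zero    = ⊕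
  powₛ s (suc k) = s ·ₛ powₛ s k

  sgn-pow : ∀ x k → sgn (pow x k) ≡ powₛ (sgn x) k
  sgn-pow x zero    = sgn-pos 0<1
  sgn-pow x (suc k) = trans (sgn-* x (pow x k)) (cong (sgn x ·ₛ_) (sgn-pow x k))

  powₛ≢⊙ : ∀ s → ¬ s ≡ ⊙ → ∀ k → ¬ powₛ s k ≡ ⊙
  powₛ≢⊙ s s≢⊙ zero    ()
  powₛ≢⊙ ⊙ s≢⊙ (suc k) _ = s≢⊙ refl
  powₛ≢⊙ ⊕ s≢⊙ (suc k) e = powₛ≢⊙ ⊕ s≢⊙ k e
  powₛ≢⊙ ⊖ s≢⊙ (suc k) e with powₛ ⊖ k in is-zero
  ... | ⊙ = powₛ≢⊙ ⊖ s≢⊙ k is-zero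
  powₛ≢⊙ ⊖ s≢⊙ (suc k) () | ⊕
  powₛ≢⊙ ⊖ s≢⊙ (suc k) () | ⊖

-- Matching the sign patterns on two lines

module Matchings (em : ExcludedMiddle 0ℓ) (𝓕 : RealClosedField) where

  open Basics em 𝓕
  open Order em 𝓕
  open Factorisation em 𝓕
  open PolynomialFunctions em 𝓕
  open PseudoRemainders em 𝓕
  open Splittings em 𝓕

  module Lines {W : Set} (ρ ρ′ : W → F) where

    P : Set
    P = List (Ex W)

    Same : P → F → F → Set
    Same p x x′ = sgn (eval (spec ρ p) x) ≡ sgn (eval (spec ρ′ p) x′)

    -- Every cut point remembers a polynomial vanishing there whose leading coefficient does not
    -- vanish. Reduction modulo it determines the sign of a polynomial adjoined later.
    RootOf : (P → Set) → F → Set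
    RootOf Ψ m = ∃ λ b → ∃ λ q → Ψ (b ∷ q) × ¬ ev b ρ ≡ 0# × eval (spec ρ (b ∷ q)) m ≡ 0#

    -- The lines over ρ and ρ′ are cut into matching cells on which the polynomials in Ψ have the same constant signs.
    data Matching (Ψ : P → Set) : (lo lo′ hi hi′ : F) → Set where
      leaf : ∀ {lo lo′ hi hi′} → lo < hi → lo′ < hi′ →
        (∀ p → Ψ p → ∀ x x′ → lo < x → x < hi → lo′ < x′ → x′ < hi′ → Same p x x′) → Matching Ψ lo lo′ hi hi′
      node : ∀ {lo lo′ hi hi′} m m′ → Matching Ψ lo lo′ m m′ → (∀ p → Ψ p → Same p m m′) → RootOf Ψ m →
        Matching Ψ m m′ hi hi′ → Matching Ψ lo lo′ hi hi′

    Matching-⇔ : ∀ {Ψ Φ lo lo′ hi hi′} → (∀ p → Ψ p → Φ p) → (∀ p → Φ p → Ψ p) → Matching Ψ lo lo′ hi hi′ → Matching Φ lo lo′ hi hi′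
    Matching-⇔ to from (leaf l l′ same) = leaf l l′ (λ p Φp → same p (from p Φp))
    Matching-⇔ to from (node m m′ L same (b , q , Ψq , rest) R) =
      node m m′ (Matching-⇔ to from L) (λ p Φp → same p (from p Φp)) (b , q , to (b ∷ q) Ψq , rest) (Matching-⇔ to from R)

    lo<hi : ∀ {Ψ lo lo′ hi hi′} → Matching Ψ lo lo′ hi hi′ → lo < hi × lo′ < hi′
    lo<hi (leaf l l′ _) = l , l′
    lo<hi (node m m′ L _ _ R) = <-trans (proj₁ (lo<hi L)) (proj₁ (lo<hi R)) , <-trans (proj₂ (lo<hi L)) (proj₂ (lo<hi R))

    locate : ∀ {Ψ lo lo′ hi hi′} → Matching Ψ lo lo′ hi hi′ → ∀ x → lo < x → x < hi → ∃ λ x′ → ∀ p → Ψ p → Same p x x′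
    locate (leaf l l′ same) x lo<x x<hi = let x′ , lo′<x′ , x′<hi′ = between l′ in x′ , λ p Ψp → same p Ψp x x′ lo<x x<hi lo′<x′ x′<hi′
    locate (node m m′ L same _ R) x lo<x x<hi with compare x m
    ... | tri< x<m _ _  = locate L x lo<x x<m
    ... | tri≈ _ refl _ = m′ , same
    ... | tri> _ _ m<x  = locate R x m<x x<hi

    Adjoin : (P → Set) → P → P → Set
    Adjoin Ψ p q = Ψ q ⊎ q ≡ p

    module _ (Ψ : P → Set) (p : P) where

      determined-refine : (∀ x x′ → (∀ q → Ψ q → Same q x x′) → Same p x x′) →
        ∀ {lo lo′ hi hi′} → Matching Ψ lo lo′ hi hi′ → Matching (Adjoin Ψ p) lo lo′ hi hi′
      determined-refine det (leaf l l′ same) = leaf l l′ λ where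
        q (inj₁ Ψq)   → same q Ψq
        q (inj₂ refl) x x′ a b c d → det x x′ (λ r Ψr → same r Ψr x x′ a b c d)
      determined-refine det (node m m′ L same (b , q , Ψq , rest) R) = node m m′ (determined-refine det L)
        (λ { q (inj₁ Ψq) → same q Ψq ; q (inj₂ refl) → det m m′ same }) (b , q , inj₁ Ψq , rest) (determined-refine det R)

      module _ (at-root : ∀ m m′ → (∀ q → Ψ q → Same q m m′) → RootOf Ψ m → Same p m m′)
               (leading-root : ∀ m → eval (spec ρ p) m ≡ 0# → RootOf (Adjoin Ψ p) m)
               (splits : ∀ {lo lo′ hi hi′} → lo < hi → lo′ < hi′ →
                  (∀ q → Ψ q → ∀ x x′ → lo < x → x < hi → lo′ < x′ → x′ < hi′ → Same q x x′) →
                  Same p lo lo′ → Same p hi hi′ → Split (eval (spec ρ p)) (eval (spec ρ′ p)) lo lo′ hi hi′) where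

        -- At the old cut points the sign of `p` is settled by reduction modulo a root polynomial.
        -- This provides the signs at both ends of every leaf, where `p` then adds at most one cut
        -- point.
        refine : ∀ {lo lo′ hi hi′} → Same p lo lo′ → Same p hi hi′ → Matching Ψ lo lo′ hi hi′ → Matching (Adjoin Ψ p) lo lo′ hi hi′
        refine elo ehi (node m m′ L same root@(b , q , Ψq , rest) R) =
          node m m′ (refine elo same-p L) (λ { q (inj₁ Ψq) → same q Ψq ; q (inj₂ refl) → same-p }) (b , q , inj₁ Ψq , rest) (refine same-p ehi R)
          where same-p = at-root m m′ same root
        refine elo ehi (leaf l l′ same) with splits l l′ same elo ehi
        ... | unsplit s = leaf l l′ λ { q (inj₁ Ψq) → same q Ψq ; q (inj₂ refl) → s }
        ... | split z z′ lo<z z<hi lo′<z′ z′<hi′ fz f′z′ sl sr = node z z′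
                (leaf lo<z lo′<z′ λ { q (inj₁ Ψq) x x′ a b c d → same q Ψq x x′ a (<-trans b z<hi) c (<-trans d z′<hi′) ; q (inj₂ refl) → sl })
                (λ { q (inj₁ Ψq) → same q Ψq z z′ lo<z z<hi lo′<z′ z′<hi′ ; q (inj₂ refl) → trans (sgn-zero fz) (sym (sgn-zero f′z′)) })
                (leading-root z fz)
                (leaf z<hi z′<hi′ λ { q (inj₁ Ψq) x x′ a b c d → same q Ψq x x′ (<-trans lo<z a) b (<-trans lo′<z′ c) d ; q (inj₂ refl) → sr })

    SameCoefficients : P → Set
    SameCoefficients p = map sgn (spec ρ p) ≡ map sgn (spec ρ′ p)

    constant-same : ∀ a → sgn (ev a ρ) ≡ sgn (ev a ρ′) → ∀ x x′ → Same (a ∷ []) x x′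
    constant-same a e x x′ = trans (cong sgn (value (ev a ρ))) (trans e (cong sgn (sym (value (ev a ρ′)))))
      where
      value : ∀ a → a * 1# + 0# ≡ a
      value = solve 1 (λ a → a :* :1 :+ :0 := a) refl

    zero-head : ∀ {σ : W → F} a p → ev a σ ≡ 0# → ∀ x → eval (spec σ (a ∷ p)) x ≡ eval (spec σ p) x
    zero-head {σ} a p e x = trans (cong (λ z → z * pow x (length (spec σ p)) + eval (spec σ p) x) e)
      (solve 2 (λ y z → :0 :* y :+ z := z) refl (pow x (length (spec σ p))) (eval (spec σ p) x))

    -- At the roots, p times a power of the leading coefficient equals the pseudo-remainder. The
    -- sign of this power is nonzero and the same on both lines, so it cancels.
    remainder-same : ∀ p b q m m′ → SameCoefficients (b ∷ q) → ¬ ev b ρ ≡ 0# → eval (spec ρ (b ∷ q)) m ≡ 0# → eval (spec ρ′ (b ∷ q)) m′ ≡ 0# →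
      Same (rem p (b ∷ q)) m m′ → Same p m m′
    remainder-same p b q m m′ coeffs b≢0 root root′ same with remainder-at-root (length p) p b q
    ... | k , identity = ·ₛ-cancel (powₛ (sgn (ev b ρ)) k) (powₛ≢⊙ (sgn (ev b ρ)) (λ z → b≢0 (sgn⇒zero z)) k) (begin
      powₛ (sgn (ev b ρ)) k ·ₛ sgn (eval (spec ρ p) m)     ≡⟨ signs ρ m root ⟩
      sgn (eval (spec ρ (rem p (b ∷ q))) m)                ≡⟨ same ⟩
      sgn (eval (spec ρ′ (rem p (b ∷ q))) m′)              ≡⟨ sym (signs ρ′ m′ root′) ⟩
      powₛ (sgn (ev b ρ′)) k ·ₛ sgn (eval (spec ρ′ p) m′)  ≡⟨ cong (λ s → powₛ s k ·ₛ sgn (eval (spec ρ′ p) m′)) (sym (proj₁ (∷-injective coeffs))) ⟩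
      powₛ (sgn (ev b ρ)) k ·ₛ sgn (eval (spec ρ′ p) m′)   ∎)
      where
      open ≡-Reasoning
      signs : ∀ σ m → eval (spec σ (b ∷ q)) m ≡ 0# → powₛ (sgn (ev b σ)) k ·ₛ sgn (eval (spec σ p) m) ≡ sgn (eval (spec σ (rem p (b ∷ q))) m)
      signs σ m root = trans (cong (_·ₛ sgn (eval (spec σ p) m)) (sym (sgn-pow (ev b σ) k)))
        (trans (sym (sgn-* (pow (ev b σ) k) (eval (spec σ p) m))) (cong sgn (identity σ m root)))

    spec-der : ∀ (σ : W → F) p → HasDer (eval (spec σ p)) (eval (spec σ (derivative timesₑ p)))
    spec-der σ p = HasDer-cong (λ _ → refl) (λ x → cong (λ l → eval l x) (sym (spec-derivative σ p))) (eval-der (spec σ p))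

    module _ {p : P} {lo lo′ hi hi′ : F} (l : lo < hi) (l′ : lo′ < hi′)
             (same : ∀ x x′ → lo < x → x < hi → lo′ < x′ → x′ < hi′ → Same (derivative timesₑ p) x x′)
             (nonvanish : ∃ λ x → lo < x × x < hi × ¬ eval (spec ρ (derivative timesₑ p)) x ≡ 0#) where
      private
        p′ : P
        p′ = derivative timesₑ p
        f g Df Dg : F → F
        f = eval (spec ρ p)
        g = eval (spec ρ′ p)
        Df = eval (spec ρ p′)
        Dg = eval (spec ρ′ p′)

      abstract
        -- The derivative has one and the same nonzero sign on both intervals. If it is negative,
        -- both polynomials are negated.
        monotone-split : Same p lo lo′ → Same p hi hi′ → Split f g lo lo′ hi hi′
        monotone-split elo ehi = by-sign nonvanish (between l′)
          where
          by-sign : (∃ λ x → lo < x × x < hi × ¬ Df x ≡ 0#) → (∃ λ x′ → lo′ < x′ × x′ < hi′) → Split f g lo lo′ hi hi′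
          by-sign (m , lo<m , m<hi , Dfm≢0) (m′ , lo′<m′ , m′<hi′) = direction (compare (Dg m′) 0#)
            where
            Df-sign : ∀ x → lo < x → x < hi → sgn (Df x) ≡ sgn (Dg m′)
            Df-sign x a b = same x m′ a b lo′<m′ m′<hi′
            Dg-sign : ∀ x → lo′ < x → x < hi′ → sgn (Dg x) ≡ sgn (Dg m′)
            Dg-sign x a b = trans (sym (same m x lo<m m<hi a b)) (same m m′ lo<m m<hi lo′<m′ m′<hi′)
            direction : Tri (Dg m′ < 0#) (Dg m′ ≡ 0#) (0# < Dg m′) → Split f g lo lo′ hi hi′
            direction (tri≈ _ z _) = ⊥-elim (Dfm≢0 (sgn⇒zero (trans (Df-sign m lo<m m<hi) (sgn-zero z))))
            direction (tri> _ _ pos) = split-increasing (eval-poly (spec ρ p)) (eval-poly (spec ρ′ p)) l l′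
              (λ x y a x<y b → increasing (spec-der ρ p) x<y (λ z x<z z<y → sgn⇒pos (trans (Df-sign z (≤-<-trans a x<z) (<-≤-trans z<y b)) (sgn-pos pos))))
              (λ x y a x<y b → increasing (spec-der ρ′ p) x<y (λ z x<z z<y → sgn⇒pos (trans (Dg-sign z (≤-<-trans a x<z) (<-≤-trans z<y b)) (sgn-pos pos))))
              elo ehi
            direction (tri< neg′ _ _) = Split-neg (split-increasing (neg-poly (eval-poly (spec ρ p))) (neg-poly (eval-poly (spec ρ′ p))) l l′
              (λ x y a x<y b → increasing (neg-der (spec-der ρ p)) x<y (λ z x<z z<y → neg-pos (sgn⇒neg (trans (Df-sign z (≤-<-trans a x<z) (<-≤-trans z<y b)) (sgn-neg neg′)))))
              (λ x y a x<y b → increasing (neg-der (spec-der ρ′ p)) x<y (λ z x<z z<y → neg-pos (sgn⇒neg (trans (Dg-sign z (≤-<-trans a x<z) (<-≤-trans z<y b)) (sgn-neg neg′)))))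
              (opposite elo) (opposite ehi))
              where
              opposite : ∀ {x y} → sgn x ≡ sgn y → sgn (- x) ≡ sgn (- y)
              opposite {x} {y} e = trans (sgn-opp x) (trans (cong (⊖ ·ₛ_) e) (sym (sgn-opp y)))

    abstract
      nonzero-somewhere : ∀ a p → ¬ a ≡ 0# → ∀ {lo hi} → lo < hi → ∃ λ x → lo < x × x < hi × ¬ eval (a ∷ p) x ≡ 0#
      nonzero-somewhere a p a≢0 {lo} {hi} l with roots-list (length p) a p ℕₚ.≤-refl a≢0
      ... | rs , all with avoid-all (right-germ lo hi l) rs
      ...   | _ , e , (refl , lo<e , e≤hi) , out = let x , lo<x , x<e = between lo<e in
              x , lo<x , <-≤-trans x<e e≤hi , λ z → out x lo<x x<e (all x z)

    -- Constants, and polynomials whose leading coefficient vanishes, get their signs from the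
    -- coefficients or from the rest; all others are monotone on each leaf. The alternative `p ≡ []`
    -- is there because `ClosedAbove 0` says nothing of empty lists.
    adjoin : ∀ (Ψ : P → Set) p → SameCoefficients p → (∀ q → Ψ q → SameCoefficients q) →
      (∀ r → r ∈ rest p ∷ derivative timesₑ p ∷ [] → p ≡ [] ⊎ Ψ r) → (∀ b q → Ψ (b ∷ q) → p ≡ [] ⊎ Ψ (rem p (b ∷ q))) →
      ∀ {lo lo′ hi hi′} → Same p lo lo′ → Same p hi hi′ → Matching Ψ lo lo′ hi hi′ → Matching (Adjoin Ψ p) lo lo′ hi hi′
    adjoin Ψ []          coeffs coeffsΨ simpler rems elo ehi = determined-refine Ψ [] (λ _ _ _ → refl)
    adjoin Ψ (a ∷ [])    coeffs coeffsΨ simpler rems elo ehi = determined-refine Ψ (a ∷ []) (λ x x′ _ → constant-same a (proj₁ (∷-injective coeffs)) x x′)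
    adjoin Ψ (a ∷ b ∷ p) coeffs coeffsΨ simpler rems elo ehi with em {ev a ρ ≡ 0#}
    ... | yes a≡0 = determined-refine Ψ (a ∷ b ∷ p) (λ x x′ same →
            trans (cong sgn (zero-head a (b ∷ p) a≡0 x))
              (trans (same (b ∷ p) (unless (simpler (b ∷ p) (here refl))))
                (cong sgn (sym (zero-head a (b ∷ p) (sgn⇒zero (trans (sym (proj₁ (∷-injective coeffs))) (sgn-zero a≡0))) x′)))))
      where
      unless : ∀ {A : Set} → (a ∷ b ∷ p) ≡ [] ⊎ A → A
      unless (inj₁ ())
      unless (inj₂ x) = x
    ... | no a≢0 = refine Ψ (a ∷ b ∷ p)
            (λ { m m′ same (c , q , Ψq , c≢0 , root) →
               remainder-same (a ∷ b ∷ p) c q m m′ (coeffsΨ (c ∷ q) Ψq) c≢0 root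
                 (sgn⇒zero (trans (sym (same (c ∷ q) Ψq)) (sgn-zero root))) (same _ (unless (rems c q Ψq))) })
            (λ m root → a , b ∷ p , inj₂ refl , a≢0 , root)
            (λ l l′ same elo ehi → monotone-split {p = a ∷ b ∷ p} l l′ (same _ (unless (simpler _ (there (here refl)))))
               -- The leading coefficient of the derivative is the degree times `a`, which is
               -- nonzero in an ordered field.
               (nonzero-somewhere (ev (timesₑ (suc (length p)) a) ρ) (spec ρ (derivative timesₑ (b ∷ p))) (λ z → times≢0 (length p) a≢0 (trans (sym (ev-times (suc (length p)) a ρ)) z)) l) elo ehi)
            elo ehi
      where
      unless : ∀ {A : Set} → (a ∷ b ∷ p) ≡ [] ⊎ A → A
      unless (inj₁ ())
      unless (inj₂ x) = x

    module _ (C : List P) (closed : ClosedAbove 0 C) (coeffs : ∀ p → p ∈ C → SameCoefficients p)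
             {lo lo′ hi hi′ : F} (l : lo < hi) (l′ : lo′ < hi′)
             (elo : ∀ p → p ∈ C → Same p lo lo′) (ehi : ∀ p → p ∈ C → Same p hi hi′) where

      -- All members of `C` of length at most `j`, and those of length `suc j` that have been
      -- treated so far, which lie in `ps`.
      UpTo : ℕ → List P → P → Set
      UpTo j ps q = q ∈ C × (length q ℕ.≤ j ⊎ (q ∈ ps × length q ℕ.≤ suc j))

      -- For `p` of length at most `suc j`, the rest and the derivative have length at most `j`. So
      -- has the remainder modulo `b ∷ q`, as it is no longer than `q`. All of them are therefore
      -- present already.
      add-all : ∀ j ps → ps ⊆ C → Matching (UpTo j []) lo lo′ hi hi′ → Matching (UpTo j ps) lo lo′ hi hi′
      add-all j []       sub M = M
      add-all j (p ∷ ps) sub M with add-all j ps (λ q∈ → sub (there q∈)) M | length p ℕ.≤? suc j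
      ... | M′ | no long = Matching-⇔
            (λ { q (q∈C , inj₁ short) → q∈C , inj₁ short ; q (q∈C , inj₂ (q∈ , s)) → q∈C , inj₂ (there q∈ , s) })
            (λ { q (q∈C , inj₁ short) → q∈C , inj₁ short ; q (q∈C , inj₂ (here refl , s)) → ⊥-elim (long s) ; q (q∈C , inj₂ (there q∈ , s)) → q∈C , inj₂ (q∈ , s) })
            M′
      ... | M′ | yes p≤ = Matching-⇔
            (λ { q (inj₁ (q∈C , inj₁ short)) → q∈C , inj₁ short ; q (inj₁ (q∈C , inj₂ (q∈ , s))) → q∈C , inj₂ (there q∈ , s)
               ; q (inj₂ refl) → p∈C , inj₂ (here refl , p≤) })
            (λ { q (q∈C , inj₁ short) → inj₁ (q∈C , inj₁ short) ; q (q∈C , inj₂ (here refl , s)) → inj₂ refl ; q (q∈C , inj₂ (there q∈ , s)) → inj₁ (q∈C , inj₂ (q∈ , s)) })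
            (adjoin (UpTo j ps) p (coeffs p p∈C) (λ q Ψq → coeffs q (proj₁ Ψq)) (simpler p p∈C p≤) (rems p p∈C) (elo p p∈C) (ehi p p∈C) M′)
        where
        p∈C : p ∈ C
        p∈C = sub (here refl)
        simpler : ∀ p → p ∈ C → length p ℕ.≤ suc j → ∀ r → r ∈ rest p ∷ derivative timesₑ p ∷ [] → p ≡ [] ⊎ UpTo j ps r
        simpler []      p∈ _  r r∈ = inj₁ refl
        simpler (a ∷ p) p∈ p≤ r (here refl) = inj₂ (closed (a ∷ p) (a ∷ p) p∈ p∈ (ℕ.s≤s ℕ.z≤n) (ℕ.s≤s ℕ.z≤n) r (here refl) , inj₁ (ℕₚ.≤-pred p≤))
        simpler (a ∷ p) p∈ p≤ r (there (here refl)) = inj₂ (closed (a ∷ p) (a ∷ p) p∈ p∈ (ℕ.s≤s ℕ.z≤n) (ℕ.s≤s ℕ.z≤n) r (there (here refl)) ,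
          inj₁ (subst (ℕ._≤ j) (sym (length-derivative timesₑ a p)) (ℕₚ.≤-pred p≤)))
        rems : ∀ p → p ∈ C → ∀ b q → UpTo j ps (b ∷ q) → p ≡ [] ⊎ UpTo j ps (rem p (b ∷ q))
        rems []      p∈ b q _ = inj₁ refl
        rems (a ∷ p) p∈ b q (q∈ , size) = inj₂ (closed (a ∷ p) (b ∷ q) p∈ q∈ (ℕ.s≤s ℕ.z≤n) (ℕ.s≤s ℕ.z≤n) _ (there (there (here refl))) ,
          inj₁ (ℕₚ.≤-trans (length-remainder (length (a ∷ p)) (a ∷ p) b q ℕₚ.≤-refl) (ℕₚ.≤-pred ([ ℕₚ.m≤n⇒m≤1+n , proj₂ ]′ size))))

      matching : ∀ j → Matching (UpTo j []) lo lo′ hi hi′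
      matching zero    = leaf l l′ λ { [] _ _ _ _ _ _ _ → refl ; (_ ∷ _) (_ , inj₁ ()) ; (_ ∷ _) (_ , inj₂ (() , _)) }
      matching (suc j) = Matching-⇔
        (λ { q (q∈C , inj₁ s) → q∈C , inj₁ (ℕₚ.m≤n⇒m≤1+n s) ; q (q∈C , inj₂ (_ , s)) → q∈C , inj₁ s })
        (λ { q (q∈C , inj₁ s) → q∈C , inj₂ (q∈C , s) ; q (q∈C , inj₂ (() , _)) })
        (add-all j C (λ q∈ → q∈) (matching j))

    Bounded : List P → F → Set
    Bounded C B = ∀ (σ : P → List F) → (σ ≡ spec ρ ⊎ σ ≡ spec ρ′) → ∀ p → p ∈ C → ∀ x → B ≤ x →
        sgn (eval (σ p) x) ≡ leading (map sgn (σ p)) × sgn (eval (σ p) (- x)) ≡ leading (map sgn (flip (σ p)))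

    abstract
      bounds : ∀ C → ∃ (Bounded C)
      bounds C = join (single (spec ρ) C) (single (spec ρ′) C)
        where
        One : (P → List F) → List P → F → Set
        One σ C B = ∀ p → p ∈ C → ∀ x → B ≤ x → sgn (eval (σ p) x) ≡ leading (map sgn (σ p)) × sgn (eval (σ p) (- x)) ≡ leading (map sgn (flip (σ p)))
        single : ∀ σ C → ∃ λ B → One σ C B
        single σ []      = 0# , λ _ ()
        single σ (p ∷ C) with eventual-sign (σ p) | eventual-sign (flip (σ p)) | single σ C
        ... | B₁ , e₁ | B₂ , e₂ | B₃ , e₃ with <-max B₁ B₂
        ...   | M , B₁≤M , B₂≤M with <-max M B₃
        ...     | N , M≤N , B₃≤N = N , λ where
                  _ (here refl) x N≤x → e₁ x (≤-trans (≤-trans B₁≤M M≤N) N≤x) ,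
                    trans (cong sgn (sym (eval-flip (σ p) x))) (e₂ x (≤-trans (≤-trans B₂≤M M≤N) N≤x))
                  q (there q∈) x N≤x → e₃ q q∈ x (≤-trans B₃≤N N≤x)
        join : (∃ λ B → One (spec ρ) C B) → (∃ λ B → One (spec ρ′) C B) → ∃ (Bounded C)
        join (B , e) (B′ , e′) with <-max B B′
        ... | M , B≤M , B′≤M = M , λ where
              _ (inj₁ refl) p p∈ x M≤x → e p p∈ x (≤-trans B≤M M≤x)
              _ (inj₂ refl) p p∈ x M≤x → e′ p p∈ x (≤-trans B′≤M M≤x)

      -- Beyond a common bound B the signs on both lines are read off the coefficients. So ± B are
      -- partners for all points outside, and ends for the matching that serves the points between
      -- them.
      transfer-point : ∀ C → ClosedAbove 0 C → (∀ p → p ∈ C → SameCoefficients p) → ∀ x → ∃ λ x′ → ∀ p → p ∈ C → Same p x x′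
      transfer-point C closed coeffs x = by-bound (bounds C)
        where
        by-bound : ∃ (Bounded C) → ∃ λ x′ → ∀ p → p ∈ C → Same p x x′
        by-bound (B₀ , large) = positioned (<⊎≥ x B) (<⊎≥ (- B) x)
          where
          -- The bound is raised to at least 1 so that - B < B.
          B : F
          B = proj₁ (<-max B₀ 1#)
          B₀≤B : B₀ ≤ B
          B₀≤B = proj₁ (proj₂ (<-max B₀ 1#))
          0<B : 0# < B
          0<B = <-≤-trans 0<1 (proj₂ (proj₂ (<-max B₀ 1#)))
          far : ∀ x x′ → B₀ ≤ x → B₀ ≤ x′ → ∀ p → p ∈ C → Same p x x′
          far x x′ a b p p∈ = trans (proj₁ (large (spec ρ) (inj₁ refl) p p∈ x a))
            (trans (cong leading (coeffs p p∈)) (sym (proj₁ (large (spec ρ′) (inj₂ refl) p p∈ x′ b))))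
          far⁻ : ∀ x x′ → B₀ ≤ x → B₀ ≤ x′ → ∀ p → p ∈ C → Same p (- x) (- x′)
          far⁻ x x′ a b p p∈ = trans (proj₂ (large (spec ρ) (inj₁ refl) p p∈ x a))
            (trans (cong leading (flip-signs (spec ρ p) (spec ρ′ p) (coeffs p p∈))) (sym (proj₂ (large (spec ρ′) (inj₂ refl) p p∈ x′ b))))
          -B<B : - B < B
          -B<B = <-trans (neg-neg 0<B) 0<B
          positioned : x < B ⊎ B ≤ x → - B < x ⊎ x ≤ - B → ∃ λ x′ → ∀ p → p ∈ C → Same p x x′
          positioned (inj₂ B≤x) _ = B , far x B (≤-trans B₀≤B B≤x) B₀≤B
          positioned (inj₁ _) (inj₂ x≤-B) = - B , λ p p∈ → subst (λ z → Same p z (- B)) (-‿involutive x)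
            (far⁻ (- x) B (≤-trans B₀≤B (flipped x≤-B)) B₀≤B p p∈)
            where
            flipped : x ≤ - B → B ≤ - x
            flipped (inj₁ lt) = inj₁ (subst (_< - x) (-‿involutive B) (neg-mono-< lt))
            flipped (inj₂ e)  = inj₂ (trans (sym (-‿involutive B)) (cong -_ (sym e)))
          positioned (inj₁ x<B) (inj₁ -B<x) =
            let j , bound = length-bound C
                x′ , same = locate (matching C closed coeffs -B<B -B<B (far⁻ B B B₀≤B B₀≤B) (far B B B₀≤B B₀≤B) j) x -B<x x<B
            in x′ , λ p p∈ → same p (p∈ , inj₁ (bound p p∈))

-- Predicates decided by finitely many signs, and Dedekind cuts

module DeterminedPredicates (em : ExcludedMiddle 0ℓ) (𝓕 : RealClosedField) where

  open Basics em 𝓕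
  open Order em 𝓕
  open Factorisation em 𝓕
  open PolynomialFunctions em 𝓕
  open PseudoRemainders em 𝓕
  open Matchings em 𝓕

  Agree : ∀ {n} → List (Ex (Fin n)) → (Fin n → F) → (Fin n → F) → Set
  Agree T ρ ρ′ = ∀ e → e ∈ T → sgn (ev e ρ) ≡ sgn (ev e ρ′)

  Agree-sym : ∀ {n} {T : List (Ex (Fin n))} {ρ ρ′} → Agree T ρ ρ′ → Agree T ρ′ ρ
  Agree-sym agree e e∈ = sym (agree e e∈)

  first : ∀ {n} → Fin (suc n) → Maybe (Fin n)
  first Fin.zero    = nothing
  first (Fin.suc i) = just i

  abstract
    -- Back and forth: agreement on finitely many signs extends along one more coordinate.
    extension : ∀ {n} (T : List (Ex (Fin (suc n)))) → ∃ λ T′ → ∀ ρ ρ′ → Agree T′ ρ ρ′ →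
      ∀ x → ∃ λ x′ → Agree T (x VF.∷ ρ) (x′ VF.∷ ρ′)
    extension {n} T = concat C , λ ρ ρ′ agree x →
      let x′ , same = Lines.transfer-point ρ ρ′ C (proj₂ (proj₂ closing)) (λ p p∈ → same-signs p (λ e e∈ → agree e (∈-concat⁺′ e∈ p∈))) x
      in x′ , λ e e∈ → trans (cong sgn (sym (value ρ x e)))
          (trans (same (coefficients first e) (proj₁ (proj₂ closing) (∈-map⁺ (coefficients first) e∈))) (cong sgn (value ρ′ x′ e)))
      where
      closing : ∃ λ C → map (coefficients first) T ⊆ C × ClosedAbove 0 C
      closing = closure (map (coefficients first) T)
      C : List (List (Ex (Fin n)))
      C = proj₁ closing
      same-signs : ∀ {ρ ρ′ : Fin n → F} p → (∀ e → e ∈ p → sgn (ev e ρ) ≡ sgn (ev e ρ′)) → map sgn (spec ρ p) ≡ map sgn (spec ρ′ p)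
      same-signs []      _     = refl
      same-signs (a ∷ p) agree = cong₂ _∷_ (agree a (here refl)) (same-signs p (λ e e∈ → agree e (there e∈)))
      value : ∀ (ρ : Fin n → F) x e → eval (spec ρ (coefficients first e)) x ≡ ev e (x VF.∷ ρ)
      value ρ x e = trans (eval-coefficients first ρ x e) (ev-cong e λ { Fin.zero → refl ; (Fin.suc i) → refl })

  -- Takes the place of equivalence to a quantifier-free formula: the signs of the tests decide `S`,
  -- but no formula is written down.
  record Determined {n} (S : (Fin n → F) → Set) : Set where
    field
      tests     : List (Ex (Fin n))
      invariant : ∀ ρ ρ′ → Agree tests ρ ρ′ → S ρ → S ρ′
  open Determined

  module _ {n} {S S′ : (Fin n → F) → Set} (D : Determined S) (D′ : Determined S′) where
    private
      left : ∀ {ρ ρ′} → Agree (tests D ++ tests D′) ρ ρ′ → Agree (tests D) ρ ρ′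
      left agree e e∈ = agree e (∈-++⁺ˡ e∈)
      right : ∀ {ρ ρ′} → Agree (tests D ++ tests D′) ρ ρ′ → Agree (tests D′) ρ ρ′
      right agree e e∈ = agree e (∈-++⁺ʳ (tests D) e∈)

    determined-× : Determined (λ ρ → S ρ × S′ ρ)
    determined-× = record
      { tests = tests D ++ tests D′
      ; invariant = λ ρ ρ′ agree (s , s′) → invariant D ρ ρ′ (left agree) s , invariant D′ ρ ρ′ (right agree) s′ }

    determined-→ : Determined (λ ρ → S ρ → S′ ρ)
    determined-→ = record
      { tests = tests D ++ tests D′
      ; invariant = λ ρ ρ′ agree f s → invariant D′ ρ ρ′ (right agree) (f (invariant D ρ′ ρ (Agree-sym {T = tests D} (left agree)) s)) }

  determined-⊥ : ∀ {n} → Determined {n} (λ _ → ⊥)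
  determined-⊥ = record { tests = [] ; invariant = λ _ _ _ b → b }

  module _ {n} {S : (Fin (suc n) → F) → Set} (D : Determined S) where
    determined-∃ : Determined (λ ρ → Σ F λ x → S (x VF.∷ ρ))
    determined-∃ = record
      { tests = proj₁ (extension (tests D))
      ; invariant = λ ρ ρ′ agree (x , s) → let x′ , agree′ = proj₂ (extension (tests D)) ρ ρ′ agree x in x′ , invariant D _ _ agree′ s }

    -- A point `x` over `ρ′` is carried back to a point over `ρ`, where the assumption applies.
    determined-∀ : Determined (λ ρ → ∀ x → S (x VF.∷ ρ))
    determined-∀ = record
      { tests = proj₁ (extension (tests D))
      ; invariant = λ ρ ρ′ agree f x →
          let x′ , agree′ = proj₂ (extension (tests D)) ρ′ ρ (Agree-sym {T = proj₁ (extension (tests D))} agree) x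
          in invariant D _ _ (Agree-sym {T = tests D} agree′) (f x′) }

  module _ {n} (d e : Ex (Fin n)) where
    private
      difference : ∀ {ρ ρ′} → Agree (d ∔ ⁻ e ∷ []) ρ ρ′ → sgn (ev d ρ - ev e ρ) ≡ sgn (ev d ρ′ - ev e ρ′)
      difference agree = agree (d ∔ ⁻ e) (here refl)

    determined-≡ : Determined (λ ρ → ev d ρ ≡ ev e ρ)
    determined-≡ = record
      { tests = d ∔ ⁻ e ∷ []
      ; invariant = λ ρ ρ′ agree s → x-y≡0⇒x≡y (sgn⇒zero (trans (sym (difference agree))
          (sgn-zero (trans (cong (_- ev e ρ) s) (-‿inverseʳ (ev e ρ)))))) }

    determined-< : Determined (λ ρ → ev d ρ < ev e ρ)
    determined-< = record
      { tests = d ∔ ⁻ e ∷ []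
      ; invariant = λ ρ ρ′ agree s → <-by (- (ev d ρ′ - ev e ρ′))
          (neg-pos (sgn⇒neg (trans (sym (difference agree)) (sgn-neg (<-by (ev e ρ - ev d ρ) (0<-diff s)
            (solve 2 (λ x y → :0 := x :- y :+ (y :- x)) refl (ev d ρ) (ev e ρ)))))))
          (solve 2 (λ x y → y := x :+ :- (x :- y)) refl (ev d ρ′) (ev e ρ′)) }

  determined-cong : ∀ {n} {S S′ : (Fin n → F) → Set} → (∀ ρ → S ρ → S′ ρ) → (∀ ρ → S′ ρ → S ρ) → Determined S → Determined S′
  determined-cong to from D = record { tests = tests D ; invariant = λ ρ ρ′ agree s → to ρ′ (invariant D ρ ρ′ agree (from ρ s)) }

  expression : ∀ {n} → Term n → Ex (Fin n)
  expression (var i)    = at i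
  expression zer        = 𝟎
  expression one        = 𝟏
  expression (plus s t) = expression s ∔ expression t
  expression (mult s t) = expression s ∙ expression t

  ev-expression : ∀ {n} (t : Term n) ρ → ev (expression t) ρ ≡ evalT 𝓕 t ρ
  ev-expression (var i)    ρ = refl
  ev-expression zer        ρ = refl
  ev-expression one        ρ = refl
  ev-expression (plus s t) ρ = cong₂ _+_ (ev-expression s ρ) (ev-expression t ρ)
  ev-expression (mult s t) ρ = cong₂ _*_ (ev-expression s ρ) (ev-expression t ρ)

  determined-Sat : ∀ {n} (φ : Formula n) → Determined (Sat 𝓕 φ)
  determined-Sat (eq s t)   = determined-cong
    (λ ρ e → trans (sym (ev-expression s ρ)) (trans e (ev-expression t ρ)))
    (λ ρ e → trans (ev-expression s ρ) (trans e (sym (ev-expression t ρ))))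
    (determined-≡ (expression s) (expression t))
  determined-Sat (less s t) = determined-cong
    (λ ρ → subst₂ _<_ (ev-expression s ρ) (ev-expression t ρ))
    (λ ρ → subst₂ _<_ (sym (ev-expression s ρ)) (sym (ev-expression t ρ)))
    (determined-< (expression s) (expression t))
  determined-Sat (neg φ)    = determined-→ (determined-Sat φ) determined-⊥
  determined-Sat (conj φ ψ) = determined-× (determined-Sat φ) (determined-Sat ψ)
  determined-Sat (ex φ)     = determined-∃ (determined-Sat φ)

  record DedekindCut (C : F → Set) : Set where
    field
      lower    : F
      upper    : F
      lower∈   : C lower
      upper∉   : ¬ C upper
      down     : ∀ {x y} → y < x → C x → C y
      no-max   : ∀ {x} → C x → ∃ λ y → C y × x < y
      no-min   : ∀ {x} → ¬ C x → ∃ λ y → ¬ C y × y < x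

    separated : ∀ {x y} → C x → ¬ C y → x < y
    separated {x} {y} Cx ¬Cy with compare x y
    ... | tri< x<y _ _  = x<y
    ... | tri≈ _ refl _ = ⊥-elim (¬Cy Cx)
    ... | tri> _ _ y<x  = ⊥-elim (¬Cy (down y<x Cx))

    larger : ∀ {x y} → C x → C y → ∃ λ z → C z × x < z × y < z
    larger {x} {y} Cx Cy with max x y
    ... | m , x≤m , y≤m , inj₁ refl = let z , Cz , m<z = no-max Cx in z , Cz , ≤-<-trans x≤m m<z , ≤-<-trans y≤m m<z
    ... | m , x≤m , y≤m , inj₂ refl = let z , Cz , m<z = no-max Cy in z , Cz , ≤-<-trans x≤m m<z , ≤-<-trans y≤m m<z

    germ : Germ (λ d e → C d × ¬ C e)
    germ = record
      { nonempty = λ (Cd , ¬Ce) → separated Cd ¬Ce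
      ; meet = λ {d} {e} {d′} {e′} (Cd , ¬Ce) (Cd′ , ¬Ce′) →
          let m , d≤m , d′≤m , which = max d d′
              n , n≤e , n≤e′ , which′ = min e e′
          in m , n , ([ (λ m≡d → subst C (sym m≡d) Cd) , (λ m≡d′ → subst C (sym m≡d′) Cd′) ]′ which ,
                      [ (λ n≡e → subst (λ z → ¬ C z) (sym n≡e) ¬Ce) , (λ n≡e′ → subst (λ z → ¬ C z) (sym n≡e′) ¬Ce′) ]′ which′) ,
             d≤m , d′≤m , n≤e , n≤e′
      ; avoid = avoiding }
      where
      avoiding : ∀ r → ∃ λ d → ∃ λ e → (C d × ¬ C e) × ¬ (d < r × r < e)
      avoiding r with em {C r}
      ... | yes Cr = let y , Cy , r<y = no-max Cr in y , upper , (Cy , upper∉) , λ (y<r , _) → <-irrefl (<-trans y<r r<y)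
      ... | no ¬Cr = let y , ¬Cy , y<r = no-min ¬Cr in lower , y , (lower∈ , ¬Cy) , λ (_ , r<y) → <-irrefl (<-trans y<r r<y)

    abstract
      -- o-minimality at a Dedekind cut
      constant-near : ∀ {n} {S : (Fin (suc n) → F) → Set} → Determined S → ∀ ρ → ∃ λ d → ∃ λ e → C d × ¬ C e ×
        ∀ x y → d < x → x < e → d < y → y < e → S (x VF.∷ ρ) → S (y VF.∷ ρ)
      constant-near D ρ =
        let d , e , (Cd , ¬Ce) , con = constant-signs germ (λ i x → ev i (x VF.∷ ρ))
              (λ i → ev-poly i (λ x → x VF.∷ ρ) λ { Fin.zero → id-poly ; (Fin.suc j) → const-poly (ρ j) }) (tests D)
        in d , e , Cd , ¬Ce , λ x y d<x x<e d<y y<e → invariant D _ _ (con x y d<x x<e d<y y<e)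

-- Polynomials in two variables near a pair of cuts

module Crossings (em : ExcludedMiddle 0ℓ) (𝓕 : RealClosedField) where

  open Basics em 𝓕
  open Order em 𝓕
  open PolynomialFunctions em 𝓕
  open DeterminedPredicates em 𝓕

  ∂ : ∀ {V} → (V → Bool) → Ex V → Ex V
  ∂ δ (at v) with δ v
  ... | true  = 𝟏
  ... | false = 𝟎
  ∂ δ 𝟎       = 𝟎
  ∂ δ 𝟏       = 𝟎
  ∂ δ (d ∔ e) = ∂ δ d ∔ ∂ δ e
  ∂ δ (d ∙ e) = ∂ δ d ∙ e ∔ d ∙ ∂ δ e
  ∂ δ (⁻ e)   = ⁻ ∂ δ e

  ∂-der : ∀ {V} (δ : V → Bool) (σ : F → V → F) → (∀ v → HasDer (λ x → σ x v) (λ x → ev (∂ δ (at v)) (σ x))) →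
    ∀ e → HasDer (λ x → ev e (σ x)) (λ x → ev (∂ δ e) (σ x))
  ∂-der δ σ H (at v)  = H v
  ∂-der δ σ H 𝟎       = const-der 0#
  ∂-der δ σ H 𝟏       = const-der 1#
  ∂-der δ σ H (d ∔ e) = +-der (∂-der δ σ H d) (∂-der δ σ H e)
  ∂-der δ σ H (d ∙ e) = *-der (∂-der δ σ H d) (∂-der δ σ H e)
  ∂-der δ σ H (⁻ e)   = neg-der (∂-der δ σ H e)

  -- One more than the degree, with 0 reserved for (formally) zero expressions.
  size-product : ℕ → ℕ → ℕ
  size-product zero    _       = 0
  size-product (suc _) zero    = 0
  size-product (suc m) (suc n) = suc (m ℕ.+ n)

  size : ∀ {V} → Ex V → ℕ
  size (at v)  = 2
  size 𝟎       = 0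
  size 𝟏       = 1
  size (d ∔ e) = size d ℕ.⊔ size e
  size (d ∙ e) = size-product (size d) (size e)
  size (⁻ e)   = size e

  size-0 : ∀ {V} (e : Ex V) → size e ℕ.≤ 0 → ∀ ρ → ev e ρ ≡ 0#
  size-0 (at v)  () ρ
  size-0 𝟎       _ ρ = refl
  size-0 𝟏       () ρ
  size-0 (d ∔ e) s ρ = trans (cong₂ _+_ (size-0 d (ℕₚ.≤-trans (ℕₚ.m≤m⊔n (size d) (size e)) s) ρ)
    (size-0 e (ℕₚ.≤-trans (ℕₚ.m≤n⊔m (size d) (size e)) s) ρ)) (+-identityˡ 0#)
  size-0 (d ∙ e) s ρ with size d in sd | size e in se
  ... | zero  | _     = trans (cong (_* ev e ρ) (size-0 d (ℕₚ.≤-reflexive sd) ρ)) (zeroˡ (ev e ρ))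
  ... | suc _ | zero  = trans (cong (ev d ρ *_) (size-0 e (ℕₚ.≤-reflexive se) ρ)) (zeroʳ (ev d ρ))
  size-0 (d ∙ e) () ρ | suc _ | suc _
  size-0 (⁻ e)   s ρ = trans (cong -_ (size-0 e s ρ)) (solve 0 (:- :0 := :0) refl)

  size-product-predˡ : ∀ m′ m n → m′ ℕ.≤ ℕ.pred m → size-product m′ n ℕ.≤ ℕ.pred (size-product m n)
  size-product-predˡ zero     m             n       _ = ℕ.z≤n
  size-product-predˡ (suc m′) (suc m)       zero    _ = ℕ.z≤n
  size-product-predˡ (suc m′) (suc m)       (suc n) p = ℕₚ.+-monoˡ-≤ n p

  size-product-predʳ : ∀ m n′ n → n′ ℕ.≤ ℕ.pred n → size-product m n′ ℕ.≤ ℕ.pred (size-product m n)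
  size-product-predʳ zero    n′       n       _ = ℕ.z≤n
  size-product-predʳ (suc m) zero     n       _ = ℕ.z≤n
  size-product-predʳ (suc m) (suc n′) (suc n) p = ℕₚ.≤-trans (ℕₚ.≤-reflexive (sym (ℕₚ.+-suc m n′))) (ℕₚ.+-monoʳ-≤ m p)

  size-∂ : ∀ {V} (δ : V → Bool) (e : Ex V) → size (∂ δ e) ℕ.≤ ℕ.pred (size e)
  size-∂ δ (at v) with δ v
  ... | true  = ℕₚ.≤-refl
  ... | false = ℕ.z≤n
  size-∂ δ 𝟎       = ℕₚ.≤-refl
  size-∂ δ 𝟏       = ℕₚ.≤-refl
  size-∂ δ (d ∔ e) = ℕₚ.⊔-lub
    (ℕₚ.≤-trans (size-∂ δ d) (ℕₚ.pred-mono-≤ (ℕₚ.m≤m⊔n (size d) (size e))))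
    (ℕₚ.≤-trans (size-∂ δ e) (ℕₚ.pred-mono-≤ (ℕₚ.m≤n⊔m (size d) (size e))))
  size-∂ δ (d ∙ e) = ℕₚ.⊔-lub
    (size-product-predˡ (size (∂ δ d)) (size d) (size e) (size-∂ δ d))
    (size-product-predʳ (size d) (size (∂ δ e)) (size e) (size-∂ δ e))
  size-∂ δ (⁻ e)   = size-∂ δ e

  -- Terms have neither subtraction nor negation, so an expression becomes a difference of two terms.
  positive-part negative-part : ∀ {V n} → (V → Fin n) → Ex V → Term n
  positive-part i (at v)  = var (i v)
  positive-part i 𝟎       = zer
  positive-part i 𝟏       = one
  positive-part i (d ∔ e) = plus (positive-part i d) (positive-part i e)
  positive-part i (d ∙ e) = plus (mult (positive-part i d) (positive-part i e)) (mult (negative-part i d) (negative-part i e))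
  positive-part i (⁻ e)   = negative-part i e
  negative-part i (at v)  = zer
  negative-part i 𝟎       = zer
  negative-part i 𝟏       = zer
  negative-part i (d ∔ e) = plus (negative-part i d) (negative-part i e)
  negative-part i (d ∙ e) = plus (mult (positive-part i d) (negative-part i e)) (mult (negative-part i d) (positive-part i e))
  negative-part i (⁻ e)   = positive-part i e

  ev-parts : ∀ {V n} (i : V → Fin n) (e : Ex V) ρ → evalT 𝓕 (positive-part i e) ρ ≡ evalT 𝓕 (negative-part i e) ρ + ev e (λ v → ρ (i v))
  ev-parts i (at v)  ρ = sym (+-identityˡ (ρ (i v)))
  ev-parts i 𝟎       ρ = sym (+-identityˡ 0#)
  ev-parts i 𝟏       ρ = sym (+-identityˡ 1#)
  ev-parts i (d ∔ e) ρ = trans (cong₂ _+_ (ev-parts i d ρ) (ev-parts i e ρ))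
    (solve 4 (λ a b c d → (a :+ b) :+ (c :+ d) := (a :+ c) :+ (b :+ d)) refl _ _ _ _)
  ev-parts i (d ∙ e) ρ = parts-product (ev-parts i d ρ) (ev-parts i e ρ)
    where
    parts-product : ∀ {p n x q m y} → p ≡ n + x → q ≡ m + y → p * q + n * m ≡ (p * m + n * q) + x * y
    parts-product {n = n} {x} {m = m} {y} refl refl =
      solve 4 (λ n x m y → (n :+ x) :* (m :+ y) :+ n :* m := ((n :+ x) :* m :+ n :* (m :+ y)) :+ x :* y) refl n x m y
  ev-parts i (⁻ e)   ρ = opposite (ev-parts i e ρ)
    where
    opposite : ∀ {p n x} → p ≡ n + x → n ≡ p + - x
    opposite {n = n} {x} refl = solve 2 (λ n x → n := (n :+ x) :+ :- x) refl n x

  0′ : ∀ {n} → Fin (suc n)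
  0′ = Fin.zero
  1′ : ∀ {n} → Fin (2 ℕ.+ n)
  1′ = Fin.suc Fin.zero
  2′ : ∀ {n} → Fin (3 ℕ.+ n)
  2′ = Fin.suc 1′
  3′ : ∀ {n} → Fin (4 ℕ.+ n)
  3′ = Fin.suc 2′
  4′ : ∀ {n} → Fin (5 ℕ.+ n)
  4′ = Fin.suc 3′
  5′ : ∀ {n} → Fin (6 ℕ.+ n)
  5′ = Fin.suc 4′
  skip : ∀ {n} m → Fin n → Fin (m ℕ.+ n)
  skip zero    i = i
  skip (suc m) i = Fin.suc (skip m i)

  module Crossing {C₁ C₂ : F → Set} (D₁ : DedekindCut C₁) (D₂ : DedekindCut C₂) {k : ℕ} (d : Fin k → F) where
    private
      module D₁ = DedekindCut D₁
      module D₂ = DedekindCut D₂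

    V : Set
    V = Fin (suc (suc k))

    -- The variable y comes first because it will range over the cut of `a` and x over that of `b`,
    -- while formulas are evaluated at `a t`, `b s` and the parameters in this order.
    env : F → F → V → F
    env x y = y VF.∷ x VF.∷ d

    value : Ex V → F → F → F
    value e x y = ev e (env x y)

    isX isY : V → Bool
    isX Fin.zero                = false
    isX (Fin.suc Fin.zero)      = true
    isX (Fin.suc (Fin.suc _))   = false
    isY Fin.zero                = true
    isY (Fin.suc _)             = false

    value-∂x : ∀ e y → HasDer (λ x → value e x y) (λ x → value (∂ isX e) x y)
    value-∂x e y = ∂-der isX (λ x → env x y) (λ where
      Fin.zero                → const-der y
      (Fin.suc Fin.zero)      → id-der
      (Fin.suc (Fin.suc i))   → const-der (d i)) e

    value-∂y : ∀ e x → HasDer (λ y → value e x y) (λ y → value (∂ isY e) x y)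
    value-∂y e x = ∂-der isY (env x) (λ where
      Fin.zero              → id-der
      (Fin.suc Fin.zero)    → const-der x
      (Fin.suc (Fin.suc i)) → const-der (d i)) e

    On : F → F → (F → F → Set) → Set
    On d₁ d₂ Q = ∀ x y → C₁ x → d₁ < x → C₂ y → d₂ < y → Q x y

    Settled : Ex V → Set
    Settled e = ∃ λ d₁ → ∃ λ d₂ → C₁ d₁ × C₂ d₂ × ∃ λ σ → On d₁ d₂ (λ x y → sgn (value e x y) ≡ σ)

    Equivalent : Set
    Equivalent = PositivelyEquivalent 𝓕 C₁ C₂

    Settled-neg : ∀ e → Settled (⁻ e) → Settled e
    Settled-neg e (d₁ , d₂ , Cd₁ , Cd₂ , σ , same) = d₁ , d₂ , Cd₁ , Cd₂ , ⊖ ·ₛ σ , λ x y a b c d →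
      trans (cong sgn (sym (-‿involutive (value e x y)))) (trans (sgn-opp (- value e x y)) (cong (⊖ ·ₛ_) (same x y a b c d)))

    module _ (e : Ex V) (d₁ d₂ : F) (Cd₁ : C₁ d₁) (Cd₂ : C₂ d₂) where
      private
        P : F → F → F
        P = value e

      y-constant : On d₁ d₂ (λ x y → value (∂ isY e) x y ≡ 0#) → ∀ x y y′ → C₁ x → d₁ < x → C₂ y → d₂ < y → C₂ y′ → d₂ < y′ → P x y ≡ P x y′
      y-constant zeros x y y′ Cx d₁<x Cy d₂<y Cy′ d₂<y′ with compare y y′
      ... | tri< y<y′ _ _ = constant (value-∂y e x) y<y′ (λ z y<z z<y′ → zeros x z Cx d₁<x (D₂.down z<y′ Cy′) (<-trans d₂<y y<z))
      ... | tri≈ _ refl _ = refl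
      ... | tri> _ _ y′<y = sym (constant (value-∂y e x) y′<y (λ z y′<z z<y → zeros x z Cx d₁<x (D₂.down z<y Cy) (<-trans d₂<y′ y′<z)))

      x-constant : On d₁ d₂ (λ x y → value (∂ isX e) x y ≡ 0#) → ∀ x x′ y → C₁ x → d₁ < x → C₁ x′ → d₁ < x′ → C₂ y → d₂ < y → P x y ≡ P x′ y
      x-constant zeros x x′ y Cx d₁<x Cx′ d₁<x′ Cy d₂<y with compare x x′
      ... | tri< x<x′ _ _ = constant (value-∂x e y) x<x′ (λ z x<z z<x′ → zeros z y (D₁.down z<x′ Cx′) (<-trans d₁<x x<z) Cy d₂<y)
      ... | tri≈ _ refl _ = refl
      ... | tri> _ _ x′<x = sym (constant (value-∂x e y) x′<x (λ z x′<z z<x → zeros z y (D₁.down z<x Cx) (<-trans d₁<x′ x′<z) Cy d₂<y))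

      -- On the quadrant the polynomial depends on x alone, so a sign in one variable near the first
      -- cut is enough.
      settled-y : On d₁ d₂ (λ x y → value (∂ isY e) x y ≡ 0#) → Settled e
      settled-y zeros =
        let y₀ , Cy₀ , d₂<y₀ = D₂.no-max Cd₂
            d′ , _ , (Cd′ , ¬Ce′) , σ , con = constant-sign D₁.germ (HasDer.poly (value-∂x e y₀))
            m , Cm , d₁<m , d′<m = D₁.larger Cd₁ Cd′
        in m , d₂ , Cm , Cd₂ , σ , λ x y Cx m<x Cy d₂<y →
             trans (cong sgn (y-constant zeros x y y₀ Cx (<-trans d₁<m m<x) Cy d₂<y Cy₀ d₂<y₀))
                   (con x (<-trans d′<m m<x) (D₁.separated Cx ¬Ce′))

      settled-x : On d₁ d₂ (λ x y → value (∂ isX e) x y ≡ 0#) → Settled e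
      settled-x zeros =
        let x₀ , Cx₀ , d₁<x₀ = D₁.no-max Cd₁
            d′ , _ , (Cd′ , ¬Ce′) , σ , con = constant-sign D₂.germ (HasDer.poly (value-∂y e x₀))
            m , Cm , d₂<m , d′<m = D₂.larger Cd₂ Cd′
        in d₁ , m , Cd₁ , Cm , σ , λ x y Cx d₁<x Cy m<y →
             trans (cong sgn (x-constant zeros x x₀ y Cx d₁<x Cx₀ d₁<x₀ Cy (<-trans d₂<m m<y)))
                   (con y (<-trans d′<m m<y) (D₂.separated Cy ¬Ce′))

      y-increasing : On d₁ d₂ (λ x y → 0# < value (∂ isY e) x y) → ∀ {x y y′} → C₁ x → d₁ < x → d₂ < y → y < y′ → C₂ y′ → P x y < P x y′
      y-increasing pos {x} Cx d₁<x d₂<y y<y′ Cy′ = increasing (value-∂y e x) y<y′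
        (λ z y<z z<y′ → pos x z Cx d₁<x (D₂.down z<y′ Cy′) (<-trans d₂<y y<z))

      x-increasing : On d₁ d₂ (λ x y → 0# < value (∂ isX e) x y) → ∀ {x x′ y} → d₁ < x → x < x′ → C₁ x′ → C₂ y → d₂ < y → P x y < P x′ y
      x-increasing pos {y = y} d₁<x x<x′ Cx′ Cy d₂<y = increasing (value-∂x e y) x<x′
        (λ z x<z z<x′ → pos z y (D₁.down z<x′ Cx′) (<-trans d₁<x x<z) Cy d₂<y)

      x-decreasing : On d₁ d₂ (λ x y → value (∂ isX e) x y < 0#) → ∀ {x x′ y} → d₁ < x → x < x′ → C₁ x′ → C₂ y → d₂ < y → P x′ y < P x y
      x-decreasing negv {x} {x′} {y} d₁<x x<x′ Cx′ Cy d₂<y =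
        subst₂ _<_ (-‿involutive (P x′ y)) (-‿involutive (P x y)) (neg-mono-< (increasing (neg-der (value-∂x e y)) x<x′
          (λ z x<z z<x′ → neg-pos (negv z y (D₁.down z<x′ Cx′) (<-trans d₁<x x<z) Cy d₂<y))))

      -- If the value is nonnegative at one point, it is positive on the quadrant above that point;
      -- otherwise it is negative everywhere.
      settled-increasing : On d₁ d₂ (λ x y → 0# < value (∂ isX e) x y) → On d₁ d₂ (λ x y → 0# < value (∂ isY e) x y) → Settled e
      settled-increasing px py with em {∃ λ x → ∃ λ y → C₁ x × d₁ < x × C₂ y × d₂ < y × 0# ≤ P x y}
      ... | yes (x₀ , y₀ , Cx₀ , d₁<x₀ , Cy₀ , d₂<y₀ , nonneg) = x₀ , y₀ , Cx₀ , Cy₀ , ⊕ , λ x y Cx x₀<x Cy y₀<y →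
              sgn-pos (≤-<-trans nonneg (<-trans (x-increasing px d₁<x₀ x₀<x Cx Cy₀ d₂<y₀) (y-increasing py Cx (<-trans d₁<x₀ x₀<x) d₂<y₀ y₀<y Cy)))
      ... | no none = d₁ , d₂ , Cd₁ , Cd₂ , ⊖ , λ x y Cx d₁<x Cy d₂<y → sgn-neg (negative x y Cx d₁<x Cy d₂<y)
        where
        negative : ∀ x y → C₁ x → d₁ < x → C₂ y → d₂ < y → P x y < 0#
        negative x y Cx d₁<x Cy d₂<y with <⊎≥ (P x y) 0#
        ... | inj₁ lt = lt
        ... | inj₂ ge = ⊥-elim (none (x , y , Cx , d₁<x , Cy , d₂<y , ge))

      module _ (px : On d₁ d₂ (λ x y → value (∂ isX e) x y < 0#)) (py : On d₁ d₂ (λ x y → 0# < value (∂ isY e) x y)) where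

        Crosses : Set
        Crosses = (∀ y → C₂ y → d₂ < y → ∃ λ x → C₁ x × d₁ < x × P x y < 0#) × (∀ x → C₁ x → d₁ < x → ∃ λ y → C₂ y × d₂ < y × 0# < P x y)

        -- If for some y₀ no x makes the value negative, growth in y makes it positive above y₀; if
        -- for some x₀ no y makes it positive, decrease in x makes it negative beyond x₀. Failing
        -- both, zeros are trapped from both sides all the way to the cuts.
        settled-or-crosses : Settled e ⊎ Crosses
        settled-or-crosses with em {∃ λ y → C₂ y × d₂ < y × (∀ x → C₁ x → d₁ < x → 0# ≤ P x y)}
        ... | yes (y₀ , Cy₀ , d₂<y₀ , nonneg) = inj₁ (d₁ , y₀ , Cd₁ , Cy₀ , ⊕ , λ x y Cx d₁<x Cy y₀<y →
                sgn-pos (≤-<-trans (nonneg x Cx d₁<x) (y-increasing py Cx d₁<x d₂<y₀ y₀<y Cy)))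
        ... | no none₁ with em {∃ λ x → C₁ x × d₁ < x × (∀ y → C₂ y → d₂ < y → P x y ≤ 0#)}
        ...   | yes (x₀ , Cx₀ , d₁<x₀ , nonpos) = inj₁ (x₀ , d₂ , Cx₀ , Cd₂ , ⊖ , λ x y Cx x₀<x Cy d₂<y →
                sgn-neg (<-≤-trans (x-decreasing px d₁<x₀ x₀<x Cx Cy d₂<y) (nonpos y Cy d₂<y)))
        ...   | no none₂ = inj₂ (below-zero , above-zero)
          where
          below-zero : ∀ y → C₂ y → d₂ < y → ∃ λ x → C₁ x × d₁ < x × P x y < 0#
          below-zero y Cy d₂<y with em {∃ λ x → C₁ x × d₁ < x × P x y < 0#}
          ... | yes found = found
          ... | no ¬found = ⊥-elim (none₁ (y , Cy , d₂<y , λ x Cx d₁<x → ≮⇒≥ (λ lt → ¬found (x , Cx , d₁<x , lt))))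
          above-zero : ∀ x → C₁ x → d₁ < x → ∃ λ y → C₂ y × d₂ < y × 0# < P x y
          above-zero x Cx d₁<x with em {∃ λ y → C₂ y × d₂ < y × 0# < P x y}
          ... | yes found = found
          ... | no ¬found = ⊥-elim (none₂ (x , Cx , d₁<x , λ y Cy d₂<y → ≮⇒≥ (λ lt → ¬found (y , Cy , d₂<y , lt))))

    private
      at-positions : ∀ {n} → Fin n → Fin n → (Fin k → Fin n) → V → Fin n
      at-positions i j par Fin.zero              = j
      at-positions i j par (Fin.suc Fin.zero)    = i
      at-positions i j par (Fin.suc (Fin.suc l)) = par l

    module Branch (e : Ex V) (y⋆ : F) where
      private
        P : F → F → F
        P = value e

      -- The implicit function as the least zero above `y⋆`. Below the cuts zeros are unique by
      -- monotonicity; beyond them nothing of the kind is known, and leastness keeps the branch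
      -- single-valued and definable.
      Branch : F → F → Set
      Branch x y = y⋆ < y × P x y ≡ 0# × ¬ (Σ F λ y′ → y⋆ < y′ × y′ < y × P x y′ ≡ 0#)

      branch-unique : ∀ {x y y′} → Branch x y → Branch x y′ → y ≡ y′
      branch-unique {x} {y} {y′} (l , z , none) (l′ , z′ , none′) with compare y y′
      ... | tri< y<y′ _ _ = ⊥-elim (none′ (y , l , y<y′ , z))
      ... | tri≈ _ y≡y′ _ = y≡y′
      ... | tri> _ _ y′<y = ⊥-elim (none (y′ , l′ , y′<y , z′))

      zero-formula : ∀ {n} → Fin n → Fin n → (Fin k → Fin n) → Formula n
      zero-formula i j par = eq (positive-part (at-positions i j par) e) (negative-part (at-positions i j par) e)

      branch-formula : ∀ {n} → Fin n → Fin n → Fin n → (Fin k → Fin n) → Formula n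
      branch-formula i j s par = conj (less (var s) (var j)) (conj (zero-formula i j par)
        (neg (ex (conj (less (var (Fin.suc s)) (var Fin.zero)) (conj (less (var Fin.zero) (var (Fin.suc j)))
          (zero-formula (Fin.suc i) Fin.zero (λ l → Fin.suc (par l))))))))

      module _ {n} {i j : Fin n} {par : Fin k → Fin n} {ρ : Fin n → F} (params : ∀ l → ρ (par l) ≡ d l) where
        private
          at-env : ev e (λ v → ρ (at-positions i j par v)) ≡ P (ρ i) (ρ j)
          at-env = ev-cong e λ { Fin.zero → refl ; (Fin.suc Fin.zero) → refl ; (Fin.suc (Fin.suc l)) → params l }

        zero⇒ : Sat 𝓕 (zero-formula i j par) ρ → P (ρ i) (ρ j) ≡ 0#
        zero⇒ s = trans (sym at-env) (cancelled s (ev-parts (at-positions i j par) e ρ))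
          where
          cancelled : ∀ {p n x} → p ≡ n → p ≡ n + x → x ≡ 0#
          cancelled {p} {_} {x} refl p≡p+x = by-multiple (- 1#) p≡p+x (solve 2 (λ x p → x :+ :- :1 :* (p :+ x) := :0 :+ :- :1 :* p) refl x p)

        zero⇐ : P (ρ i) (ρ j) ≡ 0# → Sat 𝓕 (zero-formula i j par) ρ
        zero⇐ z = trans (ev-parts (at-positions i j par) e ρ) (trans (cong (evalT 𝓕 (negative-part (at-positions i j par) e) ρ +_) (trans at-env z)) (+-identityʳ _))

      module _ {n} (i j s : Fin n) (par : Fin k → Fin n) {ρ : Fin n → F} (ρs≡y⋆ : ρ s ≡ y⋆) (params : ∀ l → ρ (par l) ≡ d l) where
        branch⇒ : Sat 𝓕 (branch-formula i j s par) ρ → Branch (ρ i) (ρ j)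
        branch⇒ (l , z , none) = subst (_< ρ j) ρs≡y⋆ l , zero⇒ {i = i} {j} {par} params z , λ (y′ , l′ , y′<y , z′) →
          none (y′ , subst (_< y′) (sym ρs≡y⋆) l′ , y′<y , zero⇐ {i = Fin.suc i} {Fin.zero} {λ l → Fin.suc (par l)} {y′ VF.∷ ρ} params z′)

        branch⇐ : Branch (ρ i) (ρ j) → Sat 𝓕 (branch-formula i j s par) ρ
        branch⇐ (l , z , none) = subst (_< ρ j) (sym ρs≡y⋆) l , zero⇐ {i = i} {j} {par} params z , λ (y′ , l′ , y′<y , z′) →
          none (y′ , subst (_< y′) ρs≡y⋆ l′ , y′<y , zero⇒ {i = Fin.suc i} {Fin.zero} {λ l → Fin.suc (par l)} {y′ VF.∷ ρ} params z′)

      -- All that the map has to satisfy between m and x: the branch exists at x, lies above its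
      -- earlier values, and takes all values between those at m and x. As a definable property of
      -- the one point x it can be continued across the cut.
      Good : F → F → Set
      Good m x =
        (Σ F λ y → Branch x y) ×
        (∀ x₁ y₁ y → ¬ x₁ < m → x₁ < x → Branch x₁ y₁ → Branch x y → y₁ < y) ×
        (∀ y₀ yₓ y → Branch m y₀ → Branch x yₓ → y₀ < y → y < yₓ → Σ F λ x′ → m < x′ × x′ < x × Branch x′ y)

      -- The coordinates are x , m , y⋆ and the parameters d.
      GoodF : (Fin (3 ℕ.+ k) → F) → Set
      GoodF ρ =
        (Σ F λ y → Sat 𝓕 (branch-formula 1′ 0′ 3′ (skip 4)) (y VF.∷ ρ)) ×
        (∀ x₁ y₁ y → (x₁ < ρ 1′ → ⊥) → x₁ < ρ 0′ →
           Sat 𝓕 (branch-formula 2′ 1′ 5′ (skip 6)) (y VF.∷ y₁ VF.∷ x₁ VF.∷ ρ) →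
           Sat 𝓕 (branch-formula 3′ 0′ 5′ (skip 6)) (y VF.∷ y₁ VF.∷ x₁ VF.∷ ρ) → y₁ < y) ×
        (∀ y₀ yₓ y → Sat 𝓕 (branch-formula 4′ 2′ 5′ (skip 6)) (y VF.∷ yₓ VF.∷ y₀ VF.∷ ρ) →
           Sat 𝓕 (branch-formula 3′ 1′ 5′ (skip 6)) (y VF.∷ yₓ VF.∷ y₀ VF.∷ ρ) → y₀ < y → y < yₓ →
           Σ F λ x′ → ρ 1′ < x′ × x′ < ρ 0′ × Sat 𝓕 (branch-formula 0′ 1′ (Fin.suc 5′) (skip 7)) (x′ VF.∷ y VF.∷ yₓ VF.∷ y₀ VF.∷ ρ))

      determined-Good : Determined GoodF
      determined-Good = determined-×
        (determined-∃ (determined-Sat (branch-formula 1′ 0′ 3′ (skip 4))))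
        (determined-×
          (determined-∀ (determined-∀ (determined-∀ (determined-→ (determined-→ (determined-< (at 2′) (at 4′)) determined-⊥)
            (determined-→ (determined-< (at 2′) (at 3′)) (determined-→ (determined-Sat (branch-formula 2′ 1′ 5′ (skip 6)))
              (determined-→ (determined-Sat (branch-formula 3′ 0′ 5′ (skip 6))) (determined-< (at 1′) (at 0′)))))))))
          (determined-∀ (determined-∀ (determined-∀ (determined-→ (determined-Sat (branch-formula 4′ 2′ 5′ (skip 6)))
            (determined-→ (determined-Sat (branch-formula 3′ 1′ 5′ (skip 6))) (determined-→ (determined-< (at 2′) (at 0′))
              (determined-→ (determined-< (at 0′) (at 1′)) (determined-∃ (determined-× (determined-< (at 5′) (at 0′))
                (determined-× (determined-< (at 0′) (at 4′)) (determined-Sat (branch-formula 0′ 1′ (Fin.suc 5′) (skip 7))))))))))))))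

      Good⇒ : ∀ m x → Good m x → GoodF (x VF.∷ m VF.∷ y⋆ VF.∷ d)
      Good⇒ m x ((y , b) , inc , onto) =
        (y , branch⇐ 1′ 0′ 3′ (skip 4) refl (λ _ → refl) b) ,
        (λ x₁ y₁ y a b s t → inc x₁ y₁ y a b (branch⇒ 2′ 1′ 5′ (skip 6) refl (λ _ → refl) s) (branch⇒ 3′ 0′ 5′ (skip 6) refl (λ _ → refl) t)) ,
        (λ y₀ yₓ y s t a b → let x′ , m<x′ , x′<x , br = onto y₀ yₓ y (branch⇒ 4′ 2′ 5′ (skip 6) refl (λ _ → refl) s)
                                                           (branch⇒ 3′ 1′ 5′ (skip 6) refl (λ _ → refl) t) a b
                             in x′ , m<x′ , x′<x , branch⇐ 0′ 1′ (Fin.suc 5′) (skip 7) refl (λ _ → refl) br)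

      Good⇐ : ∀ m x → GoodF (x VF.∷ m VF.∷ y⋆ VF.∷ d) → Good m x
      Good⇐ m x ((y , b) , inc , onto) =
        (y , branch⇒ 1′ 0′ 3′ (skip 4) refl (λ _ → refl) b) ,
        (λ x₁ y₁ y a b s t → inc x₁ y₁ y a b (branch⇐ 2′ 1′ 5′ (skip 6) refl (λ _ → refl) s) (branch⇐ 3′ 0′ 5′ (skip 6) refl (λ _ → refl) t)) ,
        (λ y₀ yₓ y s t a b → let x′ , m<x′ , x′<x , br = onto y₀ yₓ y (branch⇐ 4′ 2′ 5′ (skip 6) refl (λ _ → refl) s)
                                                           (branch⇐ 3′ 1′ 5′ (skip 6) refl (λ _ → refl) t) a b
                             in x′ , m<x′ , x′<x , branch⇒ 0′ 1′ (Fin.suc 5′) (skip 7) refl (λ _ → refl) br)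

    -- Since the value at `m`, `y⋆` is negative and decreases in x, it stays negative at height `y⋆`
    -- for all later x below the cut. Thus the zeros lie above `y⋆`, where `Branch` looks for them.
    module FromCrossing (e : Ex V) (d₁ d₂ : F) (Cd₁ : C₁ d₁) (Cd₂ : C₂ d₂)
      (px : On d₁ d₂ (λ x y → value (∂ isX e) x y < 0#)) (py : On d₁ d₂ (λ x y → 0# < value (∂ isY e) x y))
      (crosses : Crosses e d₁ d₂ Cd₁ Cd₂ px py)
      (y⋆ : F) (Cy⋆ : C₂ y⋆) (d₂<y⋆ : d₂ < y⋆) (m : F) (Cm : C₁ m) (d₁<m : d₁ < m) (Pmy⋆<0 : value e m y⋆ < 0#) where
      open Branch e y⋆
      private
        P : F → F → F
        P = value e
        up : ∀ {x y y′} → C₁ x → d₁ < x → d₂ < y → y < y′ → C₂ y′ → P x y < P x y′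
        up = y-increasing e d₁ d₂ Cd₁ Cd₂ py
        sink : ∀ {x x′ y} → d₁ < x → x < x′ → C₁ x′ → C₂ y → d₂ < y → P x′ y < P x y
        sink = x-decreasing e d₁ d₂ Cd₁ Cd₂ px

      zero⇒branch : ∀ {x y} → C₁ x → d₁ < x → C₂ y → y⋆ < y → P x y ≡ 0# → Branch x y
      zero⇒branch Cx d₁<x Cy y⋆<y z = y⋆<y , z , λ (y′ , y⋆<y′ , y′<y , z′) →
        <-irrefl (subst₂ _<_ z′ z (up Cx d₁<x (<-trans d₂<y⋆ y⋆<y′) y′<y Cy))

      below-y⋆ : ∀ {x} → C₁ x → ¬ x < m → P x y⋆ < 0#
      below-y⋆ {x} Cx x≮m with ≮⇒≥ x≮m
      ... | inj₁ m<x  = <-trans (sink d₁<m m<x Cx Cy⋆ d₂<y⋆) Pmy⋆<0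
      ... | inj₂ refl = Pmy⋆<0

      beyond-d₁ : ∀ {x} → ¬ x < m → d₁ < x
      beyond-d₁ x≮m = <-≤-trans d₁<m (≮⇒≥ x≮m)

      -- The value is negative at `y⋆` and, by the crossing, positive at some point of the second
      -- cut, which must lie above `y⋆` by monotonicity.
      branch-exists : ∀ x → C₁ x → ¬ x < m → ∃ λ y → C₂ y × Branch x y
      branch-exists x Cx x≮m with proj₂ crosses x Cx (beyond-d₁ x≮m)
      ... | y₁ , Cy₁ , d₂<y₁ , 0<P with <⊎≥ y⋆ y₁
      ...   | inj₂ (inj₁ y₁<y⋆) = ⊥-elim (<-irrefl (<-trans 0<P (<-trans (up Cx (beyond-d₁ x≮m) d₂<y₁ y₁<y⋆ Cy⋆) (below-y⋆ Cx x≮m))))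
      ...   | inj₂ (inj₂ refl)  = ⊥-elim (<-irrefl (<-trans 0<P (below-y⋆ Cx x≮m)))
      ...   | inj₁ y⋆<y₁ =
                let y , y⋆<y , y<y₁ , z = ivt↑ (HasDer.poly (value-∂y e x)) y⋆<y₁ (below-y⋆ Cx x≮m) 0<P
                in y , D₂.down y<y₁ Cy₁ , zero⇒branch Cx (beyond-d₁ x≮m) (D₂.down y<y₁ Cy₁) y⋆<y z

      branch∈C₂ : ∀ {x y} → C₁ x → ¬ x < m → Branch x y → C₂ y
      branch∈C₂ Cx x≮m b = let y , Cy , b′ = branch-exists _ Cx x≮m in subst C₂ (branch-unique b′ b) Cy

      branch-increasing : ∀ {x₁ x y₁ y} → C₁ x → ¬ x₁ < m → x₁ < x → Branch x₁ y₁ → Branch x y → y₁ < y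
      branch-increasing {x₁} {x} {y₁} {y} Cx x₁≮m x₁<x b₁@(y⋆<y₁ , z₁ , _) b@(y⋆<y , z , _) with <⊎≥ y₁ y
      ... | inj₁ lt = lt
      ... | inj₂ y≤y₁ = ⊥-elim (<-irrefl (subst (_< 0#) z (≤-<-trans (monotone y≤y₁) (subst (P x y₁ <_) z₁ (sink (beyond-d₁ x₁≮m) x₁<x Cx Cy₁ d₂<y₁)))))
        where
        Cy₁ : C₂ y₁
        Cy₁ = branch∈C₂ (D₁.down x₁<x Cx) x₁≮m b₁
        d₂<y₁ : d₂ < y₁
        d₂<y₁ = <-trans d₂<y⋆ y⋆<y₁
        d₁<x : d₁ < x
        d₁<x = <-trans (beyond-d₁ x₁≮m) x₁<x
        monotone : y ≤ y₁ → P x y ≤ P x y₁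
        monotone (inj₁ y<y₁) = inj₁ (up Cx d₁<x (<-trans d₂<y⋆ y⋆<y) y<y₁ Cy₁)
        monotone (inj₂ refl) = ≤-refl

      -- All three properties follow from monotonicity in each variable. To attain a given y, the
      -- intermediate value theorem is applied in x: the value is positive at m, where y is above
      -- the branch, and negative at x, where it is below.
      good-below : ∀ x → C₁ x → m < x → Good m x
      good-below x Cx m<x =
        (let y , _ , b = branch-exists x Cx (λ x<m → <-irrefl (<-trans x<m m<x)) in y , b) ,
        (λ x₁ y₁ y x₁≮m x₁<x b₁ b → branch-increasing Cx x₁≮m x₁<x b₁ b) ,
        onto
        where
        x≮m : ¬ x < m
        x≮m x<m = <-irrefl (<-trans x<m m<x)
        onto : ∀ y₀ yₓ y → Branch m y₀ → Branch x yₓ → y₀ < y → y < yₓ → Σ F λ x′ → m < x′ × x′ < x × Branch x′ y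
        onto y₀ yₓ y (y⋆<y₀ , z₀ , _) bₓ@(_ , zₓ , _) y₀<y y<yₓ =
          let x′ , m<x′ , x′<x , z = ivt↓ (HasDer.poly (value-∂x e y)) m<x 0<Pmy Pxy<0
          in x′ , m<x′ , x′<x , zero⇒branch (D₁.down x′<x Cx) (<-trans d₁<m m<x′) Cy (<-trans y⋆<y₀ y₀<y) z
          where
          Cyₓ : C₂ yₓ
          Cyₓ = branch∈C₂ Cx x≮m bₓ
          Cy : C₂ y
          Cy = D₂.down y<yₓ Cyₓ
          0<Pmy : 0# < P m y
          0<Pmy = subst (_< P m y) z₀ (up Cm d₁<m (<-trans d₂<y⋆ y⋆<y₀) y₀<y Cy)
          Pxy<0 : P x y < 0#
          Pxy<0 = subst (P x y <_) zₓ (up Cx (<-trans d₁<m m<x) (<-trans d₂<y⋆ (<-trans y⋆<y₀ y₀<y)) y<yₓ Cyₓ)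

      -- By o-minimality the branch stays good on some interval reaching beyond the cut.
      good-beyond : ∃ λ e₁ → ¬ C₁ e₁ × (∀ x → m < x → x ≤ e₁ → Good m x)
      good-beyond = extend (D₁.constant-near determined-Good (m VF.∷ y⋆ VF.∷ d))
        where
        extend : (∃ λ l → ∃ λ r → C₁ l × ¬ C₁ r × ∀ x y → l < x → x < r → l < y → y < r →
                    GoodF (x VF.∷ m VF.∷ y⋆ VF.∷ d) → GoodF (y VF.∷ m VF.∷ y⋆ VF.∷ d)) →
          ∃ λ e₁ → ¬ C₁ e₁ × (∀ x → m < x → x ≤ e₁ → Good m x)
        extend (l , r , Cl , ¬Cr , same) = e₁ , ¬Ce₁ , good
          where
          -- Chosen strictly below `r`, so that `e₁` itself lies in the interval of constancy.
          e₁ : F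
          e₁ = proj₁ (D₁.no-min ¬Cr)
          ¬Ce₁ : ¬ C₁ e₁
          ¬Ce₁ = proj₁ (proj₂ (D₁.no-min ¬Cr))
          e₁<r : e₁ < r
          e₁<r = proj₂ (proj₂ (D₁.no-min ¬Cr))
          good : ∀ x → m < x → x ≤ e₁ → Good m x
          good x m<x x≤e₁ with em {C₁ x}
          ... | yes Cx = good-below x Cx m<x
          ... | no ¬Cx = let z , Cz , l<z , m<z = D₁.larger Cl Cm in
                Good⇐ m x (same z x l<z (D₁.separated Cz ¬Cr) (D₁.separated Cl ¬Cx) (≤-<-trans x≤e₁ e₁<r) (Good⇒ m z (good-below z Cz m<z)))

      f : F → F
      f x with em {Σ F λ y → Branch x y}
      ... | yes (y , _) = y
      ... | no _        = 0#

      f-branch : ∀ {x y} → Branch x y → Branch x (f x)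
      f-branch {x} {y} b with em {Σ F λ y → Branch x y}
      ... | yes (_ , b′) = b′
      ... | no none      = ⊥-elim (none (y , b))

      equivalent : Equivalent
      equivalent = build good-beyond
        where
        m≮m : ¬ m < m
        m≮m = <-irrefl
        fm : Branch m (f m)
        fm = f-branch (proj₂ (proj₂ (branch-exists m Cm m≮m)))
        ≮m : ∀ {x} → m < x → ¬ x < m
        ≮m m<x x<m = <-irrefl (<-trans m<x x<m)
        build : (∃ λ e₁ → ¬ C₁ e₁ × (∀ x → m < x → x ≤ e₁ → Good m x)) → Equivalent
        build (e₁ , ¬Ce₁ , good) =
          -- `Good` holds at `e₁` too, so `f e₁` can serve as the upper end of the image interval.
          m , e₁ , f m , f e₁ , Cm , ¬Ce₁ , branch∈C₂ Cm m≮m fm , fe₁∉ , f ,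
          (suc k , branch-formula 0′ 1′ 2′ (skip 3) , y⋆ VF.∷ d , λ x (m<x , x<e₁) y → mk⇔
            (λ s → branch-unique (branch m<x (inj₁ x<e₁)) (branch⇒ 0′ 1′ 2′ (skip 3) refl (λ _ → refl) s))
            (λ { refl → branch⇐ 0′ 1′ 2′ (skip 3) refl (λ _ → refl) (branch m<x (inj₁ x<e₁)) })) ,
          (λ x y (m<x , x<e₁) (m<y , y<e₁) x<y → f-mono m<x x<y (inj₁ y<e₁)) ,
          (λ x (m<x , x<e₁) → proj₁ (proj₂ (good x m<x (inj₁ x<e₁))) m _ _ m≮m m<x fm (branch m<x (inj₁ x<e₁)) , f-mono m<x x<e₁ ≤-refl) ,
          onto ,
          (λ x (m<x , x<e₁) Cx → branch∈C₂ Cx (≮m m<x) (branch m<x (inj₁ x<e₁))) ,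
          (λ y y-in@(fm<y , y<fe₁) Cy → let x , (m<x , x<e₁) , fx≡y = onto y y-in in
             x , (m<x , x<e₁) , inside x m<x (inj₁ x<e₁) (subst C₂ (sym fx≡y) Cy) , fx≡y)
          where
          m<e₁ : m < e₁
          m<e₁ = D₁.separated Cm ¬Ce₁
          branch : ∀ {x} → m < x → x ≤ e₁ → Branch x (f x)
          branch m<x x≤e₁ = f-branch (proj₂ (proj₁ (good _ m<x x≤e₁)))
          f-mono : ∀ {x y} → m < x → x < y → y ≤ e₁ → f x < f y
          f-mono m<x x<y y≤e₁ = proj₁ (proj₂ (good _ (<-trans m<x x<y) y≤e₁)) _ _ _ (≮m m<x) x<y
            (branch m<x (inj₁ (<-≤-trans x<y y≤e₁))) (branch (<-trans m<x x<y) y≤e₁)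
          -- The values of f below the cut are cofinal in C₂.
          inside : ∀ x → m < x → x ≤ e₁ → C₂ (f x) → C₁ x
          inside x m<x x≤e₁ Cfx with em {C₁ x}
          ... | yes Cx = Cx
          ... | no ¬Cx with proj₁ crosses (f x) Cfx (<-trans d₂<y⋆ (proj₁ (branch m<x x≤e₁)))
          ...   | x₁ , Cx₁ , d₁<x₁ , negative with D₁.larger Cx₁ Cm
          -- At `z` below the cut, `f z < f x` makes the value at height `f x` positive. But along
          -- this height the value decreases in x, and it is already negative at `x₁ < z`.
          ...     | z , Cz , x₁<z , m<z = ⊥-elim (<-irrefl (<-trans contradictory (<-trans (sink d₁<x₁ x₁<z Cz Cfx d₂<fx) negative)))
            where
            d₂<fx : d₂ < f x
            d₂<fx = <-trans d₂<y⋆ (proj₁ (branch m<x x≤e₁))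
            z<x : z < x
            z<x = D₁.separated Cz ¬Cx
            bz : Branch z (f z)
            bz = branch m<z (inj₁ (<-≤-trans z<x x≤e₁))
            contradictory : 0# < P z (f x)
            contradictory = subst (_< P z (f x)) (proj₁ (proj₂ bz)) (up Cz (<-trans d₁<m m<z) (<-trans d₂<y⋆ (proj₁ bz)) (f-mono m<z z<x x≤e₁) Cfx)
          fe₁∉ : ¬ C₂ (f e₁)
          fe₁∉ C = ¬Ce₁ (inside e₁ m<e₁ ≤-refl C)
          onto : ∀ y → InInterval 𝓕 (f m) (f e₁) y → Σ F λ x → InInterval 𝓕 m e₁ x × f x ≡ y
          onto y (fm<y , y<fe₁) = let x , m<x , x<e₁ , b = proj₂ (proj₂ (good e₁ m<e₁ ≤-refl)) _ _ y fm (branch m<e₁ ≤-refl) fm<y y<fe₁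
                                  in x , (m<x , x<e₁) , branch-unique (f-branch b) b

    abstract
      positive-∂y : ∀ e d₁ d₂ → C₁ d₁ → C₂ d₂ → ∀ σ → On d₁ d₂ (λ x y → sgn (value (∂ isX e) x y) ≡ σ) →
        On d₁ d₂ (λ x y → 0# < value (∂ isY e) x y) → Settled e ⊎ Equivalent
      positive-∂y e d₁ d₂ Cd₁ Cd₂ ⊙ sx py = inj₁ (settled-x e d₁ d₂ Cd₁ Cd₂ (λ x y a b c f → sgn⇒zero (sx x y a b c f)))
      positive-∂y e d₁ d₂ Cd₁ Cd₂ ⊕ sx py = inj₁ (settled-increasing e d₁ d₂ Cd₁ Cd₂ (λ x y a b c f → sgn⇒pos (sx x y a b c f)) py)
      positive-∂y e d₁ d₂ Cd₁ Cd₂ ⊖ sx py = cases (settled-or-crosses e d₁ d₂ Cd₁ Cd₂ px py) (D₂.no-max Cd₂)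
        where
        px : On d₁ d₂ (λ x y → value (∂ isX e) x y < 0#)
        px x y a b c f = sgn⇒neg (sx x y a b c f)
        cases : Settled e ⊎ Crosses e d₁ d₂ Cd₁ Cd₂ px py → (∃ λ y → C₂ y × d₂ < y) → Settled e ⊎ Equivalent
        cases (inj₁ settled) _ = inj₁ settled
        cases (inj₂ cr) (y⋆ , Cy⋆ , d₂<y⋆) with proj₁ cr y⋆ Cy⋆ d₂<y⋆
        ... | m , Cm , d₁<m , negative = inj₂ (FromCrossing.equivalent e d₁ d₂ Cd₁ Cd₂ px py cr y⋆ Cy⋆ d₂<y⋆ m Cm d₁<m negative)

      -- Induction on the degree: the partial derivatives may be assumed to have constant signs.
      settled-or-equivalent : ∀ n e → size e ℕ.≤ n → Settled e ⊎ Equivalent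
      settled-or-equivalent zero    e small = inj₁ (D₁.lower , D₂.lower , D₁.lower∈ , D₂.lower∈ , ⊙ , λ x y _ _ _ _ → sgn-zero (size-0 e small (env x y)))
      settled-or-equivalent (suc n) e small
        with settled-or-equivalent n (∂ isX e) (ℕₚ.≤-trans (size-∂ isX e) (ℕₚ.pred-mono-≤ small))
           | settled-or-equivalent n (∂ isY e) (ℕₚ.≤-trans (size-∂ isY e) (ℕₚ.pred-mono-≤ small))
      ... | inj₂ equiv | _ = inj₂ equiv
      ... | inj₁ _ | inj₂ equiv = inj₂ equiv
      ... | inj₁ (l₁ , l₂ , Cl₁ , Cl₂ , σx , sx) | inj₁ (r₁ , r₂ , Cr₁ , Cr₂ , σy , sy)
        with D₁.larger Cl₁ Cr₁ | D₂.larger Cl₂ Cr₂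
      ...   | d₁ , Cd₁ , l₁<d₁ , r₁<d₁ | d₂ , Cd₂ , l₂<d₂ , r₂<d₂ = by-sign σy sy′
        where
        sx′ : On d₁ d₂ (λ x y → sgn (value (∂ isX e) x y) ≡ σx)
        sx′ x y a b c f = sx x y a (<-trans l₁<d₁ b) c (<-trans l₂<d₂ f)
        sy′ : On d₁ d₂ (λ x y → sgn (value (∂ isY e) x y) ≡ σy)
        sy′ x y a b c f = sy x y a (<-trans r₁<d₁ b) c (<-trans r₂<d₂ f)
        by-sign : ∀ σ → On d₁ d₂ (λ x y → sgn (value (∂ isY e) x y) ≡ σ) → Settled e ⊎ Equivalent
        by-sign ⊙ s = inj₁ (settled-y e d₁ d₂ Cd₁ Cd₂ (λ x y a b c f → sgn⇒zero (s x y a b c f)))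
        by-sign ⊕ s = positive-∂y e d₁ d₂ Cd₁ Cd₂ σx sx′ (λ x y a b c f → sgn⇒pos (s x y a b c f))
        -- Negating the polynomial reverses the signs of both partial derivatives.
        by-sign ⊖ s = [ (λ settled → inj₁ (Settled-neg e settled)) , inj₂ ]′
          (positive-∂y (⁻ e) d₁ d₂ Cd₁ Cd₂ (⊖ ·ₛ σx)
            (λ x y a b c f → trans (sgn-opp (value (∂ isX e) x y)) (cong (⊖ ·ₛ_) (sx′ x y a b c f)))
            (λ x y a b c f → neg-pos (sgn⇒neg (s x y a b c f))))

-- Perpendicularity and positive equivalence

module Perpendicularity (em : ExcludedMiddle 0ℓ) (𝓕 : RealClosedField) where

  open Basics em 𝓕
  open Order em 𝓕
  open DeterminedPredicates em 𝓕
  open Crossings em 𝓕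

  renameT : ∀ {m n} → (Fin m → Fin n) → Term m → Term n
  renameT r (var i)    = var (r i)
  renameT r zer        = zer
  renameT r one        = one
  renameT r (plus s t) = plus (renameT r s) (renameT r t)
  renameT r (mult s t) = mult (renameT r s) (renameT r t)

  rename : ∀ {m n} → (Fin m → Fin n) → Formula m → Formula n
  rename r (eq s t)   = eq (renameT r s) (renameT r t)
  rename r (less s t) = less (renameT r s) (renameT r t)
  rename r (neg φ)    = neg (rename r φ)
  rename r (conj φ ψ) = conj (rename r φ) (rename r ψ)
  rename r (ex φ)     = ex (rename (λ { Fin.zero → Fin.zero ; (Fin.suc i) → Fin.suc (r i) }) φ)

  evalT-rename : ∀ {m n} (r : Fin m → Fin n) {ρ σ} → (∀ i → ρ (r i) ≡ σ i) → ∀ t → evalT 𝓕 (renameT r t) ρ ≡ evalT 𝓕 t σ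
  evalT-rename r h (var i)    = h i
  evalT-rename r h zer        = refl
  evalT-rename r h one        = refl
  evalT-rename r h (plus s t) = cong₂ _+_ (evalT-rename r h s) (evalT-rename r h t)
  evalT-rename r h (mult s t) = cong₂ _*_ (evalT-rename r h s) (evalT-rename r h t)

  Sat-rename⇒ : ∀ {m n} (r : Fin m → Fin n) {ρ σ} → (∀ i → ρ (r i) ≡ σ i) → ∀ φ → Sat 𝓕 (rename r φ) ρ → Sat 𝓕 φ σ
  Sat-rename⇐ : ∀ {m n} (r : Fin m → Fin n) {ρ σ} → (∀ i → ρ (r i) ≡ σ i) → ∀ φ → Sat 𝓕 φ σ → Sat 𝓕 (rename r φ) ρ
  Sat-rename⇒ r h (eq s t)   e       = trans (sym (evalT-rename r h s)) (trans e (evalT-rename r h t))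
  Sat-rename⇒ r h (less s t) l       = subst₂ _<_ (evalT-rename r h s) (evalT-rename r h t) l
  Sat-rename⇒ r h (neg φ)    n       = λ s → n (Sat-rename⇐ r h φ s)
  Sat-rename⇒ r h (conj φ ψ) (s , t) = Sat-rename⇒ r h φ s , Sat-rename⇒ r h ψ t
  Sat-rename⇒ r h (ex φ)     (x , s) = x , Sat-rename⇒ _ (λ { Fin.zero → refl ; (Fin.suc i) → h i }) φ s
  Sat-rename⇐ r h (eq s t)   e       = trans (evalT-rename r h s) (trans e (sym (evalT-rename r h t)))
  Sat-rename⇐ r h (less s t) l       = subst₂ _<_ (sym (evalT-rename r h s)) (sym (evalT-rename r h t)) l
  Sat-rename⇐ r h (neg φ)    n       = λ s → n (Sat-rename⇒ r h φ s)
  Sat-rename⇐ r h (conj φ ψ) (s , t) = Sat-rename⇐ r h φ s , Sat-rename⇐ r h ψ t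
  Sat-rename⇐ r h (ex φ)     (x , s) = x , Sat-rename⇐ _ (λ { Fin.zero → refl ; (Fin.suc i) → h i }) φ s

  induced-dedekind : ∀ I a → IsDedekind 𝓕 (inducedCut 𝓕 I a) → DedekindCut (inducedCut 𝓕 I a)
  induced-dedekind I a ((l , Cl) , (u , ¬Cu) , no-max , no-min) = record
    { lower = l ; upper = u ; lower∈ = Cl ; upper∉ = ¬Cu
    ; down = λ y<x (t , x≤at) → t , inj₁ (<-≤-trans y<x x≤at)
    ; no-max = λ {x} Cx → no-max x Cx
    ; no-min = λ {x} ¬Cx → no-min x ¬Cx }

  module _ (I : LinOrder) (a : Idx I → F) (inc : StrictlyIncreasing 𝓕 I a) (D : DedekindCut (inducedCut 𝓕 I a)) where
    private
      module I = LinOrder I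
      C : F → Set
      C = inducedCut 𝓕 I a

    member : ∀ t → C (a t)
    member t = t , ≤-refl

    increasing-≤ : ∀ {s t} → s I.≤I t → a s ≤ a t
    increasing-≤ {s} {t} (inj₁ s<t)  = inj₁ (inc s t s<t)
    increasing-≤         (inj₂ refl) = ≤-refl

    -- The cut has no maximum, so some `a t` exceeds both `a t₀` and x; as `a` is increasing, `t`
    -- cannot precede `t₀`.
    beyond : ∀ t₀ {x} → C x → ∃ λ t → t₀ I.≤I t × x < a t
    beyond t₀ {x} Cx with DedekindCut.larger D (member t₀) Cx
    ... | z , (t , z≤at) , at₀<z , x<z = t , later (IsStrictTotalOrder.compare I.isStrictTotalOrder t₀ t) , <-≤-trans x<z z≤at
      where
      later : Tri (t₀ I.<I t) (t₀ ≡ t) (t I.<I t₀) → t₀ I.≤I t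
      later (tri< t₀<t _ _) = inj₁ t₀<t
      later (tri≈ _ e _)    = inj₂ e
      later (tri> _ _ t<t₀) = ⊥-elim (<-irrefl (<-trans (inc t t₀ t<t₀) (<-≤-trans at₀<z z≤at)))

    index-above : ∀ {x} → C x → ∃ λ t → x < a t
    index-above Cx@(t₀ , _) = let t , _ , x<at = beyond t₀ Cx in t , x<at

  module _ (I : LinOrder) (a : Idx I → F) (J : LinOrder) (b : Idx J → F)
           (incA : StrictlyIncreasing 𝓕 I a) (incB : StrictlyIncreasing 𝓕 J b)
           (DA : DedekindCut (inducedCut 𝓕 I a)) (DB : DedekindCut (inducedCut 𝓕 J b)) where
    private
      module DA = DedekindCut DA
      module DB = DedekindCut DB
      CA CB : F → Set
      CA = inducedCut 𝓕 I a
      CB = inducedCut 𝓕 J b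

    -- The formula f (b s) < a t distinguishes the two orders of quantification.
    equivalent⇒¬perpendicular : PositivelyEquivalent 𝓕 CB CA → ¬ Perpendicular 𝓕 I a J b
    equivalent⇒¬perpendicular
      (d₁ , e₁ , d₂ , e₂ , Cd₁ , ¬Ce₁ , Cd₂ , ¬Ce₂ , f , (k , ψ , p , graph) , mono , maps , onto , f-CA , f-CB) perp = by-value (perp k φ p)
      where
      -- In `ψ` the argument of f comes first and its value second. Under the quantifier these are
      -- `b s` in coordinate 2 and the bound variable in coordinate 0; coordinate 1 is `a t`.
      position : Fin (2 ℕ.+ k) → Fin (3 ℕ.+ k)
      position Fin.zero              = 2′
      position (Fin.suc Fin.zero)    = 0′
      position (Fin.suc (Fin.suc l)) = Fin.suc (Fin.suc (Fin.suc l))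
      φ : Formula (2 ℕ.+ k)
      φ = ex (conj (rename position ψ) (less (var 0′) (var 1′)))
      positions : ∀ {x y} z i → (z VF.∷ x VF.∷ y VF.∷ p) (position i) ≡ (y VF.∷ z VF.∷ p) i
      positions z Fin.zero              = refl
      positions z (Fin.suc Fin.zero)    = refl
      positions z (Fin.suc (Fin.suc l)) = refl
      φ⇒ : ∀ {x y} → InInterval 𝓕 d₁ e₁ y → Sat 𝓕 φ (x VF.∷ y VF.∷ p) → f y < x
      φ⇒ {x} {y} y-in (z , s , z<x) = subst (_< x) (sym (Equivalence.to (graph y y-in z) (Sat-rename⇒ position (positions z) ψ s))) z<x
      φ⇐ : ∀ {x y} → InInterval 𝓕 d₁ e₁ y → f y < x → Sat 𝓕 φ (x VF.∷ y VF.∷ p)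
      φ⇐ {x} {y} y-in fy<x = f y , Sat-rename⇐ position (positions (f y)) ψ (Equivalence.from (graph y y-in (f y)) refl) , fy<x
      Holds : Bool → Idx I → Idx J → Set
      Holds tv t s = Sat 𝓕 (φ ^tv tv) (a t VF.∷ b s VF.∷ p)
      by-value : (Σ Bool λ tv → EventuallyIn I (λ t → EventuallyIn J (Holds tv t)) × EventuallyIn J (λ s → EventuallyIn I (λ t → Holds tv t s))) → ⊥
      -- With t fixed first, `a t` is f x for some x below the cut, and f (b s) exceeds it as soon
      -- as `b s` passes x.
      by-value (true , (t₀ , ev₁) , _) with beyond I a incA DA t₀ Cd₂
      ... | t , t₀≤t , d₂<at with ev₁ t t₀≤t | f-CB (a t) (d₂<at , DA.separated (member I a incA DA t) ¬Ce₂) (member I a incA DA t)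
      ...   | s₀ , ev₂ | x , x-in@(d₁<x , _) , Cx , fx≡at with beyond J b incB DB s₀ Cx
      ...     | s , s₀≤s , x<bs = <-irrefl (<-trans (φ⇒ bs-in (ev₂ s s₀≤s)) (subst (_< f (b s)) fx≡at (mono x (b s) x-in bs-in x<bs)))
        where
        bs-in : InInterval 𝓕 d₁ e₁ (b s)
        bs-in = <-trans d₁<x x<bs , DB.separated (member J b incB DB s) ¬Ce₁
      -- With s fixed first, f (b s) belongs to the cut of `a`, so it is exceeded by `a t` for large
      -- t.
      by-value (false , _ , (s₀ , ev₁)) with beyond J b incB DB s₀ Cd₁
      ... | s , s₀≤s , d₁<bs with ev₁ s s₀≤s
      ...   | t₀ , ev₂ with beyond I a incA DA t₀ (f-CA (b s) bs-in (member J b incB DB s))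
        where
        bs-in : InInterval 𝓕 d₁ e₁ (b s)
        bs-in = d₁<bs , DB.separated (member J b incB DB s) ¬Ce₁
      ...     | t , t₀≤t , fbs<at = ev₂ t t₀≤t (φ⇐ (d₁<bs , DB.separated (member J b incB DB s) ¬Ce₁) fbs<at)

    module _ {k} (d : Fin k → F) where
      open Crossing DB DA d

      -- Without positive equivalence each test has a constant sign on some quadrant, and finitely
      -- many quadrants below the same pair of cuts have a common one.
      all-settled : ¬ PositivelyEquivalent 𝓕 CB CA → ∀ T → ∃ λ d₁ → ∃ λ d₂ → CB d₁ × CA d₂ ×
        (∀ x y x′ y′ → CB x → d₁ < x → CA y → d₂ < y → CB x′ → d₁ < x′ → CA y′ → d₂ < y′ → Agree T (env x y) (env x′ y′))
      all-settled ¬equiv []      = DB.lower , DA.lower , DB.lower∈ , DA.lower∈ , λ _ _ _ _ _ _ _ _ _ _ _ _ _ ()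
      all-settled ¬equiv (e ∷ T) with settled-or-equivalent (size e) e ℕₚ.≤-refl | all-settled ¬equiv T
      ... | inj₂ equiv | _ = ⊥-elim (¬equiv equiv)
      ... | inj₁ (l₁ , l₂ , Cl₁ , Cl₂ , σ , same) | r₁ , r₂ , Cr₁ , Cr₂ , agree with DB.larger Cl₁ Cr₁ | DA.larger Cl₂ Cr₂
      ...   | d₁ , Cd₁ , l₁<d₁ , r₁<d₁ | d₂ , Cd₂ , l₂<d₂ , r₂<d₂ = d₁ , d₂ , Cd₁ , Cd₂ , both
        where
        both : ∀ x y x′ y′ → CB x → d₁ < x → CA y → d₂ < y → CB x′ → d₁ < x′ → CA y′ → d₂ < y′ → Agree (e ∷ T) (env x y) (env x′ y′)
        both x y x′ y′ Cx a Cy b Cx′ a′ Cy′ b′ _ (here refl) =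
          trans (same x y Cx (<-trans l₁<d₁ a) Cy (<-trans l₂<d₂ b)) (sym (same x′ y′ Cx′ (<-trans l₁<d₁ a′) Cy′ (<-trans l₂<d₂ b′)))
        both x y x′ y′ Cx a Cy b Cx′ a′ Cy′ b′ i (there i∈) =
          agree x y x′ y′ Cx (<-trans r₁<d₁ a) Cy (<-trans r₂<d₂ b) Cx′ (<-trans r₁<d₁ a′) Cy′ (<-trans r₂<d₂ b′) i i∈

    -- The tests of φ have constant signs on a quadrant, so φ has one truth value there. The two
    -- sequences end up in this quadrant independently of each other, which makes both orders of
    -- quantification agree.
    ¬equivalent⇒perpendicular : ¬ PositivelyEquivalent 𝓕 CB CA → Perpendicular 𝓕 I a J b
    ¬equivalent⇒perpendicular ¬equiv k φ d with all-settled d ¬equiv (Determined.tests (determined-Sat φ))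
    ... | d₁ , d₂ , Cd₁ , Cd₂ , agree with index-above I a incA DA Cd₂ | index-above J b incB DB Cd₁
    ...   | t₀ , d₂<at₀ | s₀ , d₁<bs₀ = decide em
      where
      Holds : Formula (2 ℕ.+ k) → Idx I → Idx J → Set
      Holds χ t s = Sat 𝓕 χ (a t VF.∷ b s VF.∷ d)
      from-base : ∀ t s → LinOrder._≤I_ I t₀ t → LinOrder._≤I_ J s₀ s → Agree (Determined.tests (determined-Sat φ)) (a t₀ VF.∷ b s₀ VF.∷ d) (a t VF.∷ b s VF.∷ d)
      from-base t s t₀≤t s₀≤s = agree (b s₀) (a t₀) (b s) (a t) (member J b incB DB s₀) d₁<bs₀ (member I a incA DA t₀) d₂<at₀
        (member J b incB DB s) (<-≤-trans d₁<bs₀ (increasing-≤ J b incB DB s₀≤s)) (member I a incA DA t) (<-≤-trans d₂<at₀ (increasing-≤ I a incA DA t₀≤t))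
      everywhere : ∀ {χ} → (∀ t s → LinOrder._≤I_ I t₀ t → LinOrder._≤I_ J s₀ s → Holds χ t s) →
        EventuallyIn I (λ t → EventuallyIn J (Holds χ t)) × EventuallyIn J (λ s → EventuallyIn I (λ t → Holds χ t s))
      everywhere h = (t₀ , λ t t₀≤t → s₀ , λ s s₀≤s → h t s t₀≤t s₀≤s) , (s₀ , λ s s₀≤s → t₀ , λ t t₀≤t → h t s t₀≤t s₀≤s)
      decide : Dec (Holds φ t₀ s₀) → Σ Bool λ tv →
        EventuallyIn I (λ t → EventuallyIn J (Holds (φ ^tv tv) t)) × EventuallyIn J (λ s → EventuallyIn I (λ t → Holds (φ ^tv tv) t s))
      decide (yes h) = true , everywhere {φ} (λ t s p q → Determined.invariant (determined-Sat φ) _ _ (from-base t s p q) h)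
      decide (no ¬h) = false , everywhere {neg φ} (λ t s p q h →
        ¬h (Determined.invariant (determined-Sat φ) _ _ (Agree-sym {T = Determined.tests (determined-Sat φ)} (from-base t s p q)) h))

    equivalent⇔¬perpendicular : PositivelyEquivalent 𝓕 CB CA ⇔ (¬ Perpendicular 𝓕 I a J b)
    equivalent⇔¬perpendicular = mk⇔ equivalent⇒¬perpendicular converse
      where
      converse : ¬ Perpendicular 𝓕 I a J b → PositivelyEquivalent 𝓕 CB CA
      converse ¬perp with em {PositivelyEquivalent 𝓕 CB CA}
      ... | yes equiv = equiv
      ... | no ¬equiv = ⊥-elim (¬perp (¬equivalent⇒perpendicular ¬equiv))

theorem42 : ExcludedMiddle 0ℓ →
    (F : RealClosedField) →
    (I : LinOrder) (a : Idx I → RealClosedField.Carrier F) →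
    (J : LinOrder) (b : Idx J → RealClosedField.Carrier F) →
    StrictlyIncreasing F I a → Indiscernible F I a →
    StrictlyIncreasing F J b → Indiscernible F J b →
    IsDedekind F (inducedCut F I a) → IsDedekind F (inducedCut F J b) →
    PositivelyEquivalent F (inducedCut F J b) (inducedCut F I a) ⇔ (¬ Perpendicular F I a J b)
theorem42 em F I a J b incA _ incB _ dedA dedB =
  equivalent⇔¬perpendicular I a J b incA incB (induced-dedekind I a dedA) (induced-dedekind J b dedB)
  where open Perpendicularity em F
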